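{- Let $H$ be a bipartite graph with bipartition $A \cup B$, let $r=\max_{b \in B} \deg(b)$ and, for each $1 \leq k \leq r$, let $d_k$ be the number of vertices of degree $k$ in $B$. If $\binom{|A|}{r}\binom{r}{k}$ divides $d_k$ for each $1\leq k\leq r$, then Sidorenko's conjecture holds for $H$, i.e., for every graph $G$, $t_H(G) \geq t_{K_2}(G)^{e(H)}$.
   Context: For graphs $H$ and $G$, a homomorphism from $H$ to $G$ is a map $f:V(H)\to V(G)$ sending edges to edges; $h_H(G)$ is the number of homomorphisms and $t_H(G)=h_H(G)/|V(G)|^{|V(H)|}$ is the homomorphism density. $e(H)$ is the number of edges of $H$. "Sidorenko's conjecture holds for $H$" means $t_H(G)\ge t_{K_2}(G)^{e(H)}$ for every graph $G$ (equivalently, $t_H(W)\ge t_{K_2}(W)^{e(H)}$ for every graphon $W$). -}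

module Defs where

open import Data.Bool using (Bool; true; false; _∧_; _∨_; not; T)
open import Data.Nat using (ℕ; zero; suc; _+_; _*_; _^_; _⊔_; _≤_)
import Data.Nat
import Data.Rational
open import Data.Nat.Properties using (m^n≢0)
open import Data.Nat.Divisibility using (_∣_)
open import Data.Nat.Combinatorics using (_C_)
open import Data.Fin using (Fin; zero; suc; toℕ)
open import Data.Bool.ListAction using (and)
open import Data.List using (List; []; _∷_; map; concatMap; filterᵇ; length; allFin; foldr)
open import Data.Integer using (+_)
open import Data.Rational using (ℚ; 1ℚ) renaming (_*_ to _*ℚ_; _/_ to _/ℚ_)
open import Relation.Binary.PropositionalEquality using (_≡_)

record SimpleGraph (n : ℕ) : Set where
  field
    adj   : Fin n → Fin n → Bool
    sym   : ∀ i j → adj i j ≡ adj j i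
    irrefl : ∀ i → adj i i ≡ false
open SimpleGraph public

allMaps : (m n : ℕ) → List (Fin m → Fin n)
allMaps zero    n = (λ ()) ∷ []
allMaps (suc m) n = concatMap (λ f → map (λ x → cons x f) (allFin n)) (allMaps m n)
  where
  cons : Fin n → (Fin m → Fin n) → Fin (suc m) → Fin n
  cons x f zero    = x
  cons x f (suc i) = f i

isHom : ∀ {m n} → SimpleGraph m → SimpleGraph n → (Fin m → Fin n) → Bool
isHom {m} H G f =
  and (map (λ i → and (map (λ j → not (adj H i j) ∨ adj G (f i) (f j)) (allFin m))) (allFin m))

homCount : ∀ {m n} → SimpleGraph m → SimpleGraph n → ℕ
homCount {m} {n} H G = length (filterᵇ (isHom H G) (allMaps m n))

homDensity : ∀ {m n} → SimpleGraph m → SimpleGraph (suc n) → ℚ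
homDensity {m} {n} H G = _/ℚ_ (+ homCount H G) (suc n ^ m) {{m^n≢0 (suc n) m}}

K₂ : SimpleGraph 2
K₂ = record { adj = a ; sym = s ; irrefl = ir }
  where
  a : Fin 2 → Fin 2 → Bool
  a zero zero = false
  a zero (suc zero) = true
  a (suc zero) zero = true
  a (suc zero) (suc zero) = false
  s : ∀ i j → a i j ≡ a j i
  s zero zero = _≡_.refl
  s zero (suc zero) = _≡_.refl
  s (suc zero) zero = _≡_.refl
  s (suc zero) (suc zero) = _≡_.refl
  ir : ∀ i → a i i ≡ false
  ir zero = _≡_.refl
  ir (suc zero) = _≡_.refl

edgeCount : ∀ {m} → SimpleGraph m → ℕ
edgeCount {m} H =
  length (concatMap (λ i → filterᵇ (λ j → (toℕ i Data.Nat.<ᵇ toℕ j) ∧ adj H i j) (allFin m)) (allFin m))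

_^ℚ_ : ℚ → ℕ → ℚ
q ^ℚ zero  = 1ℚ
q ^ℚ suc k = q *ℚ (q ^ℚ k)

SidorenkoHolds : ∀ {m} → SimpleGraph m → Set
SidorenkoHolds H = ∀ (n : ℕ) (G : SimpleGraph (suc n)) →
  Data.Rational._≤_ (homDensity K₂ G ^ℚ edgeCount H) (homDensity H G)

degree : ∀ {m} → SimpleGraph m → Fin m → ℕ
degree {m} H v = length (filterᵇ (adj H v) (allFin m))

-- bipartition (A, B) given by the indicator inA of A (B = complement);
-- it is a bipartition of H iff no edge has both ends on the same side
IsBipartition : ∀ {m} → SimpleGraph m → (Fin m → Bool) → Set
IsBipartition H inA = ∀ i j → T (adj H i j) → inA i ≡ not (inA j)

sideB : ∀ {m} → (Fin m → Bool) → List (Fin m)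
sideB {m} inA = filterᵇ (λ v → not (inA v)) (allFin m)

sizeA : ∀ {m} → (Fin m → Bool) → ℕ
sizeA {m} inA = length (filterᵇ inA (allFin m))

-- r = max_{b ∈ B} deg(b)   (0 if B is empty)
maxDegB : ∀ {m} → SimpleGraph m → (Fin m → Bool) → ℕ
maxDegB H inA = foldr _⊔_ 0 (map (degree H) (sideB inA))

dB : ∀ {m} → SimpleGraph m → (Fin m → Bool) → ℕ → ℕ
dB H inA k = length (filterᵇ (λ b → degree H b Data.Nat.≡ᵇ k) (sideB inA))

{-# OPTIONS --safe #-}
module Submission where

-- Write f_S(x) = Σ_y Π_{i∈S} W(x_i, y) for x ∈ V^A, so that hom(H, G) = Σ_x Π_{b∈B} f_{N(b)}(x).
-- AM-GM over the permutations of A bounds this below by the sum of the symmetrised product,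
-- which the divisibility hypothesis writes as Π_R F_R(x), R running over the r-subsets of A and
-- F_R being a product of integral powers of the f_S with S ⊆ R.
-- If i, j ∈ R then F_R is a positive semidefinite kernel in (x_i, x_j), so Cauchy–Schwarz reflects a
-- set of factors F_R in the transposition (i j). A sorting network of such reflections turns any
-- set of factors into all or none of them, which gives E Π_R F_R ≥ (E F_{R₀})^(a choose r).
-- Finally F_{R₀} contains f_{R₀}, that is, a vertex joined to all of R₀, and Hölder's inequality over
-- the stars centred at this vertex shows that E F_{R₀} is at least the required power of the edge density.

open import Defs hiding (sym)
open import Algebra.Structures using (IsCommutativeMonoid)
open import Data.Bool using (Bool; true; false; if_then_else_; _∧_; _∨_; not; T; T?)
open import Data.Bool.ListAction using (and)
open import Data.Empty using (⊥; ⊥-elim)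
open import Data.Fin using (Fin; zero; suc; toℕ)
open import Data.Fin.Properties using (toℕ<n; toℕ-injective)
import Data.Integer as ℤ
import Data.Integer.Properties as ℤ
open import Data.List using (List; []; _∷_; map; concatMap; _++_; length; replicate; filterᵇ; allFin; tabulate; foldr)
open import Data.List.Membership.Propositional using (_∈_)
open import Data.List.Membership.Propositional.Properties using (∈-++⁻; ∈-concatMap⁻; ∈-allFin; ∈-filter⁻; ∈-map⁺; ∈-map⁻)
open import Data.List.Properties using (length-tabulate; length-map)
open import Data.List.Relation.Unary.Any using (here; there; satisfied)
open import Data.Nat
open import Data.Nat.Combinatorics using (_C_; nCn≡1; nCk+nC[k+1]≡[n+1]C[k+1])
open import Data.Nat.DivMod using (m/n*n≡m)
open import Data.Nat.Divisibility using (_∣_; quotient; ∣-trans; m∣m*n; n∣m*n; m≤n⇒m!∣n!; 0∣⇒≡0)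
open import Data.Nat.Properties
open import Data.Nat.Tactic.RingSolver using (solve-∀)
open import Data.Product using (_×_; _,_; proj₁; proj₂; ∃)
import Data.Rational as ℚ
import Data.Rational.Properties as ℚ
import Data.Rational.Unnormalised as ℚᵘ
import Data.Rational.Unnormalised.Properties as ℚᵘ
open import Data.Sum using (_⊎_; inj₁; inj₂; [_,_]′)
open import Data.Unit using (tt)
open import Data.Vec as Vec using (Vec; []; _∷_; lookup)
open import Data.Vec.Properties using (lookup∘tabulate)
open import Function using (_∘_)
open import Relation.Binary.Definitions using (tri<; tri≈; tri>)
open import Relation.Binary.PropositionalEquality
open import Relation.Nullary using (¬_; contradiction; yes; no)

-- Divisibility makes all exponents integral: with q_k = d_k / (C(a,r) C(r,k)), every r-set receives
-- q_k copies of each of its k-subsets, and vertices of degree 0 in B split off as powers of n. The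
-- vertex joined to all of R₀ exists because the maximum r is attained, so q_r ≥ 1. The obstacle is
-- that Cauchy-Schwarz bounds a family 𝓢 of factors only by the geometric mean of its two
-- reflections, and either one alone may be smaller. Hence, when G has an edge, the potential (E
-- Π_{R∈𝓢} F_R)^D / (E Π_R F_R)^|𝓢| with D = C(a,r). The two reflections together have 2|𝓢| members,
-- so the square of the potential is still at most the product of its values at them. It equals 1 at
-- the empty and at the full family and is bounded, so an extremal argument shows that it never
-- exceeds 1. The family {R₀} then gives the inequality. Everything stays in ℕ: densities are
-- cleared of denominators, a reciprocal 1/d with 1 ≤ d ≤ n becomes n!/d, and roots are replaced by
-- comparisons of powers.

-- Sums and products over lists, from one commutative-monoid template

module BigOp (_∙_ : ℕ → ℕ → ℕ) (ε : ℕ) (isCM : IsCommutativeMonoid _≡_ _∙_ ε) where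

  open IsCommutativeMonoid isCM using (assoc; comm; identityˡ)
  open ≡-Reasoning

  ⨁ : {A : Set} → List A → (A → ℕ) → ℕ
  ⨁ []       f = ε
  ⨁ (x ∷ xs) f = f x ∙ ⨁ xs f

  medial : ∀ a b c d → (a ∙ b) ∙ (c ∙ d) ≡ (a ∙ c) ∙ (b ∙ d)
  medial a b c d = begin
    (a ∙ b) ∙ (c ∙ d) ≡⟨ assoc a b (c ∙ d) ⟩
    a ∙ (b ∙ (c ∙ d)) ≡⟨ cong (a ∙_) (sym (assoc b c d)) ⟩
    a ∙ ((b ∙ c) ∙ d) ≡⟨ cong (λ z → a ∙ (z ∙ d)) (comm b c) ⟩
    a ∙ ((c ∙ b) ∙ d) ≡⟨ cong (a ∙_) (assoc c b d) ⟩
    a ∙ (c ∙ (b ∙ d)) ≡⟨ sym (assoc a c (b ∙ d)) ⟩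
    (a ∙ c) ∙ (b ∙ d) ∎

  ⨁-cong-∈ : {A : Set} (xs : List A) {f g : A → ℕ} → (∀ {x} → x ∈ xs → f x ≡ g x) → ⨁ xs f ≡ ⨁ xs g
  ⨁-cong-∈ []       eq = refl
  ⨁-cong-∈ (x ∷ xs) eq = cong₂ _∙_ (eq (here refl)) (⨁-cong-∈ xs (eq ∘ there))

  ⨁-cong : {A : Set} (xs : List A) {f g : A → ℕ} → (∀ x → f x ≡ g x) → ⨁ xs f ≡ ⨁ xs g
  ⨁-cong xs eq = ⨁-cong-∈ xs (λ {x} _ → eq x)

  ⨁-ε : {A : Set} (xs : List A) → ⨁ xs (λ _ → ε) ≡ ε
  ⨁-ε []       = refl
  ⨁-ε (x ∷ xs) = trans (identityˡ _) (⨁-ε xs)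

  ⨁-∙ : {A : Set} (xs : List A) (f g : A → ℕ) → ⨁ xs (λ x → f x ∙ g x) ≡ ⨁ xs f ∙ ⨁ xs g
  ⨁-∙ []       f g = sym (identityˡ ε)
  ⨁-∙ (x ∷ xs) f g = trans (cong ((f x ∙ g x) ∙_) (⨁-∙ xs f g)) (medial (f x) (g x) _ _)

  ⨁-swap : {A B : Set} (xs : List A) (ys : List B) (f : A → B → ℕ) →
    ⨁ xs (λ x → ⨁ ys (f x)) ≡ ⨁ ys (λ y → ⨁ xs (λ x → f x y))
  ⨁-swap []       ys f = sym (⨁-ε ys)
  ⨁-swap (x ∷ xs) ys f =
    trans (cong (⨁ ys (f x) ∙_) (⨁-swap xs ys f)) (sym (⨁-∙ ys (f x) _))

  ⨁-++ : {A : Set} (xs ys : List A) (f : A → ℕ) → ⨁ (xs ++ ys) f ≡ ⨁ xs f ∙ ⨁ ys f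
  ⨁-++ []       ys f = sym (identityˡ _)
  ⨁-++ (x ∷ xs) ys f = trans (cong (f x ∙_) (⨁-++ xs ys f)) (sym (assoc _ _ _))

  ⨁-map : {A B : Set} (h : A → B) (xs : List A) (f : B → ℕ) → ⨁ (map h xs) f ≡ ⨁ xs (f ∘ h)
  ⨁-map h []       f = refl
  ⨁-map h (x ∷ xs) f = cong (f (h x) ∙_) (⨁-map h xs f)

  ⨁-concatMap : {A B : Set} (h : A → List B) (xs : List A) (f : B → ℕ) →
    ⨁ (concatMap h xs) f ≡ ⨁ xs (λ x → ⨁ (h x) f)
  ⨁-concatMap h []       f = refl
  ⨁-concatMap h (x ∷ xs) f =
    trans (⨁-++ (h x) (concatMap h xs) f) (cong (⨁ (h x) f ∙_) (⨁-concatMap h xs f))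

module Sum = BigOp _+_ 0 +-0-isCommutativeMonoid
module Prod = BigOp _*_ 1 *-1-isCommutativeMonoid

open Sum using () renaming
  ( ⨁ to ∑; ⨁-cong to ∑-cong; ⨁-ε to ∑-0; ⨁-∙ to ∑-+; ⨁-swap to ∑-swap
  ; ⨁-++ to ∑-++; ⨁-map to ∑-map; ⨁-concatMap to ∑-concatMap )
open Prod using () renaming
  ( ⨁ to ∏; ⨁-cong-∈ to ∏-cong-∈; ⨁-cong to ∏-cong; ⨁-ε to ∏-1; ⨁-∙ to ∏-*; ⨁-swap to ∏-swap
  ; ⨁-++ to ∏-++; ⨁-map to ∏-map; ⨁-concatMap to ∏-concatMap; medial to *-medial )

∑-*ˡ : {A : Set} (xs : List A) (c : ℕ) (f : A → ℕ) → ∑ xs (λ x → c * f x) ≡ c * ∑ xs f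
∑-*ˡ []       c f = sym (*-zeroʳ c)
∑-*ˡ (x ∷ xs) c f = trans (cong (c * f x +_) (∑-*ˡ xs c f)) (sym (*-distribˡ-+ c (f x) _))

∑-*ʳ : {A : Set} (xs : List A) (f : A → ℕ) (c : ℕ) → ∑ xs (λ x → f x * c) ≡ ∑ xs f * c
∑-*ʳ xs f c = trans (∑-cong xs (λ x → *-comm (f x) c)) (trans (∑-*ˡ xs c f) (*-comm c _))

∑-const : {A : Set} (xs : List A) (c : ℕ) → ∑ xs (λ _ → c) ≡ length xs * c
∑-const []       c = refl
∑-const (x ∷ xs) c = cong (c +_) (∑-const xs c)

∏-const : {A : Set} (xs : List A) (c : ℕ) → ∏ xs (λ _ → c) ≡ c ^ length xs
∏-const []       c = refl
∏-const (x ∷ xs) c = cong (c *_) (∏-const xs c)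

∑-mono-∈ : {A : Set} (xs : List A) {f g : A → ℕ} → (∀ {x} → x ∈ xs → f x ≤ g x) → ∑ xs f ≤ ∑ xs g
∑-mono-∈ []       le = z≤n
∑-mono-∈ (x ∷ xs) le = +-mono-≤ (le (here refl)) (∑-mono-∈ xs (le ∘ there))

∑-mono : {A : Set} (xs : List A) {f g : A → ℕ} → (∀ x → f x ≤ g x) → ∑ xs f ≤ ∑ xs g
∑-mono xs le = ∑-mono-∈ xs (λ {x} _ → le x)

∏-mono : {A : Set} (xs : List A) {f g : A → ℕ} → (∀ x → f x ≤ g x) → ∏ xs f ≤ ∏ xs g
∏-mono []       le = s≤s z≤n
∏-mono (x ∷ xs) le = *-mono-≤ (le x) (∏-mono xs le)

∏-pos : {A : Set} (xs : List A) {f : A → ℕ} → (∀ x → 1 ≤ f x) → 1 ≤ ∏ xs f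
∏-pos xs {f} le = subst (_≤ ∏ xs f) (∏-1 xs) (∏-mono xs le)

∈⇒≤∑ : {A : Set} {xs : List A} {x : A} (f : A → ℕ) → x ∈ xs → f x ≤ ∑ xs f
∈⇒≤∑ f (here refl) = m≤m+n _ _
∈⇒≤∑ {xs = z ∷ _} f (there x∈) = ≤-trans (∈⇒≤∑ f x∈) (m≤n+m _ (f z))

^-distribʳ-* : ∀ a b n → (a * b) ^ n ≡ a ^ n * b ^ n
^-distribʳ-* a b zero    = refl
^-distribʳ-* a b (suc n) = trans (cong (a * b *_) (^-distribʳ-* a b n)) (*-medial a b (a ^ n) (b ^ n))

∏-^ : {A : Set} (xs : List A) (f : A → ℕ) (n : ℕ) → ∏ xs (λ x → f x ^ n) ≡ ∏ xs f ^ n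
∏-^ []       f n = sym (^-zeroˡ n)
∏-^ (x ∷ xs) f n = trans (cong (f x ^ n *_) (∏-^ xs f n)) (sym (^-distribʳ-* (f x) _ n))

^-∑ : {A : Set} (c : ℕ) (xs : List A) (f : A → ℕ) → ∏ xs (λ x → c ^ f x) ≡ c ^ ∑ xs f
^-∑ c []       f = refl
^-∑ c (x ∷ xs) f = trans (cong (c ^ f x *_) (^-∑ c xs f)) (sym (^-distribˡ-+-* c (f x) _))

^-cancelˡ-≤ : ∀ n {a b} → 1 ≤ n → a ^ n ≤ b ^ n → a ≤ b
^-cancelˡ-≤ n@(suc _) _ le = ≮⇒≥ (λ b<a → <⇒≱ (^-monoˡ-< n b<a) le)

-- AM-GM, Hölder and Cauchy-Schwarz over the naturals

2uv≤u²+v² : ∀ u v → 2 * (u * v) ≤ u * u + v * v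
2uv≤u²+v² u v with ≤-total u v
... | inj₁ u≤v = subst (λ w → 2 * (u * w) ≤ u * u + w * w) (m+[n∸m]≡n u≤v)
                   (subst (2 * (u * (u + d)) ≤_) (id₁ u d) (m≤m+n _ (d * d)))
  where
  d = v ∸ u
  id₁ : ∀ u d → 2 * (u * (u + d)) + d * d ≡ u * u + (u + d) * (u + d)
  id₁ = solve-∀
... | inj₂ v≤u = subst (λ w → 2 * (w * v) ≤ w * w + v * v) (m+[n∸m]≡n v≤u)
                   (subst (2 * ((v + d) * v) ≤_) (id₁ v d) (m≤m+n _ (d * d)))
  where
  d = u ∸ v
  id₁ : ∀ v d → 2 * ((v + d) * v) + d * d ≡ (v + d) * (v + d) + v * v
  id₁ = solve-∀

-- Convexity of the power `suc n`, homogenised. The induction multiplies `2uv≤u²+v²` by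
-- `suc n * u ^ n` and applies the hypothesis to `u ^ n * v`; the surplus `n * (u * U * v)`, added
-- to both sides beforehand, cancels.
young : ∀ n u v → suc n * (u ^ n * v) ≤ n * u ^ suc n + v ^ suc n
young zero    u v = ≤-reflexive (id₁ v)
  where
  id₁ : ∀ v → 1 * (1 * v) ≡ v * 1
  id₁ = solve-∀
young (suc n) u v = +-cancelʳ-≤ (n * (u * U * v)) _ _ (begin
  suc (suc n) * (u * U * v) + n * (u * U * v)         ≡⟨ id₁ n u v U ⟩
  suc n * U * (2 * (u * v))                           ≤⟨ *-monoʳ-≤ (suc n * U) (2uv≤u²+v² u v) ⟩
  suc n * U * (u * u + v * v)                         ≡⟨ id₂ n u v U ⟩
  suc n * (u * (u * U)) + suc n * (U * v) * v         ≤⟨ +-monoʳ-≤ (suc n * (u * (u * U))) (*-monoˡ-≤ v (young n u v)) ⟩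
  suc n * (u * (u * U)) + (n * (u * U) + v * V) * v   ≡⟨ id₃ n u v U V ⟩
  suc n * (u * (u * U)) + v * (v * V) + n * (u * U * v) ∎)
  where
  open ≤-Reasoning
  U = u ^ n
  V = v ^ n
  id₁ : ∀ n u v U → suc (suc n) * (u * U * v) + n * (u * U * v) ≡ suc n * U * (2 * (u * v))
  id₁ = solve-∀
  id₂ : ∀ n u v U → suc n * U * (u * u + v * v) ≡ suc n * (u * (u * U)) + suc n * (U * v) * v
  id₂ = solve-∀
  id₃ : ∀ n u v U V → suc n * (u * (u * U)) + (n * (u * U) + v * V) * v
        ≡ suc n * (u * (u * U)) + v * (v * V) + n * (u * U * v)
  id₃ = solve-∀

-- This adds one number `a` to n numbers of sum `s`. In `young` take `u = suc n * s` and
-- `v = n * (s + a)`: then `suc n * (u ^ n * v)` splits off `n * u ^ suc n`, which cancels, and what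
-- remains is the claim times `n`.
amgm-step : ∀ n s a → suc n ^ suc n * (s ^ n * a) ≤ n ^ n * (s + a) ^ suc n
amgm-step zero    s a = subst₂ _≤_ (id₁ a) (id₂ s a) (m≤n+m a s)
  where
  id₁ : ∀ a → a ≡ 1 * 1 * (1 * a)
  id₁ = solve-∀
  id₂ : ∀ s a → s + a ≡ 1 * ((s + a) * 1)
  id₂ = solve-∀
amgm-step n@(suc _) s a = *-cancelˡ-≤ n (+-cancelˡ-≤ (n * (u * u ^ n)) _ _ (begin
  n * (u * u ^ n) + n * (suc n * suc n ^ n * (s ^ n * a)) ≡⟨ cong (λ z → n * (u * u ^ n) + n * z) (id₁ (suc n) (suc n ^ n) (s ^ n) a) ⟩
  n * (u * u ^ n) + n * (suc n * (suc n ^ n * s ^ n * a)) ≡⟨ cong (λ z → n * (u * u ^ n) + n * (suc n * (z * a))) (sym (^-distribʳ-* (suc n) s n)) ⟩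
  n * (u * u ^ n) + n * (suc n * (u ^ n * a)) ≡⟨ id₂ n s a (u ^ n) ⟩
  suc n * (u ^ n * v)                    ≤⟨ young n u v ⟩
  n * (u * u ^ n) + v ^ suc n            ≡⟨ cong (n * (u * u ^ n) +_) (^-distribʳ-* n (s + a) (suc n)) ⟩
  n * (u * u ^ n) + n * n ^ n * (s + a) ^ suc n  ≡⟨ cong (n * (u * u ^ n) +_) (*-assoc n (n ^ n) _) ⟩
  n * (u * u ^ n) + n * (n ^ n * (s + a) ^ suc n) ∎))
  where
  open ≤-Reasoning
  u = suc n * s
  v = n * (s + a)
  id₁ : ∀ m M S a → m * M * (S * a) ≡ m * (M * S * a)
  id₁ = solve-∀
  id₂ : ∀ n s a U → n * (suc n * s * U) + n * (suc n * (U * a)) ≡ suc n * (U * (n * (s + a)))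
  id₂ = solve-∀

amgm : {A : Set} (xs : List A) (f : A → ℕ) → length xs ^ length xs * ∏ xs f ≤ ∑ xs f ^ length xs
amgm []       f = s≤s z≤n
amgm (x ∷ xs) f = *-cancelˡ-≤ (n ^ n) {{n^n≢0 n}} (begin
  n ^ n * (suc n ^ suc n * (f x * ∏ xs f))    ≡⟨ id₁ (n ^ n) (suc n ^ suc n) (f x) (∏ xs f) ⟩
  suc n ^ suc n * (n ^ n * ∏ xs f * f x)      ≤⟨ *-monoʳ-≤ (suc n ^ suc n) (*-monoˡ-≤ (f x) (amgm xs f)) ⟩
  suc n ^ suc n * (∑ xs f ^ n * f x)          ≤⟨ amgm-step n (∑ xs f) (f x) ⟩
  n ^ n * (∑ xs f + f x) ^ suc n              ≡⟨ cong (λ z → n ^ n * z ^ suc n) (+-comm (∑ xs f) (f x)) ⟩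
  n ^ n * (f x + ∑ xs f) ^ suc n              ∎)
  where
  open ≤-Reasoning
  n = length xs
  n^n≢0 : ∀ n → NonZero (n ^ n)
  n^n≢0 zero    = _
  n^n≢0 (suc n) = m^n≢0 (suc n) (suc n)
  id₁ : ∀ N M a p → N * (M * (a * p)) ≡ M * (N * p * a)
  id₁ = solve-∀

0^n≡0 : ∀ {n} → 1 ≤ n → 0 ^ n ≡ 0
0^n≡0 (s≤s _) = refl

module _ (e k l : ℕ) (1≤e : 1 ≤ e) where

  -- Morally d ≤ λa and d′ ≤ λb with λ = (l/k)^(1/e). The root is avoided by letting d/a be the
  -- larger ratio: the mediant (d+d′)/(a+b) is at most d/a, so the first bound suffices. If `a` is
  -- 0, that bound forces `k` or `d` to be 0.
  dominated-+-ordered : ∀ {a b d d′} → d′ * a ≤ d * b → k * d ^ e ≤ l * a ^ e → k * d′ ^ e ≤ l * b ^ e →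
    k * (d + d′) ^ e ≤ l * (a + b) ^ e
  dominated-+-ordered {zero} {b} {d} {d′} _ le le′ with m*n≡0⇒m≡0∨n≡0 k (n≤0⇒n≡0 (≤-trans le (≤-reflexive (trans (cong (l *_) (0^n≡0 1≤e)) (*-zeroʳ l)))))
  ... | inj₁ refl = z≤n
  ... | inj₂ d^e≡0 rewrite m^n≡0⇒m≡0 d e d^e≡0 = le′
  dominated-+-ordered {a@(suc _)} {b} {d} {d′} cross le _ = *-cancelʳ-≤ _ _ (a ^ e) {{m^n≢0 a e}} (begin
    k * (d + d′) ^ e * a ^ e     ≡⟨ *-assoc k _ _ ⟩
    k * ((d + d′) ^ e * a ^ e)   ≡⟨ cong (k *_) (sym (^-distribʳ-* (d + d′) a e)) ⟩
    k * ((d + d′) * a) ^ e       ≤⟨ *-monoʳ-≤ k (^-monoˡ-≤ e cross′) ⟩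
    k * (d * (a + b)) ^ e        ≡⟨ cong (k *_) (^-distribʳ-* d (a + b) e) ⟩
    k * (d ^ e * (a + b) ^ e)    ≡⟨ sym (*-assoc k _ _) ⟩
    k * d ^ e * (a + b) ^ e      ≤⟨ *-monoˡ-≤ ((a + b) ^ e) le ⟩
    l * a ^ e * (a + b) ^ e      ≡⟨ *-assoc l _ _ ⟩
    l * (a ^ e * (a + b) ^ e)    ≡⟨ cong (l *_) (*-comm (a ^ e) _) ⟩
    l * ((a + b) ^ e * a ^ e)    ≡⟨ sym (*-assoc l _ _) ⟩
    l * (a + b) ^ e * a ^ e      ∎)
    where
    open ≤-Reasoning
    cross′ : (d + d′) * a ≤ d * (a + b)
    cross′ = subst₂ _≤_ (sym (*-distribʳ-+ a d d′)) (sym (*-distribˡ-+ d a b)) (+-monoʳ-≤ (d * a) cross)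

  dominated-+ : ∀ {a b d d′} → k * d ^ e ≤ l * a ^ e → k * d′ ^ e ≤ l * b ^ e →
    k * (d + d′) ^ e ≤ l * (a + b) ^ e
  dominated-+ {a} {b} {d} {d′} le le′ with ≤-total (d′ * a) (d * b)
  ... | inj₁ cross = dominated-+-ordered cross le le′
  ... | inj₂ cross = subst₂ (λ s t → k * s ^ e ≤ l * t ^ e) (+-comm d′ d) (+-comm b a) (dominated-+-ordered cross le′ le)

  dominated-∑ : {Y : Set} (ys : List Y) (d a : Y → ℕ) → (∀ y → y ∈ ys → k * d y ^ e ≤ l * a y ^ e) →
    k * ∑ ys d ^ e ≤ l * ∑ ys a ^ e
  dominated-∑ []       d a le = ≤-trans (≤-reflexive (trans (cong (k *_) (0^n≡0 1≤e)) (*-zeroʳ k))) z≤n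
  dominated-∑ (y ∷ ys) d a le = dominated-+ (le y (here refl)) (dominated-∑ ys d a (λ z z∈ → le z (there z∈)))

-- An integral substitute for the weight 1/t, scaled by a multiple `p` of `t`; the value at `t = 0`
-- is a default.
cofactor : ℕ → ℕ → ℕ
cofactor p zero    = 0
cofactor p (suc t) = p / suc t

∈⇒∣∏ : {A : Set} {xs : List A} {x : A} (f : A → ℕ) → x ∈ xs → f x ∣ ∏ xs f
∈⇒∣∏ f (here refl)        = m∣m*n _
∈⇒∣∏ {xs = z ∷ _} f (there x∈) = ∣-trans (∈⇒∣∏ f x∈) (n∣m*n (f z))

cofactor-* : ∀ p t .{{_ : NonZero p}} → t ∣ p → cofactor p t * t ≡ p
cofactor-* p zero    t∣p = ⊥-elim (≢-nonZero⁻¹ p (0∣⇒≡0 t∣p))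
cofactor-* p (suc t) t∣p = m/n*n≡m t∣p

-- Normalising each factor by its total, AM-GM bounds D y by the arithmetic mean of the
-- normalised factors, and these means add up to 1.
hölder : {J Y : Set} (js : List J) (ys : List Y) (U : J → Y → ℕ) (t : J → ℕ) (c : ℕ) (D : Y → ℕ) →
  1 ≤ length js →
  (∀ y → c * D y ^ length js ≤ ∏ js (λ j → U j y)) →
  (∀ {j} → j ∈ js → ∑ ys (U j) ≤ t j) →
  c * ∑ ys D ^ length js ≤ ∏ js t
hölder {J} {Y} js ys U t c D 1≤e le tot with ∏ js t ≟ 0
-- Some total `t j` is 0, so `U j` vanishes on `ys` and every `c * D y ^ e` is 0; domination by the
-- zero function passes this on to the sum.
... | yes p≡0 = ≤-trans (dominated-∑ e c 0 1≤e ys D (λ _ → 0) λ y y∈ → ≤-trans (le y) (≤-reflexive (zero-factor js p≡0 tot y y∈))) z≤n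
  where
  e = length js
  zero-factor : (xs : List J) → ∏ xs t ≡ 0 → (∀ {j} → j ∈ xs → ∑ ys (U j) ≤ t j) → ∀ y → y ∈ ys → ∏ xs (λ j → U j y) ≡ 0
  zero-factor (x ∷ xs) eq tot y y∈ with m*n≡0⇒m≡0∨n≡0 (t x) eq
  ... | inj₁ tx≡0 = cong (_* ∏ xs (λ j → U j y)) (n≤0⇒n≡0 (≤-trans (∈⇒≤∑ (U x) y∈) (≤-trans (tot (here refl)) (≤-reflexive tx≡0))))
  ... | inj₂ eq′  = trans (cong (U x y *_) (zero-factor xs eq′ (tot ∘ there) y y∈)) (*-zeroʳ (U x y))
... | no p≢0 = *-cancelʳ-≤ _ _ ((e * p) ^ e) {{m^n≢0 (e * p) e {{m*n≢0 e p {{>-nonZero 1≤e}} {{≢-nonZero p≢0}}}}}} (begin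
  c * ∑ ys D ^ e * (e * p) ^ e         ≡⟨ id₁ c (∑ ys D ^ e) ((e * p) ^ e) ⟩
  (e * p) ^ e * c * ∑ ys D ^ e         ≤⟨ dominated-∑ e ((e * p) ^ e * c) p 1≤e ys D mean (λ y _ → pointwise y) ⟩
  p * ∑ ys mean ^ e                    ≤⟨ *-monoʳ-≤ p (^-monoˡ-≤ e total) ⟩
  p * (e * p) ^ e                      ∎)
  where
  open ≤-Reasoning
  e = length js
  p = ∏ js t
  instance
    p≠0 : NonZero p
    p≠0 = ≢-nonZero p≢0
  w : J → ℕ
  w j = cofactor p (t j)
  w*t : ∀ {j} → j ∈ js → w j * t j ≡ p
  w*t j∈ = cofactor-* p (t _) (∈⇒∣∏ t j∈)
  mean : Y → ℕ
  mean y = ∑ js (λ j → w j * U j y)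
  id₁ : ∀ a b d → a * b * d ≡ d * a * b
  id₁ = solve-∀
  total : ∑ ys mean ≤ e * p
  total = begin
    ∑ ys mean                               ≡⟨ ∑-swap ys js _ ⟩
    ∑ js (λ j → ∑ ys (λ y → w j * U j y))   ≡⟨ ∑-cong js (λ j → ∑-*ˡ ys (w j) (U j)) ⟩
    ∑ js (λ j → w j * ∑ ys (U j))           ≤⟨ ∑-mono-∈ js (λ {j} j∈ → ≤-trans (*-monoʳ-≤ (w j) (tot j∈)) (≤-reflexive (w*t j∈))) ⟩
    ∑ js (λ _ → p)                          ≡⟨ ∑-const js p ⟩
    e * p                                   ∎
  w^ : p ^ e ≡ p * ∏ js w
  w^ = begin-equality
    p ^ e                     ≡⟨ sym (∏-const js p) ⟩
    ∏ js (λ _ → p)            ≡⟨ ∏-cong-∈ js (λ j∈ → sym (w*t j∈)) ⟩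
    ∏ js (λ j → w j * t j)    ≡⟨ ∏-* js w t ⟩
    ∏ js w * p                ≡⟨ *-comm _ p ⟩
    p * ∏ js w                ∎
  id₂ : ∀ e p c d → e * p * c * d ≡ e * (p * (c * d))
  id₂ = solve-∀
  id₃ : ∀ E p w u → E * (p * w * u) ≡ p * (E * (w * u))
  id₃ = solve-∀
  pointwise : ∀ y → (e * p) ^ e * c * D y ^ e ≤ p * mean y ^ e
  pointwise y = begin
    (e * p) ^ e * c * D y ^ e                 ≡⟨ cong (λ z → z * c * D y ^ e) (^-distribʳ-* e p e) ⟩
    e ^ e * p ^ e * c * D y ^ e               ≡⟨ id₂ (e ^ e) (p ^ e) c (D y ^ e) ⟩
    e ^ e * (p ^ e * (c * D y ^ e))           ≤⟨ *-monoʳ-≤ (e ^ e) (*-monoʳ-≤ (p ^ e) (le y)) ⟩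
    e ^ e * (p ^ e * ∏ js (λ j → U j y))      ≡⟨ cong (λ z → e ^ e * (z * ∏ js (λ j → U j y))) w^ ⟩
    e ^ e * (p * ∏ js w * ∏ js (λ j → U j y)) ≡⟨ id₃ (e ^ e) p (∏ js w) _ ⟩
    p * (e ^ e * (∏ js w * ∏ js (λ j → U j y))) ≡⟨ cong (λ z → p * (e ^ e * z)) (sym (∏-* js w _)) ⟩
    p * (e ^ e * ∏ js (λ j → w j * U j y))    ≤⟨ *-monoʳ-≤ p (amgm js _) ⟩
    p * mean y ^ e                            ∎

-- Hölder with the two factors `A` and `B`, indexed by the Booleans.
cauchy-schwarz : {Y : Set} (ys : List Y) (D A B : Y → ℕ) → (∀ y → D y * D y ≤ A y * B y) →
  ∑ ys D * ∑ ys D ≤ ∑ ys A * ∑ ys B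
cauchy-schwarz ys D A B le = subst₂ _≤_ (id₁ (∑ ys D)) (id₂ (∑ ys A) (∑ ys B))
  (hölder (true ∷ false ∷ []) ys (λ j → if j then A else B) (λ j → if j then ∑ ys A else ∑ ys B) 1 D (s≤s z≤n)
    (λ y → subst₂ _≤_ (sym (id₁ (D y))) (sym (id₂ (A y) (B y))) (le y))
    λ { {true} _ → ≤-refl ; {false} _ → ≤-refl })
  where
  id₁ : ∀ d → 1 * (d * (d * 1)) ≡ d * d
  id₁ = solve-∀
  id₂ : ∀ a b → a * (b * 1) ≡ a * b
  id₂ = solve-∀

-- Vectors and their adjacent coordinates

vecs : {A : Set} → List A → (a : ℕ) → List (Vec A a)
vecs xs zero    = [] ∷ []
vecs xs (suc a) = concatMap (λ v → map (v ∷_) (vecs xs a)) xs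

-- A position in a vector of length a that has a successor.
data Pos : ℕ → Set where
  here  : ∀ {a} → Pos (suc (suc a))
  there : ∀ {a} → Pos a → Pos (suc a)

rest : ∀ {a} → Pos a → ℕ
rest (here {a}) = a
rest (there p)  = suc (rest p)

-- Separates two adjacent coordinates from the others. Tuples of vertices and characteristic vectors
-- are split by the same operation, so one position `p` serves both in the Cauchy-Schwarz argument.
insert₂ : {A : Set} {a : ℕ} (p : Pos a) → Vec A (rest p) → A → A → Vec A a
insert₂ here      o       u v = u ∷ v ∷ o
insert₂ (there p) (w ∷ o) u v = w ∷ insert₂ p o u v

swap : {A : Set} {a : ℕ} → Pos a → Vec A a → Vec A a
swap here      (u ∷ v ∷ o) = v ∷ u ∷ o
swap (there p) (w ∷ o)     = w ∷ swap p o

swap-insert₂ : {A : Set} {a : ℕ} (p : Pos a) (o : Vec A (rest p)) (u v : A) →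
  swap p (insert₂ p o u v) ≡ insert₂ p o v u
swap-insert₂ here      o       u v = refl
swap-insert₂ (there p) (w ∷ o) u v = cong (w ∷_) (swap-insert₂ p o u v)

module VecsBigOp (_∙_ : ℕ → ℕ → ℕ) (ε : ℕ) (isCM : IsCommutativeMonoid _≡_ _∙_ ε) where

  open BigOp _∙_ ε isCM

  ⨁-vecs-suc : {A : Set} (xs : List A) (a : ℕ) (f : Vec A (suc a) → ℕ) →
    ⨁ (vecs xs (suc a)) f ≡ ⨁ xs (λ v → ⨁ (vecs xs a) (λ w → f (v ∷ w)))
  ⨁-vecs-suc xs a f = trans (⨁-concatMap _ xs f) (⨁-cong xs λ v → ⨁-map (v ∷_) (vecs xs a) f)

  ⨁-vecs-insert₂ : {A : Set} (xs : List A) {a : ℕ} (p : Pos a) (f : Vec A a → ℕ) →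
    ⨁ (vecs xs a) f ≡ ⨁ (vecs xs (rest p)) (λ o → ⨁ xs (λ u → ⨁ xs (λ v → f (insert₂ p o u v))))
  ⨁-vecs-insert₂ xs {suc (suc a)} here f = begin
    ⨁ (vecs xs (suc (suc a))) f
      ≡⟨ ⨁-vecs-suc xs (suc a) f ⟩
    ⨁ xs (λ u → ⨁ (vecs xs (suc a)) (λ w → f (u ∷ w)))
      ≡⟨ ⨁-cong xs (λ u → ⨁-vecs-suc xs a _) ⟩
    ⨁ xs (λ u → ⨁ xs (λ v → ⨁ (vecs xs a) (λ o → f (u ∷ v ∷ o))))
      ≡⟨ ⨁-cong xs (λ u → ⨁-swap xs (vecs xs a) _) ⟩
    ⨁ xs (λ u → ⨁ (vecs xs a) (λ o → ⨁ xs (λ v → f (u ∷ v ∷ o))))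
      ≡⟨ ⨁-swap xs (vecs xs a) _ ⟩
    ⨁ (vecs xs a) (λ o → ⨁ xs (λ u → ⨁ xs (λ v → f (u ∷ v ∷ o)))) ∎
    where open ≡-Reasoning
  ⨁-vecs-insert₂ xs {suc a} (there p) f = begin
    ⨁ (vecs xs (suc a)) f
      ≡⟨ ⨁-vecs-suc xs a f ⟩
    ⨁ xs (λ w → ⨁ (vecs xs a) (λ o → f (w ∷ o)))
      ≡⟨ ⨁-cong xs (λ w → ⨁-vecs-insert₂ xs p _) ⟩
    ⨁ xs (λ w → ⨁ (vecs xs (rest p)) (λ o → ⨁ xs (λ u → ⨁ xs (λ v → f (w ∷ insert₂ p o u v)))))
      ≡⟨ sym (⨁-vecs-suc xs (rest p) _) ⟩
    ⨁ (vecs xs (suc (rest p))) (λ o → ⨁ xs (λ u → ⨁ xs (λ v → f (insert₂ (there p) o u v)))) ∎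
    where open ≡-Reasoning

  ⨁-vecs-swap : {A : Set} (xs : List A) {a : ℕ} (p : Pos a) (f : Vec A a → ℕ) →
    ⨁ (vecs xs a) (f ∘ swap p) ≡ ⨁ (vecs xs a) f
  ⨁-vecs-swap xs {a} p f = begin
    ⨁ (vecs xs a) (f ∘ swap p)
      ≡⟨ ⨁-vecs-insert₂ xs p _ ⟩
    ⨁ (vecs xs (rest p)) (λ o → ⨁ xs (λ u → ⨁ xs (λ v → f (swap p (insert₂ p o u v)))))
      ≡⟨ ⨁-cong (vecs xs (rest p)) (λ o → ⨁-cong xs λ u → ⨁-cong xs λ v → cong f (swap-insert₂ p o u v)) ⟩
    ⨁ (vecs xs (rest p)) (λ o → ⨁ xs (λ u → ⨁ xs (λ v → f (insert₂ p o v u))))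
      ≡⟨ ⨁-cong (vecs xs (rest p)) (λ o → ⨁-swap xs xs _) ⟩
    ⨁ (vecs xs (rest p)) (λ o → ⨁ xs (λ v → ⨁ xs (λ u → f (insert₂ p o v u))))
      ≡⟨ sym (⨁-vecs-insert₂ xs p f) ⟩
    ⨁ (vecs xs a) f ∎
    where open ≡-Reasoning

open VecsBigOp _+_ 0 +-0-isCommutativeMonoid using () renaming
  ( ⨁-vecs-suc to ∑-vecs-suc; ⨁-vecs-insert₂ to ∑-vecs-insert₂)
open VecsBigOp _*_ 1 *-1-isCommutativeMonoid using () renaming
  ( ⨁-vecs-suc to ∏-vecs-suc; ⨁-vecs-insert₂ to ∏-vecs-insert₂; ⨁-vecs-swap to ∏-vecs-swap)

length-∑ : {A : Set} (xs : List A) → ∑ xs (λ _ → 1) ≡ length xs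
length-∑ xs = trans (∑-const xs 1) (*-identityʳ _)

length-vecs : {A : Set} (xs : List A) (a : ℕ) → length (vecs xs a) ≡ length xs ^ a
length-vecs xs zero    = refl
length-vecs xs (suc a) = begin
  length (vecs xs (suc a))                 ≡⟨ sym (length-∑ (vecs xs (suc a))) ⟩
  ∑ (vecs xs (suc a)) (λ _ → 1)            ≡⟨ ∑-vecs-suc xs a _ ⟩
  ∑ xs (λ _ → ∑ (vecs xs a) (λ _ → 1))     ≡⟨ ∑-const xs _ ⟩
  length xs * ∑ (vecs xs a) (λ _ → 1)      ≡⟨ cong (length xs *_) (trans (length-∑ (vecs xs a)) (length-vecs xs a)) ⟩
  length xs * length xs ^ a                ∎
  where open ≡-Reasoning

-- Subsets of an a-element set as characteristic vectors

below : Bool → List Bool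
below false = false ∷ []
below true  = false ∷ true ∷ []

bools : List Bool
bools = below true

subsets : (a : ℕ) → List (Vec Bool a)
subsets = vecs bools

subsetsOf : {a : ℕ} → Vec Bool a → List (Vec Bool a)
subsetsOf []      = [] ∷ []
subsetsOf (b ∷ R) = concatMap (λ c → map (c ∷_) (subsetsOf R)) (below b)

bit : Bool → ℕ
bit false = 0
bit true  = 1

size : {a : ℕ} → Vec Bool a → ℕ
size []      = 0
size (b ∷ S) = bit b + size S

size-swap : {a : ℕ} (p : Pos a) (S : Vec Bool a) → size (swap p S) ≡ size S
size-swap here      (b ∷ c ∷ S) = id₁ (bit c) (bit b) (size S)
  where
  id₁ : ∀ c b s → c + (b + s) ≡ b + (c + s)
  id₁ = solve-∀
size-swap (there p) (b ∷ S) = cong (bit b +_) (size-swap p S)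

size-insert₂ : {a : ℕ} (p : Pos a) (S : Vec Bool (rest p)) (b c : Bool) →
  size (insert₂ p S b c) ≡ bit b + (bit c + size S)
size-insert₂ here      S       b c = refl
size-insert₂ (there p) (d ∷ S) b c = trans (cong (bit d +_) (size-insert₂ p S b c)) (id₁ (bit d) (bit b) (bit c) (size S))
  where
  id₁ : ∀ d b c s → d + (b + (c + s)) ≡ b + (c + (d + s))
  id₁ = solve-∀

module SubsetsBigOp (_∙_ : ℕ → ℕ → ℕ) (ε : ℕ) (isCM : IsCommutativeMonoid _≡_ _∙_ ε) where

  open BigOp _∙_ ε isCM

  ⨁-subsetsOf-∷ : {a : ℕ} (b : Bool) (R : Vec Bool a) (f : Vec Bool (suc a) → ℕ) →
    ⨁ (subsetsOf (b ∷ R)) f ≡ ⨁ (below b) (λ c → ⨁ (subsetsOf R) (λ S → f (c ∷ S)))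
  ⨁-subsetsOf-∷ b R f = trans (⨁-concatMap _ (below b) f) (⨁-cong (below b) λ c → ⨁-map (c ∷_) (subsetsOf R) f)

  ⨁-subsetsOf-insert₂ : {a : ℕ} (p : Pos a) (R : Vec Bool (rest p)) (b c : Bool) (f : Vec Bool a → ℕ) →
    ⨁ (subsetsOf (insert₂ p R b c)) f ≡
    ⨁ (subsetsOf R) (λ S → ⨁ (below b) (λ b′ → ⨁ (below c) (λ c′ → f (insert₂ p S b′ c′))))
  ⨁-subsetsOf-insert₂ here R b c f = begin
    ⨁ (subsetsOf (b ∷ c ∷ R)) f
      ≡⟨ ⨁-subsetsOf-∷ b (c ∷ R) f ⟩
    ⨁ (below b) (λ b′ → ⨁ (subsetsOf (c ∷ R)) (λ w → f (b′ ∷ w)))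
      ≡⟨ ⨁-cong (below b) (λ b′ → ⨁-subsetsOf-∷ c R _) ⟩
    ⨁ (below b) (λ b′ → ⨁ (below c) (λ c′ → ⨁ (subsetsOf R) (λ S → f (b′ ∷ c′ ∷ S))))
      ≡⟨ ⨁-cong (below b) (λ b′ → ⨁-swap (below c) (subsetsOf R) _) ⟩
    ⨁ (below b) (λ b′ → ⨁ (subsetsOf R) (λ S → ⨁ (below c) (λ c′ → f (b′ ∷ c′ ∷ S))))
      ≡⟨ ⨁-swap (below b) (subsetsOf R) _ ⟩
    ⨁ (subsetsOf R) (λ S → ⨁ (below b) (λ b′ → ⨁ (below c) (λ c′ → f (b′ ∷ c′ ∷ S)))) ∎
    where open ≡-Reasoning
  ⨁-subsetsOf-insert₂ (there p) (d ∷ R) b c f = begin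
    ⨁ (subsetsOf (d ∷ insert₂ p R b c)) f
      ≡⟨ ⨁-subsetsOf-∷ d (insert₂ p R b c) f ⟩
    ⨁ (below d) (λ d′ → ⨁ (subsetsOf (insert₂ p R b c)) (λ S → f (d′ ∷ S)))
      ≡⟨ ⨁-cong (below d) (λ d′ → ⨁-subsetsOf-insert₂ p R b c _) ⟩
    ⨁ (below d) (λ d′ → ⨁ (subsetsOf R) (λ S → ⨁ (below b) (λ b′ → ⨁ (below c) (λ c′ → f (d′ ∷ insert₂ p S b′ c′)))))
      ≡⟨ sym (⨁-subsetsOf-∷ d R _) ⟩
    ⨁ (subsetsOf (d ∷ R)) (λ S → ⨁ (below b) (λ b′ → ⨁ (below c) (λ c′ → f (insert₂ (there p) S b′ c′)))) ∎
    where open ≡-Reasoning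

open SubsetsBigOp _+_ 0 +-0-isCommutativeMonoid using () renaming
  ( ⨁-subsetsOf-∷ to ∑-subsetsOf-∷)
open SubsetsBigOp _*_ 1 *-1-isCommutativeMonoid using () renaming
  ( ⨁-subsetsOf-∷ to ∏-subsetsOf-∷ ; ⨁-subsetsOf-insert₂ to ∏-subsetsOf-insert₂)

-- Comparators, sorting networks and the extremal argument

raise : ∀ {a} → Pos a → Vec Bool a → Vec Bool a
raise here      (b ∷ c ∷ R) = (b ∨ c) ∷ (b ∧ c) ∷ R
raise (there p) (d ∷ R)     = d ∷ raise p R

lower : ∀ {a} → Pos a → Vec Bool a → Vec Bool a
lower here      (b ∷ c ∷ R) = (b ∧ c) ∷ (b ∨ c) ∷ R
lower (there p) (d ∷ R)     = d ∷ lower p R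

raise-insert₂ : ∀ {a} (p : Pos a) (R : Vec Bool (rest p)) b c → raise p (insert₂ p R b c) ≡ insert₂ p R (b ∨ c) (b ∧ c)
raise-insert₂ here      R       b c = refl
raise-insert₂ (there p) (d ∷ R) b c = cong (d ∷_) (raise-insert₂ p R b c)

lower-insert₂ : ∀ {a} (p : Pos a) (R : Vec Bool (rest p)) b c → lower p (insert₂ p R b c) ≡ insert₂ p R (b ∧ c) (b ∨ c)
lower-insert₂ here      R       b c = refl
lower-insert₂ (there p) (d ∷ R) b c = cong (d ∷_) (lower-insert₂ p R b c)

raise-id-or-swap : ∀ {a} (p : Pos a) (R : Vec Bool a) → raise p R ≡ R ⊎ raise p R ≡ swap p R
raise-id-or-swap here (false ∷ false ∷ R) = inj₁ refl
raise-id-or-swap here (false ∷ true ∷ R)  = inj₂ refl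
raise-id-or-swap here (true ∷ false ∷ R)  = inj₁ refl
raise-id-or-swap here (true ∷ true ∷ R)   = inj₁ refl
raise-id-or-swap (there p) (d ∷ R) with raise-id-or-swap p R
... | inj₁ eq = inj₁ (cong (d ∷_) eq)
... | inj₂ eq = inj₂ (cong (d ∷_) eq)

raiseAll : ∀ {a} → List (Pos a) → Vec Bool a → Vec Bool a
raiseAll []       R = R
raiseAll (p ∷ ps) R = raiseAll ps (raise p R)

initial : ∀ a → ℕ → Vec Bool a
initial zero    k       = []
initial (suc a) zero    = false ∷ initial a zero
initial (suc a) (suc k) = true ∷ initial a k

size-initial : ∀ {a k} → k ≤ a → size (initial a k) ≡ k
size-initial {zero}  z≤n       = refl
size-initial {suc a} z≤n       = size-initial {a} z≤n
size-initial {suc a} (s≤s k≤a) = cong suc (size-initial k≤a)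

size≤ : ∀ {a} (R : Vec Bool a) → size R ≤ a
size≤ []          = z≤n
size≤ (false ∷ R) = m≤n⇒m≤1+n (size≤ R)
size≤ (true ∷ R)  = s≤s (size≤ R)

bubble : ∀ a → List (Pos a)
bubble zero          = []
bubble (suc zero)    = []
bubble (suc (suc a)) = here ∷ map there (bubble (suc a))

-- Insertion sort: the tail is sorted, then the head bubbles into place. The comparators do not
-- depend on the set being sorted, so a single sequence of reflections treats all sets at once.
sortingNetwork : ∀ a → List (Pos a)
sortingNetwork zero    = []
sortingNetwork (suc a) = map there (sortingNetwork a) ++ bubble (suc a)

raiseAll-++ : ∀ {a} (ps qs : List (Pos a)) R → raiseAll (ps ++ qs) R ≡ raiseAll qs (raiseAll ps R)
raiseAll-++ []       qs R = refl
raiseAll-++ (p ∷ ps) qs R = raiseAll-++ ps qs (raise p R)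

raiseAll-there : ∀ {a} (ps : List (Pos a)) d R → raiseAll (map there ps) (d ∷ R) ≡ d ∷ raiseAll ps R
raiseAll-there []       d R = refl
raiseAll-there (p ∷ ps) d R = raiseAll-there ps d (raise p R)

bubble-initial : ∀ a k → raiseAll (bubble a) (initial a k) ≡ initial a k
bubble-initial zero          k             = refl
bubble-initial (suc zero)    k             = refl
bubble-initial (suc (suc a)) zero          = trans (raiseAll-there (bubble (suc a)) _ _) (cong (false ∷_) (bubble-initial (suc a) zero))
bubble-initial (suc (suc a)) (suc zero)    = trans (raiseAll-there (bubble (suc a)) _ _) (cong (true ∷_) (bubble-initial (suc a) zero))
bubble-initial (suc (suc a)) (suc (suc k)) = trans (raiseAll-there (bubble (suc a)) _ _) (cong (true ∷_) (bubble-initial (suc a) (suc k)))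

bubble-∷ : ∀ {a k} b → k ≤ a → raiseAll (bubble (suc a)) (b ∷ initial a k) ≡ initial (suc a) (bit b + k)
bubble-∷ {a} {k} true k≤a = bubble-initial (suc a) (suc k)
bubble-∷ {a} false z≤n = bubble-initial (suc a) zero
bubble-∷ {suc a} {suc k} false (s≤s k≤a) = trans (raiseAll-there (bubble (suc a)) _ _) (cong (true ∷_) (bubble-∷ {a} {k} false k≤a))

sortingNetwork-sorts : ∀ {a} (R : Vec Bool a) → raiseAll (sortingNetwork a) R ≡ initial a (size R)
sortingNetwork-sorts [] = refl
sortingNetwork-sorts {suc a} (b ∷ R) = begin
  raiseAll (map there (sortingNetwork a) ++ bubble (suc a)) (b ∷ R)
    ≡⟨ raiseAll-++ (map there (sortingNetwork a)) _ _ ⟩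
  raiseAll (bubble (suc a)) (raiseAll (map there (sortingNetwork a)) (b ∷ R))
    ≡⟨ cong (raiseAll (bubble (suc a))) (trans (raiseAll-there (sortingNetwork a) b R) (cong (b ∷_) (sortingNetwork-sorts R))) ⟩
  raiseAll (bubble (suc a)) (b ∷ initial a (size R))
    ≡⟨ bubble-∷ b (size≤ R) ⟩
  initial (suc a) (bit b + size R) ∎
  where open ≡-Reasoning

-- A value of 𝓐 exceeding c could, by log-convexity, be kept along the whole sorting network
-- unless some fold strictly increases it; the bound allows only finitely many increases.
reflection-bound : ∀ {a} (𝓐 : (Vec Bool a → Bool) → ℕ) (bound c : ℕ) (ps : List (Pos a)) →
  (∀ 𝓢 → 𝓐 𝓢 ≤ bound) →
  (∀ p 𝓢 → 𝓐 𝓢 * 𝓐 𝓢 ≤ 𝓐 (𝓢 ∘ raise p) * 𝓐 (𝓢 ∘ lower p)) →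
  (∀ 𝓢 → 𝓐 (𝓢 ∘ raiseAll ps) ≤ c) →
  ∀ 𝓢 → 𝓐 𝓢 ≤ c
reflection-bound {a} 𝓐 bound c ps bounded fold end 𝓢₀ = go bound 𝓢₀ (m≤n+m bound (𝓐 𝓢₀))
  where
  go : ∀ fuel 𝓢 → bound ≤ 𝓐 𝓢 + fuel → 𝓐 𝓢 ≤ c
  go fuel 𝓢 enough = ≮⇒≥ λ c<𝓐 → <⇒≱ c<𝓐 (≤-trans (walk c<𝓐 ps) (end 𝓢))
    where
    walk : c < 𝓐 𝓢 → ∀ qs → 𝓐 𝓢 ≤ 𝓐 (𝓢 ∘ raiseAll qs)
    walk c<𝓐 []       = ≤-refl
    walk c<𝓐 (q ∷ qs) with 𝓐 (𝓢 ∘ raiseAll qs ∘ lower q) ≤? 𝓐 (𝓢 ∘ raiseAll qs)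
    -- From `x * x ≤ 𝓐 (raise) * 𝓐 (lower)` and `𝓐 (lower) ≤ x` one factor `x` is cancelled; it is
    -- positive because it is at least `𝓐 𝓢`, which exceeds `c`.
    ... | yes le = ≤-trans (walk c<𝓐 qs) (*-cancelʳ-≤ x _ x {{>-nonZero (≤-trans (s≤s z≤n) (≤-trans c<𝓐 (walk c<𝓐 qs)))}}
                     (≤-trans (fold q (𝓢 ∘ raiseAll qs)) (*-monoʳ-≤ (𝓐 (𝓢 ∘ raiseAll qs ∘ raise q)) le)))
      where x = 𝓐 (𝓢 ∘ raiseAll qs)
    ... | no ≰ = ⊥-elim (contra fuel enough)
      where
      𝓣 : Vec Bool a → Bool
      𝓣 = 𝓢 ∘ raiseAll qs ∘ lower q
      bigger : 𝓐 𝓢 < 𝓐 𝓣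
      bigger = ≤-<-trans (walk c<𝓐 qs) (≰⇒> ≰)
      contra : ∀ fuel → bound ≤ 𝓐 𝓢 + fuel → ⊥
      contra zero       en = <⇒≱ bigger (≤-trans (bounded 𝓣) (≤-trans en (≤-reflexive (+-identityʳ _))))
      contra (suc fuel) en = <⇒≱ (<-trans c<𝓐 bigger) (go fuel 𝓣 (≤-trans en (≤-trans (≤-reflexive (+-suc _ fuel)) (+-monoˡ-≤ fuel bigger))))

-- Gram kernels and their bilinear forms

term : {V : Set} → V → V → ℕ × (V → ℕ) → ℕ
term u v (c , g) = c * (g u * g v)

-- Positive semidefiniteness by certificate: a combination of rank-one kernels with coefficients in
-- ℕ. This form is visibly closed under products, and it reduces Cauchy-Schwarz for the bilinear
-- form to the inequality for sums over `terms`.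
record Gram {V : Set} (k : V → V → ℕ) : Set where
  field
    terms  : List (ℕ × (V → ℕ))
    expand : ∀ u v → k u v ≡ ∑ terms (term u v)
open Gram

gram-const : {V : Set} (c : ℕ) → Gram {V} (λ _ _ → c)
gram-const c .terms = (c , λ _ → 1) ∷ []
gram-const c .expand u v = id₁ c
  where
  id₁ : ∀ c → c ≡ c * (1 * 1) + 0
  id₁ = solve-∀

gram-outer : {V : Set} (g : V → ℕ) → Gram (λ u v → g u * g v)
gram-outer g .terms = (1 , g) ∷ []
gram-outer g .expand u v = id₁ (g u) (g v)
  where
  id₁ : ∀ a b → a * b ≡ 1 * (a * b) + 0
  id₁ = solve-∀

gram-∑ : {V Y : Set} (ys : List Y) (t : Y → ℕ × (V → ℕ)) → Gram (λ u v → ∑ ys (λ y → term u v (t y)))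
gram-∑ ys t .terms = map t ys
gram-∑ ys t .expand u v = sym (∑-map t ys (term u v))

-- The Schur product: multiplying the rank-one kernels of g and h gives that of the pointwise
-- product of g and h.
gram-* : {V : Set} {k l : V → V → ℕ} → Gram k → Gram l → Gram (λ u v → k u v * l u v)
gram-* {V} {k} {l} G H = record { terms = concatMap (λ s → map (both s) (terms H)) (terms G) ; expand = eq }
  where
  both : ℕ × (V → ℕ) → ℕ × (V → ℕ) → ℕ × (V → ℕ)
  both (c , g) (d , h) = c * d , λ u → g u * h u
  id₁ : ∀ c d a b x y → c * (a * b) * (d * (x * y)) ≡ c * d * (a * x * (b * y))
  id₁ = solve-∀
  open ≡-Reasoning
  eq : ∀ u v → k u v * l u v ≡ ∑ (concatMap (λ s → map (both s) (terms H)) (terms G)) (term u v)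
  eq u v = begin
    k u v * l u v
      ≡⟨ cong₂ _*_ (expand G u v) (expand H u v) ⟩
    ∑ (terms G) (term u v) * ∑ (terms H) (term u v)
      ≡⟨ sym (∑-*ʳ (terms G) (term u v) _) ⟩
    ∑ (terms G) (λ s → term u v s * ∑ (terms H) (term u v))
      ≡⟨ ∑-cong (terms G) (λ s → sym (∑-*ˡ (terms H) (term u v s) (term u v))) ⟩
    ∑ (terms G) (λ s → ∑ (terms H) (λ t → term u v s * term u v t))
      ≡⟨ ∑-cong (terms G) (λ { (c , g) → ∑-cong (terms H) λ { (d , h) → id₁ c d (g u) (g v) (h u) (h v) } }) ⟩
    ∑ (terms G) (λ s → ∑ (terms H) (λ t → term u v (both s t)))
      ≡⟨ ∑-cong (terms G) (λ s → sym (∑-map (both s) (terms H) (term u v))) ⟩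
    ∑ (terms G) (λ s → ∑ (map (both s) (terms H)) (term u v))
      ≡⟨ sym (∑-concatMap (λ s → map (both s) (terms H)) (terms G) (term u v)) ⟩
    ∑ (concatMap (λ s → map (both s) (terms H)) (terms G)) (term u v) ∎

gram-cong : {V : Set} {k l : V → V → ℕ} → (∀ u v → k u v ≡ l u v) → Gram l → Gram k
gram-cong eq G .terms = terms G
gram-cong eq G .expand u v = trans (eq u v) (expand G u v)

gram-^ : {V : Set} {k : V → V → ℕ} → Gram k → (n : ℕ) → Gram (λ u v → k u v ^ n)
gram-^ G zero    = gram-const 1
gram-^ G (suc n) = gram-* G (gram-^ G n)

gram-∏ : {V I : Set} (is : List I) {k : I → V → V → ℕ} → (∀ i → Gram (k i)) → Gram (λ u v → ∏ is (λ i → k i u v))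
gram-∏ []       G = gram-const 1
gram-∏ (i ∷ is) G = gram-* (G i) (gram-∏ is G)

gram-if : {V : Set} (b : Bool) {k : V → V → ℕ} → Gram k → Gram (λ u v → if b then k u v else 1)
gram-if false G = gram-const 1
gram-if true  G = G

bilinear : {V : Set} → List V → (V → V → ℕ) → (V → ℕ) → (V → ℕ) → ℕ
bilinear vs k α β = ∑ vs (λ u → ∑ vs (λ v → k u v * (α u * β v)))

bilinear-gram : {V : Set} (vs : List V) {k : V → V → ℕ} (G : Gram k) (α β : V → ℕ) →
  bilinear vs k α β ≡ ∑ (terms G) (λ t → proj₁ t * (∑ vs (λ u → proj₂ t u * α u) * ∑ vs (λ v → proj₂ t v * β v)))
bilinear-gram vs {k} G α β = begin
  ∑ vs (λ u → ∑ vs (λ v → k u v * (α u * β v)))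
    ≡⟨ ∑-cong vs (λ u → ∑-cong vs λ v → trans (cong (_* (α u * β v)) (expand G u v)) (sym (∑-*ʳ (terms G) (term u v) _))) ⟩
  ∑ vs (λ u → ∑ vs (λ v → ∑ (terms G) (λ t → term u v t * (α u * β v))))
    ≡⟨ ∑-cong vs (λ u → ∑-swap vs (terms G) _) ⟩
  ∑ vs (λ u → ∑ (terms G) (λ t → ∑ vs (λ v → term u v t * (α u * β v))))
    ≡⟨ ∑-swap vs (terms G) _ ⟩
  ∑ (terms G) (λ t → ∑ vs (λ u → ∑ vs (λ v → term u v t * (α u * β v))))
    ≡⟨ ∑-cong (terms G) (λ { (c , g) → factor c g }) ⟩
  ∑ (terms G) (λ t → proj₁ t * (∑ vs (λ u → proj₂ t u * α u) * ∑ vs (λ v → proj₂ t v * β v))) ∎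
  where
  open ≡-Reasoning
  id₁ : ∀ c a b x y → c * (a * b) * (x * y) ≡ c * (a * x * (b * y))
  id₁ = solve-∀
  factor : ∀ c g → ∑ vs (λ u → ∑ vs (λ v → c * (g u * g v) * (α u * β v))) ≡
    c * (∑ vs (λ u → g u * α u) * ∑ vs (λ v → g v * β v))
  factor c g = begin
    ∑ vs (λ u → ∑ vs (λ v → c * (g u * g v) * (α u * β v)))
      ≡⟨ ∑-cong vs (λ u → ∑-cong vs λ v → id₁ c (g u) (g v) (α u) (β v)) ⟩
    ∑ vs (λ u → ∑ vs (λ v → c * (g u * α u * (g v * β v))))
      ≡⟨ ∑-cong vs (λ u → trans (∑-*ˡ vs c _) (cong (c *_) (∑-*ˡ vs (g u * α u) _))) ⟩
    ∑ vs (λ u → c * (g u * α u * ∑ vs (λ v → g v * β v)))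
      ≡⟨ ∑-*ˡ vs c _ ⟩
    c * ∑ vs (λ u → g u * α u * ∑ vs (λ v → g v * β v))
      ≡⟨ cong (c *_) (∑-*ʳ vs _ _) ⟩
    c * (∑ vs (λ u → g u * α u) * ∑ vs (λ v → g v * β v)) ∎

-- Each term contributes c times a product of one linear functional at `α` and at `β`, so the
-- termwise condition of `cauchy-schwarz` holds with equality.
bilinear-cauchy-schwarz : {V : Set} (vs : List V) {k : V → V → ℕ} → Gram k → (α β : V → ℕ) →
  bilinear vs k α β * bilinear vs k α β ≤ bilinear vs k α α * bilinear vs k β β
bilinear-cauchy-schwarz vs G α β =
  subst₂ _≤_ (cong₂ _*_ (sym (bilinear-gram vs G α β)) (sym (bilinear-gram vs G α β)))
             (cong₂ _*_ (sym (bilinear-gram vs G α α)) (sym (bilinear-gram vs G β β)))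
    (cauchy-schwarz (terms G) _ _ _ λ { (c , g) → ≤-reflexive (id₁ c (∑ vs (λ u → g u * α u)) (∑ vs (λ v → g v * β v))) })
  where
  id₁ : ∀ c a b → c * (a * b) * (c * (a * b)) ≡ c * (a * a) * (c * (b * b))
  id₁ = solve-∀

-- Reflecting a family of factors by Cauchy-Schwarz

selected : {a : ℕ} → (Vec Bool a → Bool) → (Vec Bool a → ℕ) → Vec Bool a → ℕ
selected 𝓢 h R = if 𝓢 R then h R else 1

-- What Cauchy–Schwarz needs to exchange the adjacent coordinates u and v at p: a set R containing
-- both or neither contributes a Gram kernel, and one containing exactly one of them a function of it.
record Reflective {V : Set} {a : ℕ} (p : Pos a) (F : Vec Bool a → Vec V a → ℕ) : Set where
  field
    kernel     : ∀ b R o → Gram (λ u v → F (insert₂ p R b b) (insert₂ p o u v))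
    side       : Vec Bool (rest p) → Vec V (rest p) → V → ℕ
    side-left  : ∀ R o u v → F (insert₂ p R true false) (insert₂ p o u v) ≡ side R o u
    side-right : ∀ R o u v → F (insert₂ p R false true) (insert₂ p o u v) ≡ side R o v
open Reflective

module Fold {V : Set} (vs : List V) {a : ℕ} (F : Vec Bool a → Vec V a → ℕ) where

  mass : (Vec Bool a → Bool) → ℕ
  mass 𝓢 = ∑ (vecs vs a) (λ x → ∏ (subsets a) (selected 𝓢 (λ R → F R x)))

  module _ (p : Pos a) (refl-F : Reflective p F) (𝓢 : Vec Bool a → Bool) where

    ker : Vec V (rest p) → V → V → ℕ
    ker o u v = ∏ (subsets (rest p)) (λ R →
      (if 𝓢 (insert₂ p R false false) then F (insert₂ p R false false) (insert₂ p o u v) else 1) *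
      (if 𝓢 (insert₂ p R true true) then F (insert₂ p R true true) (insert₂ p o u v) else 1))

    ker-gram : ∀ o → Gram (ker o)
    ker-gram o = gram-∏ (subsets (rest p)) λ R →
      gram-* (gram-if (𝓢 (insert₂ p R false false)) (kernel refl-F false R o))
             (gram-if (𝓢 (insert₂ p R true true)) (kernel refl-F true R o))

    sides : (Vec Bool (rest p) → Bool) → Vec V (rest p) → V → ℕ
    sides s o u = ∏ (subsets (rest p)) (λ R → if s R then side refl-F R o u else 1)

    left right : Vec Bool (rest p) → Bool
    left  R = 𝓢 (insert₂ p R true false)
    right R = 𝓢 (insert₂ p R false true)

    -- Stated for any `𝓣` that agrees with `𝓢` on the sets containing both or neither index, so that
    -- `𝓢` and its two reflections share the kernel `ker` and differ only in the two functions
    -- paired by it.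
    mass-split : (𝓣 : Vec Bool a → Bool) (l r : Vec Bool (rest p) → Bool) →
      (∀ b R → 𝓣 (insert₂ p R b b) ≡ 𝓢 (insert₂ p R b b)) →
      (∀ R → 𝓣 (insert₂ p R true false) ≡ l R) →
      (∀ R → 𝓣 (insert₂ p R false true) ≡ r R) →
      mass 𝓣 ≡ ∑ (vecs vs (rest p)) (λ o → bilinear vs (ker o) (sides l o) (sides r o))
    mass-split 𝓣 l r eq eql eqr = trans (∑-vecs-insert₂ vs p _)
      (∑-cong (vecs vs (rest p)) λ o → ∑-cong vs λ u → ∑-cong vs λ v → begin
        ∏ (subsets a) (selected 𝓣 (λ R → F R (insert₂ p o u v)))
          ≡⟨ ∏-vecs-insert₂ bools p _ ⟩
        ∏ (subsets (rest p)) (λ R → ∏ bools (λ b → ∏ bools (λ c → f o u v (insert₂ p R b c))))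
          ≡⟨ ∏-cong (subsets (rest p)) (λ R → factors o u v R) ⟩
        ∏ (subsets (rest p)) (λ R →
          (if 𝓢 (insert₂ p R false false) then F (insert₂ p R false false) (insert₂ p o u v) else 1) *
          (if 𝓢 (insert₂ p R true true) then F (insert₂ p R true true) (insert₂ p o u v) else 1) *
          ((if l R then side refl-F R o u else 1) * (if r R then side refl-F R o v else 1)))
          ≡⟨ ∏-* (subsets (rest p)) _ _ ⟩
        ker o u v * ∏ (subsets (rest p)) (λ R → (if l R then side refl-F R o u else 1) * (if r R then side refl-F R o v else 1))
          ≡⟨ cong (ker o u v *_) (∏-* (subsets (rest p)) _ _) ⟩
        ker o u v * (sides l o u * sides r o v) ∎)
      where
      open ≡-Reasoning
      f : Vec V (rest p) → V → V → Vec Bool a → ℕ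
      f o u v = selected 𝓣 (λ R → F R (insert₂ p o u v))
      id₁ : ∀ ff ft tf tt → (ff * (ft * 1)) * ((tf * (tt * 1)) * 1) ≡ ff * tt * (tf * ft)
      id₁ = solve-∀
      factors : ∀ o u v R → ∏ bools (λ b → ∏ bools (λ c → f o u v (insert₂ p R b c))) ≡
          (if 𝓢 (insert₂ p R false false) then F (insert₂ p R false false) (insert₂ p o u v) else 1) *
          (if 𝓢 (insert₂ p R true true) then F (insert₂ p R true true) (insert₂ p o u v) else 1) *
          ((if l R then side refl-F R o u else 1) * (if r R then side refl-F R o v else 1))
      factors o u v R
        rewrite sym (eq false R) | sym (eq true R) | sym (eql R) | sym (eqr R)
              | sym (side-left refl-F R o u v) | sym (side-right refl-F R o u v) =
        id₁ (f o u v (insert₂ p R false false)) (f o u v (insert₂ p R false true))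
            (f o u v (insert₂ p R true false)) (f o u v (insert₂ p R true true))

    -- For fixed remaining coordinates, `𝓢` pairs `left` with `right`, while its reflections pair
    -- `left` with itself and `right` with itself. Cauchy-Schwarz is used for this form, and once
    -- more for the sum over the remaining coordinates.
    mass-fold : mass 𝓢 * mass 𝓢 ≤ mass (𝓢 ∘ raise p) * mass (𝓢 ∘ lower p)
    mass-fold = subst₂ _≤_
      (cong₂ _*_ (sym whole) (sym whole))
      (cong₂ _*_
        (sym (mass-split (𝓢 ∘ raise p) left left
          (λ { false R → cong 𝓢 (raise-insert₂ p R false false) ; true R → cong 𝓢 (raise-insert₂ p R true true) })
          (λ R → cong 𝓢 (raise-insert₂ p R true false)) (λ R → cong 𝓢 (raise-insert₂ p R false true))))
        (sym (mass-split (𝓢 ∘ lower p) right right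
          (λ { false R → cong 𝓢 (lower-insert₂ p R false false) ; true R → cong 𝓢 (lower-insert₂ p R true true) })
          (λ R → cong 𝓢 (lower-insert₂ p R true false)) (λ R → cong 𝓢 (lower-insert₂ p R false true)))))
      (cauchy-schwarz (vecs vs (rest p)) _ _ _ λ o → bilinear-cauchy-schwarz vs (ker-gram o) (sides left o) (sides right o))
      where
      whole : mass 𝓢 ≡ ∑ (vecs vs (rest p)) (λ o → bilinear vs (ker o) (sides left o) (sides right o))
      whole = mass-split 𝓢 left right (λ _ _ → refl) (λ _ → refl) (λ _ → refl)

-- The reflection inequality for sets of size r

ofSize : ∀ {a} → ℕ → Vec Bool a → Bool
ofSize r R = size R ≡ᵇ r

-- The binomial coefficient C(a, r), in the form in which it arises as an exponent.
count : ∀ a → ℕ → ℕ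
count a r = ∑ (subsets a) (λ R → bit (ofSize r R))

if-^-bit : ∀ c b → (if b then c else 1) ≡ c ^ bit b
if-^-bit c false = refl
if-^-bit c true  = sym (*-identityʳ c)

∏-ofSize-const : ∀ a r c → ∏ (subsets a) (λ R → if ofSize r R then c else 1) ≡ c ^ count a r
∏-ofSize-const a r c = trans (∏-cong (subsets a) λ R → if-^-bit c (ofSize r R)) (^-∑ c (subsets a) _)

is : ∀ {a} → Vec Bool a → Vec Bool a → Bool
is []          []          = true
is (true ∷ S)  (true ∷ R)  = is S R
is (false ∷ S) (false ∷ R) = is S R
is (true ∷ S)  (false ∷ R) = false
is (false ∷ S) (true ∷ R)  = false

is⇒≡ : ∀ {a} (S R : Vec Bool a) → T (is S R) → S ≡ R
is⇒≡ []          []          _ = refl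
is⇒≡ (true ∷ S)  (true ∷ R)  t = cong (true ∷_) (is⇒≡ S R t)
is⇒≡ (false ∷ S) (false ∷ R) t = cong (false ∷_) (is⇒≡ S R t)

∏-is : ∀ {a} (S : Vec Bool a) (h : Vec Bool a → ℕ) → ∏ (subsets a) (λ R → if is S R then h R else 1) ≡ h S
∏-is [] h = *-identityʳ (h [])
∏-is {suc a} (true ∷ S) h = begin
  ∏ (subsets (suc a)) (λ R → if is (true ∷ S) R then h R else 1) ≡⟨ ∏-vecs-suc bools a _ ⟩
  ∏ (subsets a) (λ _ → 1) * (∏ (subsets a) (λ R → if is S R then h (true ∷ R) else 1) * 1)
    ≡⟨ cong₂ (λ s t → s * (t * 1)) (∏-1 (subsets a)) (∏-is S (h ∘ (true ∷_))) ⟩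
  1 * (h (true ∷ S) * 1) ≡⟨ trans (*-identityˡ _) (*-identityʳ _) ⟩
  h (true ∷ S) ∎
  where open ≡-Reasoning
∏-is {suc a} (false ∷ S) h = begin
  ∏ (subsets (suc a)) (λ R → if is (false ∷ S) R then h R else 1) ≡⟨ ∏-vecs-suc bools a _ ⟩
  ∏ (subsets a) (λ R → if is S R then h (false ∷ R) else 1) * (∏ (subsets a) (λ _ → 1) * 1)
    ≡⟨ cong₂ (λ s t → t * (s * 1)) (∏-1 (subsets a)) (∏-is S (h ∘ (false ∷_))) ⟩
  h (false ∷ S) * 1 ≡⟨ *-identityʳ _ ⟩
  h (false ∷ S) ∎
  where open ≡-Reasoning

module Weight (a r N P : ℕ) where

  -- Normalises the potential: if `𝓢` has k members of size `r` and C(a, r) is D, the product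
  -- `weights 𝓢` is N^k P^(D-k), written without subtraction.
  weight : (Vec Bool a → Bool) → Vec Bool a → ℕ
  weight 𝓢 R = if ofSize r R then (if 𝓢 R then N else P) else 1

  weights : (Vec Bool a → Bool) → ℕ
  weights 𝓢 = ∏ (subsets a) (weight 𝓢)

  -- For a mixed pair, `raise` uses the membership of one version twice and `lower` that of the
  -- other twice. The two versions have equal size, so the four weights are the same up to order.
  weights-fold : ∀ p 𝓢 → weights 𝓢 * weights 𝓢 ≡ weights (𝓢 ∘ raise p) * weights (𝓢 ∘ lower p)
  weights-fold p 𝓢 = begin
    weights 𝓢 * weights 𝓢
      ≡⟨ sym (∏-* (subsets a) _ _) ⟩
    ∏ (subsets a) (λ R → weight 𝓢 R * weight 𝓢 R)
      ≡⟨ ∏-vecs-insert₂ bools p _ ⟩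
    ∏ (subsets (rest p)) (λ R → ∏ bools (λ b → ∏ bools (λ c → weight 𝓢 (insert₂ p R b c) * weight 𝓢 (insert₂ p R b c))))
      ≡⟨ ∏-cong (subsets (rest p)) fold-at ⟩
    ∏ (subsets (rest p)) (λ R → ∏ bools (λ b → ∏ bools (λ c → weight (𝓢 ∘ raise p) (insert₂ p R b c) * weight (𝓢 ∘ lower p) (insert₂ p R b c))))
      ≡⟨ sym (∏-vecs-insert₂ bools p _) ⟩
    ∏ (subsets a) (λ R → weight (𝓢 ∘ raise p) R * weight (𝓢 ∘ lower p) R)
      ≡⟨ ∏-* (subsets a) _ _ ⟩
    weights (𝓢 ∘ raise p) * weights (𝓢 ∘ lower p) ∎
    where
    open ≡-Reasoning
    weight′ : Bool → Bool → ℕ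
    weight′ o b = if o then (if b then N else P) else 1
    id₁ : ∀ ff ft tf tt → ff * ff * (ft * ft * 1) * (tf * tf * (tt * tt * 1) * 1) ≡
                          ff * ff * (tf * ft * 1) * (tf * ft * (tt * tt * 1) * 1)
    id₁ = solve-∀
    fold-at : ∀ R →
      ∏ bools (λ b → ∏ bools (λ c → weight 𝓢 (insert₂ p R b c) * weight 𝓢 (insert₂ p R b c))) ≡
      ∏ bools (λ b → ∏ bools (λ c → weight (𝓢 ∘ raise p) (insert₂ p R b c) * weight (𝓢 ∘ lower p) (insert₂ p R b c)))
    fold-at R
      rewrite raise-insert₂ p R false false | raise-insert₂ p R false true | raise-insert₂ p R true false | raise-insert₂ p R true true
            | lower-insert₂ p R false false | lower-insert₂ p R false true | lower-insert₂ p R true false | lower-insert₂ p R true true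
            | size-insert₂ p R false false | size-insert₂ p R false true | size-insert₂ p R true false | size-insert₂ p R true true
      = id₁ (weight′ (size R ≡ᵇ r) (𝓢 (insert₂ p R false false))) (weight′ (suc (size R) ≡ᵇ r) (𝓢 (insert₂ p R false true)))
            (weight′ (suc (size R) ≡ᵇ r) (𝓢 (insert₂ p R true false))) (weight′ (suc (suc (size R)) ≡ᵇ r) (𝓢 (insert₂ p R true true)))

-- With the value 1 at all other sizes, products over r-sets stay indexed by the whole cube
-- `subsets a`, which splits along `insert₂`.
restrict : ∀ {V : Set} {a} → ℕ → (Vec Bool a → Vec V a → ℕ) → Vec Bool a → Vec V a → ℕ
restrict r F R x = if ofSize r R then F R x else 1

restrict-reflective : ∀ {V : Set} {a} (r : ℕ) {p : Pos a} {F : Vec Bool a → Vec V a → ℕ} →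
  Reflective p F → Reflective p (restrict r F)
restrict-reflective r {p} {F} ρ = record
  { kernel     = λ b R o → gram-if (ofSize r (insert₂ p R b b)) (kernel ρ b R o)
  ; side       = λ R o u → if suc (size R) ≡ᵇ r then side ρ R o u else 1
  ; side-left  = λ R o u v → cong₂ (λ s t → if s ≡ᵇ r then t else 1) (size-insert₂ p R true false) (side-left ρ R o u v)
  ; side-right = λ R o u v → cong₂ (λ s t → if s ≡ᵇ r then t else 1) (size-insert₂ p R false true) (side-right ρ R o u v)
  }

if-within : ∀ o {s b : Bool} {k : ℕ} → (T o → s ≡ b) →
  (if s then (if o then k else 1) else 1) ≡ (if b then (if o then k else 1) else 1)
if-within true              eq rewrite eq tt = refl
if-within false {true}  {true}  _ = refl
if-within false {true}  {false} _ = refl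
if-within false {false} {true}  _ = refl
if-within false {false} {false} _ = refl

within-if : ∀ o {s b : Bool} {k l : ℕ} → (T o → s ≡ b) →
  (if o then (if s then k else l) else 1) ≡ (if o then (if b then k else l) else 1)
within-if true  eq rewrite eq tt = refl
within-if false _  = refl

module Reflection {V : Set} (vs : List V) {a r : ℕ} (r≤a : r ≤ a) (F : Vec Bool a → Vec V a → ℕ)
         (reflective : ∀ p → Reflective p F) where

  D N P : ℕ
  D = count a r
  N = length vs ^ a
  P = ∑ (vecs vs a) (λ x → ∏ (subsets a) (λ R → restrict r F R x))

  -- After division by N^(D+1) this reads (E F_I)^D ≤ E Π_R F_R for `I = initial a r`. It says that
  -- the potential `𝓐` at the family {I} does not exceed P^D N^D, its value at the empty and at the
  -- full family.
  reflection-inequality : 1 ≤ P → ∑ (vecs vs a) (F (initial a r)) ^ D * N ≤ P * N ^ D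
  reflection-inequality 1≤P = *-cancelʳ-≤ _ _ (P ^ D) {{m^n≢0 P D {{>-nonZero 1≤P}}}} (begin
    M ^ D * N * P ^ D                  ≡⟨ *-assoc (M ^ D) N _ ⟩
    M ^ D * (N * P ^ D)                ≡⟨ cong₂ (λ s t → s ^ D * t) (sym mass-singleton) (sym weights-singleton) ⟩
    mass 𝓢₁ ^ D * (weights 𝓢₁ * P)     ≡⟨ sym (*-assoc (mass 𝓢₁ ^ D) (weights 𝓢₁) P) ⟩
    mass 𝓢₁ ^ D * weights 𝓢₁ * P       ≤⟨ *-monoˡ-≤ P (reflection-bound 𝓐 bound (P ^ D * N ^ D) (sortingNetwork a) bounded fold end 𝓢₁) ⟩
    P ^ D * N ^ D * P                  ≡⟨ id₁ (P ^ D) (N ^ D) P ⟩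
    P * N ^ D * P ^ D                  ∎)
    where
    open ≤-Reasoning
    open Fold vs (restrict r F)
    open Weight a r N P
    id₁ : ∀ a b c → a * b * c ≡ c * b * a
    id₁ = solve-∀
    I = initial a r
    𝓢₁ = is I
    M = ∑ (vecs vs a) (F I)
    𝓐 : (Vec Bool a → Bool) → ℕ
    𝓐 𝓢 = mass 𝓢 ^ D * weights 𝓢
    -- Any bound independent of `𝓢` will do: a factor that is either kept or replaced by 1 is at
    -- most itself plus 1.
    bound = ∑ (vecs vs a) (λ x → ∏ (subsets a) (λ R → restrict r F R x + 1)) ^ D * ∏ (subsets a) (λ R → N + P + 1)

    bounded : ∀ 𝓢 → 𝓐 𝓢 ≤ bound
    bounded 𝓢 = *-mono-≤ (^-monoˡ-≤ D (∑-mono (vecs vs a) λ x → ∏-mono (subsets a) λ R → bounded₁ (𝓢 R) _))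
                         (∏-mono (subsets a) λ R → bounded₂ (ofSize r R) (𝓢 R))
      where
      bounded₁ : ∀ b k → (if b then k else 1) ≤ k + 1
      bounded₁ true  k = m≤m+n k 1
      bounded₁ false k = m≤n+m 1 k
      bounded₂ : ∀ o b → (if o then (if b then N else P) else 1) ≤ N + P + 1
      bounded₂ true  true  = ≤-trans (m≤m+n N P) (m≤m+n _ 1)
      bounded₂ true  false = ≤-trans (m≤n+m P N) (m≤m+n _ 1)
      bounded₂ false b     = m≤n+m 1 (N + P)

    fold : ∀ p 𝓢 → 𝓐 𝓢 * 𝓐 𝓢 ≤ 𝓐 (𝓢 ∘ raise p) * 𝓐 (𝓢 ∘ lower p)
    fold p 𝓢 = begin
      mass 𝓢 ^ D * weights 𝓢 * (mass 𝓢 ^ D * weights 𝓢)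
        ≡⟨ *-medial (mass 𝓢 ^ D) (weights 𝓢) _ _ ⟩
      mass 𝓢 ^ D * mass 𝓢 ^ D * (weights 𝓢 * weights 𝓢)
        ≡⟨ cong₂ _*_ (sym (^-distribʳ-* (mass 𝓢) _ D)) (weights-fold p 𝓢) ⟩
      (mass 𝓢 * mass 𝓢) ^ D * (weights (𝓢 ∘ raise p) * weights (𝓢 ∘ lower p))
        ≤⟨ *-monoˡ-≤ _ (^-monoˡ-≤ D (mass-fold p (restrict-reflective r (reflective p)) 𝓢)) ⟩
      (mass (𝓢 ∘ raise p) * mass (𝓢 ∘ lower p)) ^ D * (weights (𝓢 ∘ raise p) * weights (𝓢 ∘ lower p))
        ≡⟨ cong (_* (weights (𝓢 ∘ raise p) * weights (𝓢 ∘ lower p))) (^-distribʳ-* (mass (𝓢 ∘ raise p)) _ D) ⟩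
      mass (𝓢 ∘ raise p) ^ D * mass (𝓢 ∘ lower p) ^ D * (weights (𝓢 ∘ raise p) * weights (𝓢 ∘ lower p))
        ≡⟨ *-medial (mass (𝓢 ∘ raise p) ^ D) _ _ _ ⟩
      𝓐 (𝓢 ∘ raise p) * 𝓐 (𝓢 ∘ lower p) ∎

    -- The full family has mass `P` and weight N^D, the empty one mass `N` and weight P^D, so both
    -- give the same value of `𝓐`.
    constant : ∀ b (𝓢 : Vec Bool a → Bool) → (∀ R → T (ofSize r R) → 𝓢 R ≡ b) → 𝓐 𝓢 ≤ P ^ D * N ^ D
    constant b 𝓢 eq = ≤-reflexive (trans (cong₂ (λ s t → s ^ D * t) (mass-eq b eq) (trans (weights-eq b eq) (∏-ofSize-const a r _))) (swapped b))
      where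
      mass-const : Bool → ℕ
      mass-const true  = P
      mass-const false = N
      mass-eq : ∀ b → (∀ R → T (ofSize r R) → 𝓢 R ≡ b) → mass 𝓢 ≡ mass-const b
      mass-eq true  eq = ∑-cong (vecs vs a) λ x → ∏-cong (subsets a) λ R → if-within (ofSize r R) (eq R)
      mass-eq false eq = trans (∑-cong (vecs vs a) λ x → trans (∏-cong (subsets a) λ R → if-within (ofSize r R) (eq R)) (∏-1 (subsets a)))
                           (trans (length-∑ (vecs vs a)) (length-vecs vs a))
      weights-eq : ∀ b → (∀ R → T (ofSize r R) → 𝓢 R ≡ b) → weights 𝓢 ≡ ∏ (subsets a) (λ R → if ofSize r R then (if b then N else P) else 1)
      weights-eq b eq = ∏-cong (subsets a) λ R → within-if (ofSize r R) (eq R)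
      swapped : ∀ b → mass-const b ^ D * (if b then N else P) ^ D ≡ P ^ D * N ^ D
      swapped true  = refl
      swapped false = *-comm (N ^ D) (P ^ D)

    -- The network sends every r-set to `I`, so the reflected family contains all r-sets or none,
    -- according to `𝓢 I`.
    end : ∀ 𝓢 → 𝓐 (𝓢 ∘ raiseAll (sortingNetwork a)) ≤ P ^ D * N ^ D
    end 𝓢 = constant (𝓢 I) _ λ R ofSize-R →
      cong 𝓢 (trans (sortingNetwork-sorts R) (cong (initial a) (≡ᵇ⇒≡ (size R) r ofSize-R)))

    mass-singleton : mass 𝓢₁ ≡ M
    mass-singleton = ∑-cong (vecs vs a) λ x → trans (∏-is I _) (restrict-I x)
      where
      restrict-I : ∀ x → restrict r F I x ≡ F I x
      restrict-I x with ofSize r I | ≡⇒≡ᵇ (size I) r (size-initial r≤a)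
      ... | true | _ = refl

    -- The extra factor `P` stands in for the missing exponent D - 1.
    weights-singleton : weights 𝓢₁ * P ≡ N * P ^ D
    weights-singleton = begin-equality
      weights 𝓢₁ * P
        ≡⟨ cong (weights 𝓢₁ *_) (sym (∏-is I (λ _ → P))) ⟩
      weights 𝓢₁ * ∏ (subsets a) (λ R → if is I R then P else 1)
        ≡⟨ sym (∏-* (subsets a) _ _) ⟩
      ∏ (subsets a) (λ R → weight 𝓢₁ R * (if is I R then P else 1))
        ≡⟨ ∏-cong (subsets a) exchange ⟩
      ∏ (subsets a) (λ R → (if is I R then N else 1) * (if ofSize r R then P else 1))
        ≡⟨ ∏-* (subsets a) _ _ ⟩
      ∏ (subsets a) (λ R → if is I R then N else 1) * ∏ (subsets a) (λ R → if ofSize r R then P else 1)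
        ≡⟨ cong₂ _*_ (∏-is I (λ _ → N)) (∏-ofSize-const a r P) ⟩
      N * P ^ D ∎
      where
      exchange : ∀ R → weight 𝓢₁ R * (if is I R then P else 1) ≡ (if is I R then N else 1) * (if ofSize r R then P else 1)
      exchange R with is I R | is⇒≡ I R
      ... | false | _ = *-comm _ 1
      ... | true  | eq rewrite sym (eq tt) with ofSize r I | ≡⇒≡ᵇ (size I) r (size-initial r≤a)
      ...   | true | _ = refl

-- Codegrees and clusters

module Codegree {V : Set} (vs : List V) (E : V → V → Bool) where

  hit : Bool → V → V → ℕ
  hit false v y = 1
  hit true  v y = bit (E v y)

  common : ∀ {a} → Vec Bool a → Vec V a → V → ℕ
  common []      []      y = 1
  common (b ∷ S) (v ∷ x) y = hit b v y * common S x y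

  codeg : ∀ {a} → Vec Bool a → Vec V a → ℕ
  codeg S x = ∑ vs (common S x)

  common-insert₂ : ∀ {a} (p : Pos a) S b c o u v y →
    common (insert₂ p S b c) (insert₂ p o u v) y ≡ hit b u y * (hit c v y * common S o y)
  common-insert₂ here      S       b c o       u v y = refl
  common-insert₂ (there p) (d ∷ S) b c (w ∷ o) u v y =
    trans (cong (hit d w y *_) (common-insert₂ p S b c o u v y))
          (id₁ (hit d w y) (hit b u y) (hit c v y) (common S o y))
    where
    id₁ : ∀ d b c s → d * (b * (c * s)) ≡ b * (c * (d * s))
    id₁ = solve-∀

  common-swap : ∀ {a} (p : Pos a) (S : Vec Bool a) x y → common (swap p S) (swap p x) y ≡ common S x y
  common-swap here (b ∷ c ∷ S) (u ∷ v ∷ x) y = id₁ (hit c v y) (hit b u y) (common S x y)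
    where
    id₁ : ∀ c b s → c * (b * s) ≡ b * (c * s)
    id₁ = solve-∀
  common-swap (there p) (b ∷ S) (u ∷ x) y = cong (hit b u y *_) (common-swap p S x y)

  codeg-swap : ∀ {a} (p : Pos a) (S : Vec Bool a) x → codeg (swap p S) (swap p x) ≡ codeg S x
  codeg-swap p S x = ∑-cong vs (common-swap p S x)

  module _ (q : ℕ → ℕ) where

    -- The F_R of the overview: for fixed `x` it counts the placements of new vertices, `q (size S)`
    -- of them joined to the entries of `x` in S for each S ⊆ R.
    cluster : ∀ {a} → Vec Bool a → Vec V a → ℕ
    cluster R x = ∏ (subsetsOf R) (λ S → codeg S x ^ q (size S))

    module _ {a} (p : Pos a) where

      -- The factor of a cluster at the set with membership `b`, `c` at `p` and `S` elsewhere. Where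
      -- the membership is `false`, `hit` computes to 1, so that the piece is definitionally
      -- independent of the corresponding vertex.
      piece : Bool → Bool → Vec Bool (rest p) → Vec V (rest p) → V → V → ℕ
      piece b c S o u v = ∑ vs (λ y → hit b u y * (hit c v y * common S o y)) ^ q (bit b + (bit c + size S))

      piece-comm : ∀ b c S o u v → piece b c S o u v ≡ piece c b S o v u
      piece-comm b c S o u v = cong₂ _^_ (∑-cong vs λ y → id₁ (hit b u y) (hit c v y) (common S o y)) (cong q (id₂ (bit b) (bit c) (size S)))
        where
        id₁ : ∀ a b c → a * (b * c) ≡ b * (a * c)
        id₁ = solve-∀
        id₂ : ∀ a b c → a + (b + c) ≡ b + (a + c)
        id₂ = solve-∀

      cluster-insert₂ : ∀ R b c o u v → cluster (insert₂ p R b c) (insert₂ p o u v) ≡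
        ∏ (subsetsOf R) (λ S → ∏ (below b) (λ b′ → ∏ (below c) (λ c′ → piece b′ c′ S o u v)))
      cluster-insert₂ R b c o u v = trans (∏-subsetsOf-insert₂ p R b c _)
        (∏-cong (subsetsOf R) λ S → ∏-cong (below b) λ b′ → ∏-cong (below c) λ c′ →
          cong₂ _^_ (∑-cong vs (common-insert₂ p S b′ c′ o u v)) (cong q (size-insert₂ p S b′ c′)))

      -- If R contains both indices, its subsets with neither give constants, those with exactly one
      -- pair up into g(u) g(v), and those with both give powers of a codegree, which is a Gram
      -- kernel with one term per common neighbour y.
      cluster-kernel : ∀ b R o → Gram (λ u v → cluster (insert₂ p R b b) (insert₂ p o u v))
      cluster-kernel false R o = gram-cong (cluster-insert₂ R false false o)
        (gram-∏ (subsetsOf R) λ S → gram-const ((∑ vs (λ y → 1 * (1 * common S o y)) ^ q (size S)) * 1 * 1))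
      cluster-kernel true R o = gram-cong (λ u v → trans (cluster-insert₂ R true true o u v) (∏-cong (subsetsOf R) (regroup u v)))
        (gram-∏ (subsetsOf R) λ S → gram-* (gram-* (gram-const (∑ vs (λ y → 1 * (1 * common S o y)) ^ q (size S))) (gram-outer (λ u → piece true false S o u u)))
          (gram-^ (gram-cong (λ u v → ∑-cong vs λ y → id₂ (hit true u y) (hit true v y) (common S o y))
                             (gram-∑ vs (λ y → common S o y , λ u → hit true u y))) (q (suc (suc (size S))))))
        where
        id₁ : ∀ ff ft tf tt → (ff * (ft * 1)) * ((tf * (tt * 1)) * 1) ≡ ff * (tf * ft) * tt
        id₁ = solve-∀
        id₂ : ∀ a b c → a * (b * c) ≡ c * (a * b)
        id₂ = solve-∀
        regroup : ∀ u v S → ∏ (below true) (λ b → ∏ (below true) (λ c → piece b c S o u v)) ≡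
          piece false false S o u v * (piece true false S o u u * piece true false S o v v) * piece true true S o u v
        regroup u v S = trans
          (id₁ (piece false false S o u v) (piece false true S o u v) (piece true false S o u v) (piece true true S o u v))
          (cong (λ z → piece false false S o u v * (piece true false S o u v * z) * piece true true S o u v) (piece-comm false true S o u v))

      cluster-reflective : Reflective p cluster
      cluster-reflective = record
        { kernel     = cluster-kernel
        ; side       = λ R o u → ∏ (subsetsOf R) (λ S → ∏ (below true) (λ b → ∏ (below false) (λ c → piece b c S o u u)))
        ; side-left  = λ R o u v → cluster-insert₂ R true false o u v
        ; side-right = λ R o u v → trans (cluster-insert₂ R false true o u v)
            (∏-cong (subsetsOf R) λ S → trans (∏-swap (below false) (below true) (λ b c → piece b c S o u v))
              (∏-cong (below true) λ c → ∏-cong (below false) λ b → piece-comm b c S o u v))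
        }

-- A lower bound for one cluster by Hölder over stars

full : ∀ a → Vec Bool a
full zero    = []
full (suc a) = true ∷ full a

select : ∀ {V : Set} {a} (S : Vec Bool a) → Vec V a → Vec V (size S)
select []          []      = []
select (true ∷ S)  (v ∷ x) = v ∷ select S x
select (false ∷ S) (v ∷ x) = select S x

cosize : ∀ {a} → Vec Bool a → ℕ
cosize []      = 0
cosize (b ∷ S) = bit (not b) + cosize S

cosize+size : ∀ {a} (S : Vec Bool a) → cosize S + size S ≡ a
cosize+size []          = refl
cosize+size (true ∷ S)  = trans (+-suc _ _) (cong suc (cosize+size S))
cosize+size (false ∷ S) = cong suc (cosize+size S)

∏-replicate : {A : Set} (n : ℕ) (x : A) (f : A → ℕ) → ∏ (replicate n x) f ≡ f x ^ n
∏-replicate zero    x f = refl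
∏-replicate (suc n) x f = cong (f x *_) (∏-replicate n x f)

∑-replicate : {A : Set} (n : ℕ) (x : A) (f : A → ℕ) → ∑ (replicate n x) f ≡ n * f x
∑-replicate zero    x f = refl
∑-replicate (suc n) x f = cong (f x +_) (∑-replicate n x f)

∈-replicate : {A : Set} {n : ℕ} {x y : A} → y ∈ replicate n x → y ≡ x
∈-replicate {n = suc n} (here eq)   = eq
∈-replicate {n = suc n} (there y∈) = ∈-replicate {n = n} y∈

∣! : ∀ {d n} → 1 ≤ d → d ≤ n → d ∣ n !
∣! {suc d} _ d≤n = ∣-trans (m∣m*n (d !)) (m≤n⇒m!∣n! d≤n)

module LocalBound {V : Set} (vs : List V) (every : ∀ v → v ∈ vs) (E : V → V → Bool) where

  open Codegree vs E

  n L : ℕ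
  n = length vs
  L = n !

  instance
    L≢0 : NonZero L
    L≢0 = n !≢0

  deg : V → ℕ
  deg y = ∑ vs (λ v → bit (E v y))

  hit-01 : ∀ b v y → hit b v y ≡ 0 ⊎ hit b v y ≡ 1
  hit-01 false v y = inj₂ refl
  hit-01 true  v y with E v y
  ... | true  = inj₂ refl
  ... | false = inj₁ refl

  common-01 : ∀ {a} (S : Vec Bool a) x y → common S x y ≡ 0 ⊎ common S x y ≡ 1
  common-01 [] [] y = inj₂ refl
  common-01 (b ∷ S) (v ∷ x) y with hit-01 b v y
  ... | inj₁ eq = inj₁ (cong (_* common S x y) eq)
  ... | inj₂ eq rewrite eq | *-identityˡ (common S x y) = common-01 S x y

  common-full : ∀ {a} (S : Vec Bool a) x y → common (full a) x y ≡ 1 → common S x y ≡ 1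
  common-full [] [] y eq = refl
  common-full (b ∷ S) (v ∷ x) y eq
    rewrite common-full S x y (m*n≡1⇒n≡1 (hit true v y) _ eq) with b
  ... | true  rewrite m*n≡1⇒m≡1 (hit true v y) _ eq = refl
  ... | false = refl

  common-select : ∀ {a} (S : Vec Bool a) x y → common S x y ≡ common (full (size S)) (select S x) y
  common-select [] [] y = refl
  common-select (true ∷ S)  (v ∷ x) y = cong (hit true v y *_) (common-select S x y)
  common-select (false ∷ S) (v ∷ x) y = trans (*-identityˡ _) (common-select S x y)

  ∑-bits≤n : (f : V → ℕ) → (∀ y → f y ≡ 0 ⊎ f y ≡ 1) → ∑ vs f ≤ n
  ∑-bits≤n f f-01 = ≤-trans (∑-mono vs λ y → [ (λ eq → ≤-trans (≤-reflexive eq) z≤n) , ≤-reflexive ]′ (f-01 y)) (≤-reflexive (length-∑ vs))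

  deg≤n : ∀ y → deg y ≤ n
  deg≤n y = ∑-bits≤n _ (λ v → hit-01 true v y)

  codeg≤n : ∀ {a} (S : Vec Bool a) x → codeg S x ≤ n
  codeg≤n S x = ∑-bits≤n _ (common-01 S x)

  -- Nonzero degrees and codegrees lie between 1 and `n`, hence divide `L`; this single scale makes
  -- all reciprocal weights integral.
  inv : ℕ → ℕ
  inv = cofactor L

  inv-* : ∀ {d} → 1 ≤ d → d ≤ n → inv d * d ≡ L
  inv-* {d} 1≤d d≤n = cofactor-* L d (∣! 1≤d d≤n)

  inv-*-≤ : ∀ {d} → d ≤ n → inv d * d ≤ L
  inv-*-≤ {zero}  _   = z≤n
  inv-*-≤ {suc d} d≤n = ≤-reflexive (inv-* (s≤s z≤n) d≤n)

  -- A coordinate outside S is constrained only by adjacency to `y`, so it is summed freely and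
  -- contributes a factor `deg y`.
  ∑-marginal : ∀ {a} (S : Vec Bool a) (h : Vec V (size S) → ℕ) y →
    ∑ (vecs vs a) (λ x → common (full a) x y * h (select S x)) ≡
    deg y ^ cosize S * ∑ (vecs vs (size S)) (λ z → common (full (size S)) z y * h z)
  ∑-marginal [] h y = sym (+-identityʳ _)
  ∑-marginal {suc a} (true ∷ S) h y = begin
    ∑ (vecs vs (suc a)) (λ x → common (full (suc a)) x y * h (select (true ∷ S) x))
      ≡⟨ ∑-vecs-suc vs a _ ⟩
    ∑ vs (λ v → ∑ (vecs vs a) (λ x → hit true v y * common (full a) x y * h (v ∷ select S x)))
      ≡⟨ ∑-cong vs (λ v → trans (∑-cong (vecs vs a) λ x → *-assoc (hit true v y) _ _) (∑-*ˡ (vecs vs a) (hit true v y) _)) ⟩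
    ∑ vs (λ v → hit true v y * ∑ (vecs vs a) (λ x → common (full a) x y * h (v ∷ select S x)))
      ≡⟨ ∑-cong vs (λ v → trans (cong (hit true v y *_) (∑-marginal S (λ z → h (v ∷ z)) y)) (id₁ (hit true v y) (deg y ^ cosize S) _)) ⟩
    ∑ vs (λ v → deg y ^ cosize S * (hit true v y * ∑ (vecs vs (size S)) (λ z → common (full (size S)) z y * h (v ∷ z))))
      ≡⟨ ∑-*ˡ vs (deg y ^ cosize S) _ ⟩
    deg y ^ cosize S * ∑ vs (λ v → hit true v y * ∑ (vecs vs (size S)) (λ z → common (full (size S)) z y * h (v ∷ z)))
      ≡⟨ cong (deg y ^ cosize S *_) (∑-cong vs λ v → trans (sym (∑-*ˡ (vecs vs (size S)) (hit true v y) _))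
           (∑-cong (vecs vs (size S)) λ z → sym (*-assoc (hit true v y) _ _))) ⟩
    deg y ^ cosize S * ∑ vs (λ v → ∑ (vecs vs (size S)) (λ z → hit true v y * common (full (size S)) z y * h (v ∷ z)))
      ≡⟨ cong (deg y ^ cosize S *_) (sym (∑-vecs-suc vs (size S) _)) ⟩
    deg y ^ cosize S * ∑ (vecs vs (suc (size S))) (λ z → common (full (suc (size S))) z y * h z) ∎
    where
    open ≡-Reasoning
    id₁ : ∀ a b c → a * (b * c) ≡ b * (a * c)
    id₁ = solve-∀
  ∑-marginal {suc a} (false ∷ S) h y = begin
    ∑ (vecs vs (suc a)) (λ x → common (full (suc a)) x y * h (select (false ∷ S) x))
      ≡⟨ ∑-vecs-suc vs a _ ⟩
    ∑ vs (λ v → ∑ (vecs vs a) (λ x → hit true v y * common (full a) x y * h (select S x)))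
      ≡⟨ ∑-cong vs (λ v → trans (∑-cong (vecs vs a) λ x → *-assoc (hit true v y) _ _) (∑-*ˡ (vecs vs a) (hit true v y) _)) ⟩
    ∑ vs (λ v → hit true v y * ∑ (vecs vs a) (λ x → common (full a) x y * h (select S x)))
      ≡⟨ ∑-*ʳ vs _ _ ⟩
    deg y * ∑ (vecs vs a) (λ x → common (full a) x y * h (select S x))
      ≡⟨ cong (deg y *_) (∑-marginal S h y) ⟩
    deg y * (deg y ^ cosize S * ∑ (vecs vs (size S)) (λ z → common (full (size S)) z y * h z))
      ≡⟨ sym (*-assoc (deg y) _ _) ⟩
    deg y * deg y ^ cosize S * ∑ (vecs vs (size S)) (λ z → common (full (size S)) z y * h z) ∎
    where open ≡-Reasoning

  ∑-common-full : ∀ a y → ∑ (vecs vs a) (λ x → common (full a) x y) ≡ deg y ^ a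
  ∑-common-full zero    y = refl
  ∑-common-full (suc a) y = trans (∑-vecs-suc vs a _)
    (trans (∑-cong vs λ v → trans (∑-*ˡ (vecs vs a) (hit true v y) _) (cong (hit true v y *_) (∑-common-full a y))) (∑-*ʳ vs _ _))

  module _ (s t : ℕ) (q : ℕ → ℕ) where

    private
      r Q X e : ℕ
      r = suc s
      Q = ∑ (subsets r) (λ S → q (size S))
      X = ∑ (subsets r) (λ S → size S * q (size S))
      e = suc (Q + t)

    K : ℕ
    K = ∑ (vecs vs r) (λ x → codeg (full r) x * ∏ (subsets r) (λ S → codeg S x ^ q (size S)))

    -- Hölder over the stars (y , x), with x ranging over the r-tuples of neighbours of y. One factor
    -- is the summand of K; each other one has a weight making its total at most a power of n
    -- (up to powers of L = n!, where inv d = n! / d replaces 1 / d).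
    local-bound : r + X ≡ e → ∑ vs deg ^ e ≤ K * n ^ (X + t)
    local-bound r+X≡e = *-cancelˡ-≤ (L ^ (Q + s * e)) {{m^n≢0 L (Q + s * e)}} (begin
      L ^ (Q + s * e) * ∑ vs deg ^ e            ≡⟨ lhs ⟩
      L ^ Q * ∑ Ω D ^ e                         ≡⟨ cong (λ k → L ^ Q * ∑ Ω D ^ k) (sym length-js) ⟩
      L ^ Q * ∑ Ω D ^ length js                 ≤⟨ hölder js Ω proj₁ proj₂ (L ^ Q) D (≤-trans (s≤s z≤n) (≤-reflexive (sym length-js))) (λ ω → ≤-trans (≤-reflexive (cong (λ k → L ^ Q * D ω ^ k) length-js)) (pointwise ω)) totals ⟩
      ∏ js proj₂                                ≡⟨ rhs ⟩
      L ^ (Q + s * e) * (K * n ^ (X + t))       ∎)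
      where
      open ≤-Reasoning
      Ω : List (V × Vec V r)
      Ω = concatMap (λ y → map (y ,_) (vecs vs r)) vs
      ∑-Ω : (f : V × Vec V r → ℕ) → ∑ Ω f ≡ ∑ vs (λ y → ∑ (vecs vs r) (λ x → f (y , x)))
      ∑-Ω f = trans (∑-concatMap _ vs f) (∑-cong vs λ y → ∑-map (y ,_) (vecs vs r) f)

      Factor : Set
      Factor = (V × Vec V r → ℕ) × ℕ
      -- Each factor pairs a weight on stars with a bound for its total. `face S` occurs
      -- `q (size S)` times and cancels the codegrees in `base`; `t` copies of `leaf` bring the
      -- number of factors up to `e`, the number of edges.
      base leaf : Factor
      base = (λ { (y , x) → common (full r) x y * ∏ (subsets r) (λ S → codeg S x ^ q (size S)) }) , K
      leaf = (λ { (y , x) → common (full r) x y * inv (deg y) ^ r }) , L ^ r * n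
      face : Vec Bool r → Factor
      face S = (λ { (y , x) → common (full r) x y * (inv (deg y) ^ cosize S * inv (codeg S x)) }) , L ^ cosize S * (n ^ size S * L)
      -- A centre `y` has `deg y ^ r` stars, each weighted by `inv (deg y) ^ s` with r = s + 1, so
      -- they contribute `L ^ s * deg y` in total.
      D : V × Vec V r → ℕ
      D (y , x) = common (full r) x y * inv (deg y) ^ s
      js : List Factor
      js = base ∷ concatMap (λ S → replicate (q (size S)) (face S)) (subsets r) ++ replicate t leaf

      ∏-js : (f : Factor → ℕ) → ∏ js f ≡ f base * (∏ (subsets r) (λ S → f (face S) ^ q (size S)) * f leaf ^ t)
      ∏-js f = cong (f base *_) (trans (∏-++ (concatMap (λ S → replicate (q (size S)) (face S)) (subsets r)) _ f)
        (cong₂ _*_ (trans (∏-concatMap _ (subsets r) f) (∏-cong (subsets r) λ S → ∏-replicate (q (size S)) (face S) f))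
                   (∏-replicate t leaf f)))

      length-js : length js ≡ e
      length-js = trans (sym (length-∑ js)) (cong suc (trans (∑-++ (concatMap (λ S → replicate (q (size S)) (face S)) (subsets r)) _ _)
        (cong₂ _+_ (trans (∑-concatMap _ (subsets r) _) (∑-cong (subsets r) λ S → trans (∑-replicate (q (size S)) (face S) _) (*-identityʳ _)))
                   (trans (∑-replicate t leaf _) (*-identityʳ t)))))

      Y : ℕ
      Y = ∑ (subsets r) (λ S → cosize S * q (size S))

      -- The balance of powers of `inv (deg y)`: faces and leaves on the left, `D` to the power `e`
      -- on the right. It follows from cosize + size = r for each face together with r + X = e.
      exponents : Y + r * t ≡ s * e
      exponents = +-cancelʳ-≡ e _ _ (begin-equality
        Y + r * t + e              ≡⟨ cong (Y + r * t +_) (sym r+X≡e) ⟩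
        Y + r * t + (r + X)        ≡⟨ id₁ Y (r * t) r X ⟩
        (Y + X) + (r * t + r)      ≡⟨ cong (_+ (r * t + r)) Y+X ⟩
        r * Q + (r * t + r)        ≡⟨ id₂ s Q t ⟩
        s * e + e                  ∎)
        where
        id₁ : ∀ c a r x → c + a + (r + x) ≡ (c + x) + (a + r)
        id₁ = solve-∀
        id₂ : ∀ s Q t → suc s * Q + (suc s * t + suc s) ≡ s * suc (Q + t) + suc (Q + t)
        id₂ = solve-∀
        Y+X : Y + X ≡ r * Q
        Y+X = trans (sym (∑-+ (subsets r) _ _)) (trans (∑-cong (subsets r) λ S →
          trans (sym (*-distribʳ-+ (q (size S)) (cosize S) (size S))) (cong (_* q (size S)) (cosize+size S))) (∑-*ˡ (subsets r) r _))

      lhs : L ^ (Q + s * e) * ∑ vs deg ^ e ≡ L ^ Q * ∑ Ω D ^ e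
      lhs = begin-equality
        L ^ (Q + s * e) * ∑ vs deg ^ e          ≡⟨ cong (_* ∑ vs deg ^ e) (^-distribˡ-+-* L Q (s * e)) ⟩
        L ^ Q * L ^ (s * e) * ∑ vs deg ^ e      ≡⟨ *-assoc (L ^ Q) _ _ ⟩
        L ^ Q * (L ^ (s * e) * ∑ vs deg ^ e)    ≡⟨ cong (λ z → L ^ Q * (z * ∑ vs deg ^ e)) (sym (^-*-assoc L s e)) ⟩
        L ^ Q * ((L ^ s) ^ e * ∑ vs deg ^ e)    ≡⟨ cong (L ^ Q *_) (sym (^-distribʳ-* (L ^ s) (∑ vs deg) e)) ⟩
        L ^ Q * (L ^ s * ∑ vs deg) ^ e          ≡⟨ cong (λ z → L ^ Q * z ^ e) (sym ∑D) ⟩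
        L ^ Q * ∑ Ω D ^ e                       ∎
        where
        id₁ : ∀ d D i → d * D * i ≡ i * D * d
        id₁ = solve-∀
        normalise : ∀ d → d ≤ n → d ^ r * inv d ^ s ≡ L ^ s * d
        normalise zero    _   = sym (*-zeroʳ (L ^ s))
        normalise d@(suc _) d≤n = begin-equality
          d * d ^ s * inv d ^ s   ≡⟨ id₁ d (d ^ s) (inv d ^ s) ⟩
          inv d ^ s * d ^ s * d   ≡⟨ cong (_* d) (sym (^-distribʳ-* (inv d) d s)) ⟩
          (inv d * d) ^ s * d     ≡⟨ cong (λ z → z ^ s * d) (inv-* (s≤s z≤n) d≤n) ⟩
          L ^ s * d               ∎
        ∑D : ∑ Ω D ≡ L ^ s * ∑ vs deg
        ∑D = begin-equality
          ∑ Ω D                                          ≡⟨ ∑-Ω D ⟩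
          ∑ vs (λ y → ∑ (vecs vs r) (λ x → D (y , x)))   ≡⟨ ∑-cong vs (λ y → ∑-*ʳ (vecs vs r) _ _) ⟩
          ∑ vs (λ y → ∑ (vecs vs r) (λ x → common (full r) x y) * inv (deg y) ^ s)
                                                         ≡⟨ ∑-cong vs (λ y → cong (_* inv (deg y) ^ s) (∑-common-full r y)) ⟩
          ∑ vs (λ y → deg y ^ r * inv (deg y) ^ s)       ≡⟨ ∑-cong vs (λ y → normalise (deg y) (deg≤n y)) ⟩
          ∑ vs (λ y → L ^ s * deg y)                     ≡⟨ ∑-*ˡ vs (L ^ s) deg ⟩
          L ^ s * ∑ vs deg                               ∎

      rhs : ∏ js proj₂ ≡ L ^ (Q + s * e) * (K * n ^ (X + t))
      rhs = begin-equality
        ∏ js proj₂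
          ≡⟨ ∏-js proj₂ ⟩
        K * (∏ (subsets r) (λ S → (L ^ cosize S * (n ^ size S * L)) ^ q (size S)) * (L ^ r * n) ^ t)
          ≡⟨ cong₂ (λ a b → K * (a * b)) faces (trans (^-distribʳ-* (L ^ r) n t) (cong (_* n ^ t) (^-*-assoc L r t))) ⟩
        K * (L ^ Y * (n ^ X * L ^ Q) * (L ^ (r * t) * n ^ t))
          ≡⟨ id₁ K (L ^ Y) (n ^ X) (L ^ Q) (L ^ (r * t)) (n ^ t) ⟩
        L ^ Q * (L ^ Y * L ^ (r * t)) * (K * (n ^ X * n ^ t))
          ≡⟨ cong₂ (λ a b → L ^ Q * a * (K * b)) (trans (sym (^-distribˡ-+-* L Y (r * t))) (cong (L ^_) exponents)) (sym (^-distribˡ-+-* n X t)) ⟩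
        L ^ Q * L ^ (s * e) * (K * n ^ (X + t))
          ≡⟨ cong (_* (K * n ^ (X + t))) (sym (^-distribˡ-+-* L Q (s * e))) ⟩
        L ^ (Q + s * e) * (K * n ^ (X + t)) ∎
        where
        id₁ : ∀ k c x q r t → k * (c * (x * q) * (r * t)) ≡ q * (c * r) * (k * (x * t))
        id₁ = solve-∀
        split : ∀ S → (L ^ cosize S * (n ^ size S * L)) ^ q (size S) ≡
          L ^ (cosize S * q (size S)) * (n ^ (size S * q (size S)) * L ^ q (size S))
        split S = trans (^-distribʳ-* (L ^ cosize S) _ (q (size S))) (cong₂ _*_ (^-*-assoc L (cosize S) (q (size S)))
          (trans (^-distribʳ-* (n ^ size S) L (q (size S))) (cong (_* L ^ q (size S)) (^-*-assoc n (size S) (q (size S))))))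
        faces : ∏ (subsets r) (λ S → (L ^ cosize S * (n ^ size S * L)) ^ q (size S)) ≡ L ^ Y * (n ^ X * L ^ Q)
        faces = begin-equality
          ∏ (subsets r) (λ S → (L ^ cosize S * (n ^ size S * L)) ^ q (size S))
            ≡⟨ ∏-cong (subsets r) split ⟩
          ∏ (subsets r) (λ S → L ^ (cosize S * q (size S)) * (n ^ (size S * q (size S)) * L ^ q (size S)))
            ≡⟨ ∏-* (subsets r) _ _ ⟩
          ∏ (subsets r) (λ S → L ^ (cosize S * q (size S))) * ∏ (subsets r) (λ S → n ^ (size S * q (size S)) * L ^ q (size S))
            ≡⟨ cong₂ _*_ (^-∑ L (subsets r) _) (trans (∏-* (subsets r) _ _) (cong₂ _*_ (^-∑ n (subsets r) _) (^-∑ L (subsets r) _))) ⟩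
          L ^ Y * (n ^ X * L ^ Q) ∎

      pointwise : ∀ ω → L ^ Q * D ω ^ e ≤ ∏ js (λ j → proj₁ j ω)
      pointwise (y , x) with common-01 (full r) x y
      ... | inj₁ eq = ≤-trans (≤-reflexive (trans (cong (λ z → L ^ Q * (z * inv (deg y) ^ s) ^ e) eq) (*-zeroʳ (L ^ Q)))) z≤n
      ... | inj₂ eq = ≤-reflexive (sym (begin-equality
        ∏ js (λ j → proj₁ j (y , x))
          ≡⟨ ∏-js (λ j → proj₁ j (y , x)) ⟩
        common (full r) x y * F * (∏ (subsets r) (λ S → (common (full r) x y * (i ^ cosize S * inv (codeg S x))) ^ q (size S)) * (common (full r) x y * i ^ r) ^ t)
          ≡⟨ cong (λ z → z * F * (∏ (subsets r) (λ S → (z * (i ^ cosize S * inv (codeg S x))) ^ q (size S)) * (z * i ^ r) ^ t)) eq ⟩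
        1 * F * (∏ (subsets r) (λ S → (1 * (i ^ cosize S * inv (codeg S x))) ^ q (size S)) * (1 * i ^ r) ^ t)
          ≡⟨ cong₂ _*_ (*-identityˡ F) (cong₂ _*_ (∏-cong (subsets r) λ S → trans (cong (_^ q (size S)) (*-identityˡ _)) (^-distribʳ-* (i ^ cosize S) (inv (codeg S x)) (q (size S))))
                                                 (trans (cong (_^ t) (*-identityˡ (i ^ r))) (^-*-assoc i r t))) ⟩
        F * (∏ (subsets r) (λ S → (i ^ cosize S) ^ q (size S) * inv (codeg S x) ^ q (size S)) * i ^ (r * t))
          ≡⟨ cong (λ z → F * (z * i ^ (r * t))) (trans (∏-* (subsets r) _ _) (cong (_* G) (trans (∏-cong (subsets r) λ S → ^-*-assoc i (cosize S) (q (size S))) (^-∑ i (subsets r) _)))) ⟩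
        F * (i ^ Y * G * i ^ (r * t))
          ≡⟨ id₁ F (i ^ Y) G (i ^ (r * t)) ⟩
        G * F * (i ^ Y * i ^ (r * t))
          ≡⟨ cong₂ _*_ cancelled (trans (sym (^-distribˡ-+-* i Y (r * t))) (cong (i ^_) exponents)) ⟩
        L ^ Q * i ^ (s * e)
          ≡⟨ cong (L ^ Q *_) (trans (sym (^-*-assoc i s e)) (cong (_^ e) (sym (*-identityˡ (i ^ s))))) ⟩
        L ^ Q * (1 * i ^ s) ^ e
          ≡⟨ cong (λ z → L ^ Q * (z * i ^ s) ^ e) (sym eq) ⟩
        L ^ Q * D (y , x) ^ e ∎))
        where
        i = inv (deg y)
        F = ∏ (subsets r) (λ S → codeg S x ^ q (size S))
        G = ∏ (subsets r) (λ S → inv (codeg S x) ^ q (size S))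
        id₁ : ∀ f c g d → f * (c * g * d) ≡ g * f * (c * d)
        id₁ = solve-∀
        -- The centre `y` is itself a common neighbour of every part of the star, so all the
        -- reciprocals here are exact.
        1≤codeg : ∀ S → 1 ≤ codeg S x
        1≤codeg S = ≤-trans (≤-reflexive (sym (common-full S x y eq))) (∈⇒≤∑ (common S x) (every y))
        cancelled : G * F ≡ L ^ Q
        cancelled = begin-equality
          G * F
            ≡⟨ sym (∏-* (subsets r) _ _) ⟩
          ∏ (subsets r) (λ S → inv (codeg S x) ^ q (size S) * codeg S x ^ q (size S))
            ≡⟨ ∏-cong (subsets r) (λ S → trans (sym (^-distribʳ-* (inv (codeg S x)) (codeg S x) (q (size S)))) (cong (_^ q (size S)) (inv-* (1≤codeg S) (codeg≤n S x)))) ⟩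
          ∏ (subsets r) (λ S → L ^ q (size S))
            ≡⟨ ^-∑ L (subsets r) _ ⟩
          L ^ Q ∎

      total-base : ∑ Ω (proj₁ base) ≤ K
      total-base = ≤-reflexive (trans (∑-Ω (proj₁ base)) (trans (∑-swap vs (vecs vs r) _) (∑-cong (vecs vs r) λ x → ∑-*ʳ vs _ _)))

      total-leaf : ∑ Ω (proj₁ leaf) ≤ L ^ r * n
      total-leaf = begin
        ∑ Ω (proj₁ leaf)
          ≡⟨ ∑-Ω (proj₁ leaf) ⟩
        ∑ vs (λ y → ∑ (vecs vs r) (λ x → common (full r) x y * inv (deg y) ^ r))
          ≡⟨ ∑-cong vs (λ y → trans (∑-*ʳ (vecs vs r) _ _) (cong (_* inv (deg y) ^ r) (∑-common-full r y))) ⟩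
        ∑ vs (λ y → deg y ^ r * inv (deg y) ^ r)
          ≤⟨ ∑-mono vs (λ y → ≤-trans (≤-reflexive (trans (*-comm (deg y ^ r) _) (sym (^-distribʳ-* (inv (deg y)) (deg y) r)))) (^-monoˡ-≤ r (inv-*-≤ (deg≤n y)))) ⟩
        ∑ vs (λ y → L ^ r)
          ≡⟨ trans (∑-const vs (L ^ r)) (*-comm n _) ⟩
        L ^ r * n ∎

      -- Summing over the coordinates outside S gives `deg y ^ cosize S`, cancelled by the first
      -- reciprocal; summing over `y` then gives the codegree of the tuple on S, cancelled by the
      -- second. What remains is one term for each of the `n ^ size S` tuples.
      total-face : ∀ S → ∑ Ω (proj₁ (face S)) ≤ L ^ cosize S * (n ^ size S * L)
      total-face S = begin
        ∑ Ω (proj₁ (face S))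
          ≡⟨ ∑-Ω (proj₁ (face S)) ⟩
        ∑ vs (λ y → ∑ (vecs vs r) (λ x → common (full r) x y * (inv (deg y) ^ cosize S * inv (codeg S x))))
          ≡⟨ ∑-cong vs (λ y → trans (∑-cong (vecs vs r) λ x → trans (id₁ (common (full r) x y) (inv (deg y) ^ cosize S) (inv (codeg S x)))
               (cong (λ z → inv (deg y) ^ cosize S * (common (full r) x y * inv z)) (∑-cong vs (common-select S x)))) (∑-*ˡ (vecs vs r) (inv (deg y) ^ cosize S) _)) ⟩
        ∑ vs (λ y → inv (deg y) ^ cosize S * ∑ (vecs vs r) (λ x → common (full r) x y * h (select S x)))
          ≡⟨ ∑-cong vs (λ y → trans (cong (inv (deg y) ^ cosize S *_) (∑-marginal S h y)) (trans (sym (*-assoc (inv (deg y) ^ cosize S) _ _))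
               (cong (_* Z y) (sym (^-distribʳ-* (inv (deg y)) (deg y) (cosize S)))))) ⟩
        ∑ vs (λ y → (inv (deg y) * deg y) ^ cosize S * Z y)
          ≤⟨ ∑-mono vs (λ y → *-monoˡ-≤ (Z y) (^-monoˡ-≤ (cosize S) (inv-*-≤ (deg≤n y)))) ⟩
        ∑ vs (λ y → L ^ cosize S * Z y)
          ≡⟨ ∑-*ˡ vs (L ^ cosize S) Z ⟩
        L ^ cosize S * ∑ vs Z
          ≡⟨ cong (L ^ cosize S *_) (trans (∑-swap vs (vecs vs (size S)) _) (∑-cong (vecs vs (size S)) λ z → trans (∑-*ʳ vs _ (h z)) (*-comm _ (h z)))) ⟩
        L ^ cosize S * ∑ (vecs vs (size S)) (λ z → h z * codeg (full (size S)) z)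
          ≤⟨ *-monoʳ-≤ (L ^ cosize S) (∑-mono (vecs vs (size S)) λ z → inv-*-≤ (codeg≤n (full (size S)) z)) ⟩
        L ^ cosize S * ∑ (vecs vs (size S)) (λ _ → L)
          ≡⟨ cong (L ^ cosize S *_) (trans (∑-const (vecs vs (size S)) L) (cong (_* L) (length-vecs vs (size S)))) ⟩
        L ^ cosize S * (n ^ size S * L) ∎
        where
        h : Vec V (size S) → ℕ
        h z = inv (codeg (full (size S)) z)
        Z : V → ℕ
        Z y = ∑ (vecs vs (size S)) (λ z → common (full (size S)) z y * h z)
        id₁ : ∀ a b c → a * (b * c) ≡ b * (a * c)
        id₁ = solve-∀

      totals : ∀ {j} → j ∈ js → ∑ Ω (proj₁ j) ≤ proj₂ j
      totals (here refl) = total-base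
      totals (there j∈) with ∈-++⁻ (concatMap (λ S → replicate (q (size S)) (face S)) (subsets r)) j∈
      ... | inj₂ j∈′ with refl ← ∈-replicate {n = t} j∈′ = total-leaf
      ... | inj₁ j∈′ with S , j∈″ ← satisfied (∈-concatMap⁻ (λ S → replicate (q (size S)) (face S)) {xs = subsets r} j∈′)
            with refl ← ∈-replicate {n = q (size S)} j∈″ = total-face S

-- Rearrangements of a vector

under : {V : Set} {a : ℕ} → V → V × Vec V a → V × Vec V (suc a)
under u (v , y) = v , u ∷ y

picks : {V : Set} {a : ℕ} → Vec V (suc a) → List (V × Vec V a)
picks (u ∷ [])        = (u , []) ∷ []
picks (u ∷ x@(_ ∷ _)) = (u , x) ∷ map (under u) (picks x)

-- Rearrangements are listed with multiplicity, so every orbit has length `a !`, even if entries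
-- coincide, and AM-GM has the same exponent at each `x`.
perms : {V : Set} {a : ℕ} → Vec V a → List (Vec V a)
perms {a = zero}  x = x ∷ []
perms {a = suc a} x = concatMap (λ { (v , y) → map (v ∷_) (perms y) }) (picks x)

∏-perms-suc : {V : Set} {a : ℕ} (x : Vec V (suc a)) (h : Vec V (suc a) → ℕ) →
  ∏ (perms x) h ≡ ∏ (picks x) (λ { (v , y) → ∏ (perms y) (λ z → h (v ∷ z)) })
∏-perms-suc x h = trans (∏-concatMap _ (picks x) h) (∏-cong (picks x) λ { (v , y) → ∏-map (v ∷_) (perms y) h })

∑-perms-suc : {V : Set} {a : ℕ} (x : Vec V (suc a)) (h : Vec V (suc a) → ℕ) →
  ∑ (perms x) h ≡ ∑ (picks x) (λ { (v , y) → ∑ (perms y) (λ z → h (v ∷ z)) })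
∑-perms-suc x h = trans (∑-concatMap _ (picks x) h) (∑-cong (picks x) λ { (v , y) → ∑-map (v ∷_) (perms y) h })

length-picks : {V : Set} {a : ℕ} (x : Vec V (suc a)) → length (picks x) ≡ suc a
length-picks (u ∷ [])        = refl
length-picks (u ∷ x@(_ ∷ _)) = cong suc (trans (trans (sym (length-∑ (map _ (picks x)))) (trans (∑-map _ (picks x) _) (length-∑ (picks x)))) (length-picks x))

length-perms : {V : Set} {a : ℕ} (x : Vec V a) → length (perms x) ≡ a !
length-perms {a = zero}  x = refl
length-perms {a = suc a} x = begin
  length (perms x)                                 ≡⟨ sym (length-∑ (perms x)) ⟩
  ∑ (perms x) (λ _ → 1)                            ≡⟨ ∑-perms-suc x _ ⟩
  ∑ (picks x) (λ { (v , y) → ∑ (perms y) (λ _ → 1) })  ≡⟨ ∑-cong (picks x) (λ { (v , y) → trans (length-∑ (perms y)) (length-perms y) }) ⟩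
  ∑ (picks x) (λ _ → a !)                          ≡⟨ ∑-const (picks x) (a !) ⟩
  length (picks x) * a !                           ≡⟨ cong (_* a !) (length-picks x) ⟩
  suc a * a !                                      ∎
  where open ≡-Reasoning

-- Ordered pairs of positions are split by the head `u`: it is picked first, second, or not at all.
-- Exchanging the picks swaps the first two classes, and induction handles the third.
∏-picks-picks-comm : {V : Set} {a : ℕ} (x : Vec V (suc (suc a))) (g : V → V → Vec V a → ℕ) →
  ∏ (picks x) (λ { (v , y) → ∏ (picks y) (λ { (w , z) → g v w z }) }) ≡
  ∏ (picks x) (λ { (v , y) → ∏ (picks y) (λ { (w , z) → g w v z }) })
∏-picks-picks-comm (u ∷ v ∷ []) g = id₁ (g u v []) (g v u [])
  where
  id₁ : ∀ a b → a * 1 * (b * 1 * 1) ≡ b * 1 * (a * 1 * 1)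
  id₁ = solve-∀
∏-picks-picks-comm (u ∷ x@(_ ∷ _ ∷ _)) g = begin
  ∏ (picks (u ∷ x)) (both g)
    ≡⟨ peel g ⟩
  first * (second * ∏ (picks x) (both (λ v w z → g v w (u ∷ z))))
    ≡⟨ cong (λ t → first * (second * t)) (∏-picks-picks-comm x (λ v w z → g v w (u ∷ z))) ⟩
  first * (second * ∏ (picks x) (both (λ v w z → g w v (u ∷ z))))
    ≡⟨ id₁ first second _ ⟩
  second * (first * ∏ (picks x) (both (λ v w z → g w v (u ∷ z))))
    ≡⟨ sym (peel (λ v w z → g w v z)) ⟩
  ∏ (picks (u ∷ x)) (both (λ v w z → g w v z)) ∎
  where
  open ≡-Reasoning
  both : {V : Set} {a : ℕ} → (V → V → Vec V a → ℕ) → V × Vec V (suc a) → ℕ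
  both g (v , y) = ∏ (picks y) (λ { (w , z) → g v w z })
  first second : ℕ
  first  = ∏ (picks x) (λ { (v , y) → g u v y })
  second = ∏ (picks x) (λ { (v , y) → g v u y })
  id₁ : ∀ a b c → a * (b * c) ≡ b * (a * c)
  id₁ = solve-∀
  both-∷ : ∀ g v y → both g (v , u ∷ y) ≡ g v u y * both (λ v w z → g v w (u ∷ z)) (v , y)
  both-∷ g v (w ∷ z) = cong (g v u (w ∷ z) *_) (∏-map _ (picks (w ∷ z)) _)
  peel : ∀ g → ∏ (picks (u ∷ x)) (both g) ≡
    ∏ (picks x) (λ { (v , y) → g u v y }) * (∏ (picks x) (λ { (v , y) → g v u y }) * ∏ (picks x) (both (λ v w z → g v w (u ∷ z))))
  peel g = cong (∏ (picks x) (λ { (v , y) → g u v y }) *_) (begin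
    ∏ (map (under u) (picks x)) (both g)
      ≡⟨ ∏-map (under u) (picks x) (both g) ⟩
    ∏ (picks x) (λ { (v , y) → both g (v , u ∷ y) })
      ≡⟨ ∏-cong (picks x) (λ { (v , y) → both-∷ g v y }) ⟩
    ∏ (picks x) (λ { (v , y) → g v u y * both (λ v w z → g v w (u ∷ z)) (v , y) })
      ≡⟨ ∏-* (picks x) (λ { (v , y) → g v u y }) (both (λ v w z → g v w (u ∷ z))) ⟩
    ∏ (picks x) (λ { (v , y) → g v u y }) * ∏ (picks x) (both (λ v w z → g v w (u ∷ z))) ∎)

∏-perms-swap : {V : Set} {a : ℕ} (p : Pos a) (x : Vec V a) (h : Vec V a → ℕ) →
  ∏ (perms x) (h ∘ swap p) ≡ ∏ (perms x) h
∏-perms-swap {V} here x h = begin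
  ∏ (perms x) (h ∘ swap here)
    ≡⟨ two (h ∘ swap here) ⟩
  ∏ (picks x) (λ { (v , y) → ∏ (picks y) (λ { (w , z) → ∏ (perms z) (λ z → h (w ∷ v ∷ z)) }) })
    ≡⟨ ∏-picks-picks-comm x (λ v w z → ∏ (perms z) (λ z → h (w ∷ v ∷ z))) ⟩
  ∏ (picks x) (λ { (v , y) → ∏ (picks y) (λ { (w , z) → ∏ (perms z) (λ z → h (v ∷ w ∷ z)) }) })
    ≡⟨ sym (two h) ⟩
  ∏ (perms x) h ∎
  where
  open ≡-Reasoning
  two : ∀ h → ∏ (perms x) h ≡ ∏ (picks x) (λ { (v , y) → ∏ (picks y) (λ { (w , z) → ∏ (perms z) (λ z → h (v ∷ w ∷ z)) }) })
  two h = trans (∏-perms-suc x h) (∏-cong (picks x) λ { (v , y) → ∏-perms-suc y (λ z → h (v ∷ z)) })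
∏-perms-swap (there p) x h = begin
  ∏ (perms x) (h ∘ swap (there p))
    ≡⟨ ∏-perms-suc x _ ⟩
  ∏ (picks x) (λ { (v , y) → ∏ (perms y) (λ z → h (v ∷ swap p z)) })
    ≡⟨ ∏-cong (picks x) (λ { (v , y) → ∏-perms-swap p y (λ z → h (v ∷ z)) }) ⟩
  ∏ (picks x) (λ { (v , y) → ∏ (perms y) (λ z → h (v ∷ z)) })
    ≡⟨ sym (∏-perms-suc x h) ⟩
  ∏ (perms x) h ∎
  where open ≡-Reasoning

-- A picked entry is brought to the front by adjacent swaps: one swap moves it past `u`, and
-- induction treats the vector below `u`.
∏-picks-invariant : {V : Set} {a : ℕ} (Φ : Vec V (suc a) → ℕ) → (∀ p x → Φ (swap p x) ≡ Φ x) →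
  ∀ x → ∏ (picks x) (λ { (v , y) → Φ (v ∷ y) }) ≡ ∏ (picks x) (λ _ → Φ x)
∏-picks-invariant Φ inv (u ∷ [])        = refl
∏-picks-invariant Φ inv (u ∷ x@(_ ∷ _)) = cong (Φ (u ∷ x) *_) (begin
  ∏ (map (under u) (picks x)) (λ { (v , y) → Φ (v ∷ y) })
    ≡⟨ ∏-map _ (picks x) _ ⟩
  ∏ (picks x) (λ { (v , y) → Φ (v ∷ u ∷ y) })
    ≡⟨ ∏-cong (picks x) (λ { (v , y) → inv here (u ∷ v ∷ y) }) ⟩
  ∏ (picks x) (λ { (v , y) → Φ (u ∷ v ∷ y) })
    ≡⟨ ∏-picks-invariant (λ z → Φ (u ∷ z)) (λ p z → inv (there p) (u ∷ z)) x ⟩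
  ∏ (picks x) (λ _ → Φ (u ∷ x))
    ≡⟨ sym (∏-map _ (picks x) _) ⟩
  ∏ (map (under u) (picks x)) (λ _ → Φ (u ∷ x)) ∎)
  where open ≡-Reasoning

∏-perms-invariant : {V : Set} {a : ℕ} (Φ : Vec V a → ℕ) → (∀ p x → Φ (swap p x) ≡ Φ x) →
  ∀ x → ∏ (perms x) Φ ≡ Φ x ^ (a !)
∏-perms-invariant {a = zero}  Φ inv x = refl
∏-perms-invariant {a = suc a} Φ inv x = begin
  ∏ (perms x) Φ
    ≡⟨ ∏-perms-suc x Φ ⟩
  ∏ (picks x) (λ { (v , y) → ∏ (perms y) (λ z → Φ (v ∷ z)) })
    ≡⟨ ∏-cong (picks x) (λ { (v , y) → ∏-perms-invariant (λ z → Φ (v ∷ z)) (λ p z → inv (there p) (v ∷ z)) y }) ⟩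
  ∏ (picks x) (λ { (v , y) → Φ (v ∷ y) ^ (a !) })
    ≡⟨ ∏-picks-invariant (λ z → Φ z ^ (a !)) (λ p z → cong (_^ (a !)) (inv p z)) x ⟩
  ∏ (picks x) (λ _ → Φ x ^ (a !))
    ≡⟨ ∏-const (picks x) _ ⟩
  (Φ x ^ (a !)) ^ length (picks x)
    ≡⟨ cong ((Φ x ^ (a !)) ^_) (length-picks x) ⟩
  (Φ x ^ (a !)) ^ suc a
    ≡⟨ ^-*-assoc (Φ x) (a !) (suc a) ⟩
  Φ x ^ (a ! * suc a)
    ≡⟨ cong (Φ x ^_) (*-comm (a !) (suc a)) ⟩
  Φ x ^ (suc a * a !) ∎
  where open ≡-Reasoning

∑-vecs-picks : {V : Set} (vs : List V) (a : ℕ) (g : V → Vec V a → ℕ) →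
  ∑ (vecs vs (suc a)) (λ x → ∑ (picks x) (λ { (v , y) → g v y })) ≡ suc a * ∑ vs (λ v → ∑ (vecs vs a) (g v))
∑-vecs-picks vs zero g = trans (∑-vecs-suc vs 0 _) (trans (∑-cong vs λ v → +-identityʳ _) (sym (+-identityʳ _)))
∑-vecs-picks {V} vs (suc a) g = begin
  ∑ (vecs vs (suc (suc a))) (λ x → ∑ (picks x) (λ { (v , y) → g v y }))
    ≡⟨ ∑-vecs-suc vs (suc a) _ ⟩
  ∑ vs (λ u → ∑ (vecs vs (suc a)) (λ x → ∑ (picks (u ∷ x)) (λ { (v , y) → g v y })))
    ≡⟨ ∑-cong vs (λ u → trans (∑-cong (vecs vs (suc a)) (peel u)) (∑-+ (vecs vs (suc a)) _ _)) ⟩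
  ∑ vs (λ u → ∑ (vecs vs (suc a)) (g u) + ∑ (vecs vs (suc a)) (λ x → ∑ (picks x) (λ { (v , y) → g v (u ∷ y) })))
    ≡⟨ ∑-+ vs _ _ ⟩
  total + ∑ vs (λ u → ∑ (vecs vs (suc a)) (λ x → ∑ (picks x) (λ { (v , y) → g v (u ∷ y) })))
    ≡⟨ cong (total +_) (∑-cong vs λ u → ∑-vecs-picks vs a (λ v y → g v (u ∷ y))) ⟩
  total + ∑ vs (λ u → suc a * ∑ vs (λ v → ∑ (vecs vs a) (λ y → g v (u ∷ y))))
    ≡⟨ cong (total +_) (∑-*ˡ vs (suc a) _) ⟩
  total + suc a * ∑ vs (λ u → ∑ vs (λ v → ∑ (vecs vs a) (λ y → g v (u ∷ y))))
    ≡⟨ cong (λ z → total + suc a * z) (trans (∑-swap vs vs _) (∑-cong vs λ v → sym (∑-vecs-suc vs a (g v)))) ⟩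
  total + suc a * total ∎
  where
  open ≡-Reasoning
  total = ∑ vs (λ v → ∑ (vecs vs (suc a)) (g v))
  peel : ∀ u (x : Vec V (suc a)) → ∑ (picks (u ∷ x)) (λ { (v , y) → g v y }) ≡ g u x + ∑ (picks x) (λ { (v , y) → g v (u ∷ y) })
  peel u x@(_ ∷ _) = cong (g u x +_) (∑-map _ (picks x) _)

-- Each of the `a !` rearrangements permutes the set of all tuples, so it leaves the total of `F`
-- unchanged.
∑-vecs-perms : {V : Set} (vs : List V) (a : ℕ) (F : Vec V a → ℕ) →
  ∑ (vecs vs a) (λ x → ∑ (perms x) F) ≡ a ! * ∑ (vecs vs a) F
∑-vecs-perms vs zero    F = refl
∑-vecs-perms vs (suc a) F = begin
  ∑ (vecs vs (suc a)) (λ x → ∑ (perms x) F)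
    ≡⟨ ∑-cong (vecs vs (suc a)) (λ x → ∑-perms-suc x F) ⟩
  ∑ (vecs vs (suc a)) (λ x → ∑ (picks x) (λ { (v , y) → ∑ (perms y) (λ z → F (v ∷ z)) }))
    ≡⟨ ∑-vecs-picks vs a (λ v y → ∑ (perms y) (λ z → F (v ∷ z))) ⟩
  suc a * ∑ vs (λ v → ∑ (vecs vs a) (λ y → ∑ (perms y) (λ z → F (v ∷ z))))
    ≡⟨ cong (suc a *_) (trans (∑-cong vs λ v → ∑-vecs-perms vs a _) (∑-*ˡ vs (a !) _)) ⟩
  suc a * (a ! * ∑ vs (λ v → ∑ (vecs vs a) (λ z → F (v ∷ z))))
    ≡⟨ sym (*-assoc (suc a) (a !) _) ⟩
  suc a * a ! * ∑ vs (λ v → ∑ (vecs vs a) (λ z → F (v ∷ z)))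
    ≡⟨ cong (suc a * a ! *_) (sym (∑-vecs-suc vs a F)) ⟩
  suc a * a ! * ∑ (vecs vs (suc a)) F ∎
  where open ≡-Reasoning

-- Symmetrisation by AM-GM

∏-subsetsOf-swap : ∀ {a} (p : Pos a) (R : Vec Bool a) (h : Vec Bool a → ℕ) →
  ∏ (subsetsOf (swap p R)) h ≡ ∏ (subsetsOf R) (h ∘ swap p)
∏-subsetsOf-swap here (b ∷ c ∷ R) h = begin
  ∏ (subsetsOf (c ∷ b ∷ R)) h
    ≡⟨ ∏-subsetsOf-insert₂ here R c b h ⟩
  ∏ (subsetsOf R) (λ S → ∏ (below c) (λ c′ → ∏ (below b) (λ b′ → h (c′ ∷ b′ ∷ S))))
    ≡⟨ ∏-cong (subsetsOf R) (λ S → ∏-swap (below c) (below b) (λ c′ b′ → h (c′ ∷ b′ ∷ S))) ⟩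
  ∏ (subsetsOf R) (λ S → ∏ (below b) (λ b′ → ∏ (below c) (λ c′ → h (c′ ∷ b′ ∷ S))))
    ≡⟨ sym (∏-subsetsOf-insert₂ here R b c (h ∘ swap here)) ⟩
  ∏ (subsetsOf (b ∷ c ∷ R)) (h ∘ swap here) ∎
  where open ≡-Reasoning
∏-subsetsOf-swap (there p) (d ∷ R) h = begin
  ∏ (subsetsOf (d ∷ swap p R)) h
    ≡⟨ ∏-subsetsOf-∷ d (swap p R) h ⟩
  ∏ (below d) (λ d′ → ∏ (subsetsOf (swap p R)) (λ S → h (d′ ∷ S)))
    ≡⟨ ∏-cong (below d) (λ d′ → ∏-subsetsOf-swap p R _) ⟩
  ∏ (below d) (λ d′ → ∏ (subsetsOf R) (λ S → h (d′ ∷ swap p S)))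
    ≡⟨ sym (∏-subsetsOf-∷ d R _) ⟩
  ∏ (subsetsOf (d ∷ R)) (h ∘ swap (there p)) ∎
  where open ≡-Reasoning

-- A comparator acts on a given set as the identity or as a swap, so the sorting network carries S
-- to an initial segment without changing `g`.
swap-invariant⇒size : ∀ {a} (g : Vec Bool a → ℕ) → (∀ p S → g (swap p S) ≡ g S) → ∀ S → g S ≡ g (initial a (size S))
swap-invariant⇒size {a} g inv S = trans (sym (along (sortingNetwork a) S)) (cong g (sortingNetwork-sorts S))
  where
  along : ∀ ps S → g (raiseAll ps S) ≡ g S
  along []       S = refl
  along (p ∷ ps) S with raise-id-or-swap p S
  ... | inj₁ eq = trans (along ps (raise p S)) (cong g eq)
  ... | inj₂ eq = trans (along ps (raise p S)) (trans (cong g eq) (inv p S))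

module Symmetrise {V : Set} (vs : List V) (E : V → V → Bool) {a : ℕ} (r : ℕ) (q : ℕ → ℕ) where

  open Codegree vs E

  clusters : Vec V a → ℕ
  clusters x = ∏ (subsets a) (λ R → restrict r (cluster q) R x)

  cluster-swap : ∀ p (R : Vec Bool a) x → cluster q (swap p R) (swap p x) ≡ cluster q R x
  cluster-swap p R x = trans (∏-subsetsOf-swap p R _)
    (∏-cong (subsetsOf R) λ S → cong₂ _^_ (codeg-swap p S x) (cong q (size-swap p S)))

  clusters-swap : ∀ p x → clusters (swap p x) ≡ clusters x
  clusters-swap p x = trans (sym (∏-vecs-swap bools p _))
    (∏-cong (subsets a) λ R → cong₂ (λ s t → if s ≡ᵇ r then t else 1) (size-swap p R) (cluster-swap p R x))

  symmetric-codeg : Vec V a → ℕ → ℕ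
  symmetric-codeg x k = ∏ (perms x) (codeg (initial a k))

  -- Swapping coordinates of S can be undone by reordering the orbit, so only the size of S matters.
  ∏-perms-codeg : ∀ S x → ∏ (perms x) (codeg S) ≡ symmetric-codeg x (size S)
  ∏-perms-codeg S x = swap-invariant⇒size (λ S → ∏ (perms x) (codeg S))
    (λ p S → trans (sym (∏-perms-swap p x (codeg (swap p S)))) (∏-cong (perms x) (codeg-swap p S))) S

  -- The product of the right-hand summands over the orbit of x is the a !-th power of n^d₀ * clusters x,
  -- and AM-GM over the orbit bounds the latter by their sum.
  symmetrisation : (Ns : List (Vec Bool a)) (d₀ : ℕ) →
    (∀ φ → ∏ Ns (φ ∘ size) ≡ φ 0 ^ d₀ * ∏ (subsets a) (λ R → if ofSize r R then ∏ (subsetsOf R) (λ S → φ (size S) ^ q (size S)) else 1)) →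
    length vs ^ d₀ * ∑ (vecs vs a) clusters ≤ ∑ (vecs vs a) (λ x → ∏ Ns (λ N → codeg N x))
  symmetrisation Ns d₀ degrees = *-cancelˡ-≤ (a !) {{a !≢0}} (begin
    a ! * (length vs ^ d₀ * ∑ (vecs vs a) clusters)
      ≡⟨ cong (a ! *_) (sym (∑-*ˡ (vecs vs a) (length vs ^ d₀) clusters)) ⟩
    a ! * ∑ (vecs vs a) (λ x → length vs ^ d₀ * clusters x)
      ≡⟨ sym (∑-*ˡ (vecs vs a) (a !) _) ⟩
    ∑ (vecs vs a) (λ x → a ! * (length vs ^ d₀ * clusters x))
      ≤⟨ ∑-mono (vecs vs a) pointwise ⟩
    ∑ (vecs vs a) (λ x → ∑ (perms x) F)
      ≡⟨ ∑-vecs-perms vs a F ⟩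
    a ! * ∑ (vecs vs a) F ∎)
    where
    open ≤-Reasoning
    F : Vec V a → ℕ
    F x = ∏ Ns (λ N → codeg N x)

    codeg-∅ : ∀ {a} (x : Vec V a) → codeg (initial a 0) x ≡ length vs
    codeg-∅ x = trans (∑-cong vs (common-∅ x)) (length-∑ vs)
      where
      common-∅ : ∀ {a} (x : Vec V a) y → common (initial a 0) x y ≡ 1
      common-∅ []      y = refl
      common-∅ (v ∷ x) y = trans (*-identityˡ _) (common-∅ x y)

    symmetric-codeg-0 : ∀ x → symmetric-codeg x 0 ≡ length vs ^ (a !)
    symmetric-codeg-0 x = trans (∏-cong (perms x) codeg-∅) (trans (∏-const (perms x) _) (cong (length vs ^_) (length-perms x)))

    ∏-perms-restrict : ∀ x R → ∏ (perms x) (restrict r (cluster q) R) ≡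
      (if ofSize r R then ∏ (subsetsOf R) (λ S → symmetric-codeg x (size S) ^ q (size S)) else 1)
    ∏-perms-restrict x R with ofSize r R
    ... | false = ∏-1 (perms x)
    ... | true  = trans (∏-swap (perms x) (subsetsOf R) _)
      (∏-cong (subsetsOf R) λ S → trans (∏-^ (perms x) (codeg S) (q (size S))) (cong (_^ q (size S)) (∏-perms-codeg S x)))

    orbit : ∀ x → ∏ (perms x) F ≡ (length vs ^ d₀ * clusters x) ^ (a !)
    orbit x = begin-equality
      ∏ (perms x) F
        ≡⟨ ∏-swap (perms x) Ns _ ⟩
      ∏ Ns (λ N → ∏ (perms x) (codeg N))
        ≡⟨ ∏-cong Ns (λ N → ∏-perms-codeg N x) ⟩
      ∏ Ns (symmetric-codeg x ∘ size)
        ≡⟨ degrees (symmetric-codeg x) ⟩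
      symmetric-codeg x 0 ^ d₀ * ∏ (subsets a) (λ R → if ofSize r R then ∏ (subsetsOf R) (λ S → symmetric-codeg x (size S) ^ q (size S)) else 1)
        ≡⟨ cong₂ _*_ (trans (cong (_^ d₀) (symmetric-codeg-0 x)) (trans (^-*-assoc (length vs) (a !) d₀) (trans (cong (length vs ^_) (*-comm (a !) d₀)) (sym (^-*-assoc (length vs) d₀ (a !))))))
                     (trans (∏-cong (subsets a) λ R → sym (∏-perms-restrict x R)) (sym (∏-swap (perms x) (subsets a) (λ y R → restrict r (cluster q) R y)))) ⟩
      (length vs ^ d₀) ^ (a !) * ∏ (perms x) clusters
        ≡⟨ cong ((length vs ^ d₀) ^ (a !) *_) (∏-perms-invariant clusters clusters-swap x) ⟩
      (length vs ^ d₀) ^ (a !) * clusters x ^ (a !)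
        ≡⟨ sym (^-distribʳ-* (length vs ^ d₀) (clusters x) (a !)) ⟩
      (length vs ^ d₀ * clusters x) ^ (a !) ∎

    pointwise : ∀ x → a ! * (length vs ^ d₀ * clusters x) ≤ ∑ (perms x) F
    pointwise x = ^-cancelˡ-≤ (a !) (>-nonZero⁻¹ (a !) {{a !≢0}}) (begin
      (a ! * (length vs ^ d₀ * clusters x)) ^ (a !)
        ≡⟨ ^-distribʳ-* (a !) _ (a !) ⟩
      (a !) ^ (a !) * (length vs ^ d₀ * clusters x) ^ (a !)
        ≡⟨ cong ((a !) ^ (a !) *_) (sym (orbit x)) ⟩
      (a !) ^ (a !) * ∏ (perms x) F
        ≡⟨ cong (λ k → k ^ k * ∏ (perms x) F) (sym (length-perms x)) ⟩
      length (perms x) ^ length (perms x) * ∏ (perms x) F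
        ≤⟨ amgm (perms x) F ⟩
      ∑ (perms x) F ^ length (perms x)
        ≡⟨ cong (∑ (perms x) F ^_) (length-perms x) ⟩
      ∑ (perms x) F ^ (a !) ∎)

-- Homomorphism and edge counts of bipartite graphs

module FinBigOp (_∙_ : ℕ → ℕ → ℕ) (ε : ℕ) (isCM : IsCommutativeMonoid _≡_ _∙_ ε) where

  open BigOp _∙_ ε isCM
  open IsCommutativeMonoid isCM using (identityˡ)

  ⨁-tabulate : {A : Set} {m : ℕ} (h : Fin m → A) (f : A → ℕ) → ⨁ (tabulate h) f ≡ ⨁ (allFin m) (f ∘ h)
  ⨁-tabulate {m = zero}  h f = refl
  ⨁-tabulate {m = suc m} h f = cong (f (h zero) ∙_) (trans (⨁-tabulate (h ∘ suc) f) (sym (⨁-tabulate suc (f ∘ h))))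

  ⨁-allFin-suc : (m : ℕ) (f : Fin (suc m) → ℕ) → ⨁ (allFin (suc m)) f ≡ f zero ∙ ⨁ (allFin m) (f ∘ suc)
  ⨁-allFin-suc m f = cong (f zero ∙_) (⨁-tabulate suc f)

  ⨁-filterᵇ : {A : Set} (P : A → Bool) (xs : List A) (f : A → ℕ) → ⨁ (filterᵇ P xs) f ≡ ⨁ xs (λ x → if P x then f x else ε)
  ⨁-filterᵇ P []       f = refl
  ⨁-filterᵇ P (x ∷ xs) f with P x
  ... | true  = cong (f x ∙_) (⨁-filterᵇ P xs f)
  ... | false = trans (⨁-filterᵇ P xs f) (sym (identityˡ _))

open FinBigOp _+_ 0 +-0-isCommutativeMonoid using () renaming
  ( ⨁-allFin-suc to ∑-allFin-suc; ⨁-filterᵇ to ∑-filterᵇ)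
open FinBigOp _*_ 1 *-1-isCommutativeMonoid using () renaming
  ( ⨁-allFin-suc to ∏-allFin-suc; ⨁-filterᵇ to ∏-filterᵇ)

length-filterᵇ : {A : Set} (P : A → Bool) (xs : List A) → length (filterᵇ P xs) ≡ ∑ xs (bit ∘ P)
length-filterᵇ P xs = trans (sym (length-∑ (filterᵇ P xs))) (trans (∑-filterᵇ P xs _) (∑-cong xs λ x → if-bit (P x)))
  where
  if-bit : ∀ b → (if b then 1 else 0) ≡ bit b
  if-bit true  = refl
  if-bit false = refl

size-tabulate : ∀ {m} (P : Fin m → Bool) → size (Vec.tabulate P) ≡ ∑ (allFin m) (bit ∘ P)
size-tabulate {zero}  P = refl
size-tabulate {suc m} P = trans (cong (bit (P zero) +_) (size-tabulate (P ∘ suc))) (sym (∑-allFin-suc m (bit ∘ P)))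

size-select : ∀ {m} (A : Vec Bool m) (P : Fin m → Bool) →
  size (select A (Vec.tabulate P)) ≡ ∑ (allFin m) (λ i → if lookup A i then bit (P i) else 0)
size-select []          P = refl
size-select (true ∷ A)  P = trans (cong (bit (P zero) +_) (size-select A (P ∘ suc)))
  (sym (∑-allFin-suc _ (λ i → if lookup (true ∷ A) i then bit (P i) else 0)))
size-select (false ∷ A) P = trans (size-select A (P ∘ suc))
  (sym (∑-allFin-suc _ (λ i → if lookup (false ∷ A) i then bit (P i) else 0)))

-- The maps in `allMaps` agree with lookups in vectors only pointwise, hence the condition that `Ψ`
-- respects pointwise equality.
∑-allMaps : ∀ m n (Ψ : (Fin m → Fin n) → ℕ) → (∀ f g → (∀ i → f i ≡ g i) → Ψ f ≡ Ψ g) →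
  ∑ (allMaps m n) Ψ ≡ ∑ (vecs (allFin n) m) (Ψ ∘ lookup)
∑-allMaps zero    n Ψ ext = cong (_+ 0) (ext _ _ λ ())
∑-allMaps (suc m) n Ψ ext = begin
  ∑ (allMaps (suc m) n) Ψ
    ≡⟨ ∑-concatMap _ (allMaps m n) Ψ ⟩
  ∑ (allMaps m n) (λ f → ∑ (map _ (allFin n)) Ψ)
    ≡⟨ ∑-allMaps m n _ (λ f g eq → trans (∑-map _ (allFin n) Ψ) (trans (∑-cong (allFin n) λ v → ext _ _ λ { zero → refl ; (suc i) → eq i }) (sym (∑-map _ (allFin n) Ψ)))) ⟩
  ∑ (vecs (allFin n) m) (λ w → ∑ (map _ (allFin n)) Ψ)
    ≡⟨ ∑-cong (vecs (allFin n) m) (λ w → trans (∑-map _ (allFin n) Ψ) (∑-cong (allFin n) λ v → ext _ (lookup (v ∷ w)) λ { zero → refl ; (suc i) → refl })) ⟩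
  ∑ (vecs (allFin n) m) (λ w → ∑ (allFin n) (λ v → Ψ (lookup (v ∷ w))))
    ≡⟨ ∑-swap (vecs (allFin n) m) (allFin n) (λ w v → Ψ (lookup (v ∷ w))) ⟩
  ∑ (allFin n) (λ v → ∑ (vecs (allFin n) m) (λ w → Ψ (lookup (v ∷ w))))
    ≡⟨ sym (∑-vecs-suc (allFin n) m _) ⟩
  ∑ (vecs (allFin n) (suc m)) (Ψ ∘ lookup) ∎
  where open ≡-Reasoning

bit-∧ : ∀ b c → bit (b ∧ c) ≡ bit b * bit c
bit-∧ true  c = sym (*-identityˡ _)
bit-∧ false c = refl

bit-and : {A : Set} (P : A → Bool) (xs : List A) → bit (and (map P xs)) ≡ ∏ xs (bit ∘ P)
bit-and P []       = refl
bit-and P (x ∷ xs) = trans (bit-∧ (P x) _) (cong (bit (P x) *_) (bit-and P xs))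

∏∉ : ∀ {m} → Vec Bool m → (Fin m → ℕ) → ℕ
∏∉ {m} A φ = ∏ (allFin m) (λ i → if lookup A i then 1 else φ i)

∏∉-true : ∀ {m} (A : Vec Bool m) (φ : Fin (suc m) → ℕ) → ∏∉ (true ∷ A) φ ≡ ∏∉ A (φ ∘ suc)
∏∉-true A φ = trans (∏-allFin-suc _ (λ i → if lookup (true ∷ A) i then 1 else φ i)) (*-identityˡ _)

∏∉-false : ∀ {m} (A : Vec Bool m) (φ : Fin (suc m) → ℕ) → ∏∉ (false ∷ A) φ ≡ φ zero * ∏∉ A (φ ∘ suc)
∏∉-false A φ = ∏-allFin-suc _ (λ i → if lookup (false ∷ A) i then 1 else φ i)

-- Vertices outside A are mapped independently of each other once the image of A is fixed.
∑-vecs-select : {V : Set} (vs : List V) {m : ℕ} (A : Vec Bool m)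
  (h : Vec V (size A) → ℕ) (g : Fin m → Vec V (size A) → V → ℕ) →
  ∑ (vecs vs m) (λ f → h (select A f) * ∏∉ A (λ i → g i (select A f) (lookup f i))) ≡
  ∑ (vecs vs (size A)) (λ x → h x * ∏∉ A (λ i → ∑ vs (g i x)))
∑-vecs-select vs [] h g = refl
∑-vecs-select {V} vs {suc m} (true ∷ A) h g = begin
  ∑ (vecs vs (suc m)) (λ f → h (select (true ∷ A) f) * ∏∉ (true ∷ A) (λ i → g i (select (true ∷ A) f) (lookup f i)))
    ≡⟨ ∑-vecs-suc vs m _ ⟩
  ∑ vs (λ v → ∑ (vecs vs m) (λ f → h (v ∷ select A f) * ∏∉ (true ∷ A) (λ i → g i (v ∷ select A f) (lookup (v ∷ f) i))))
    ≡⟨ ∑-cong vs (λ v → ∑-cong (vecs vs m) λ f → cong (h (v ∷ select A f) *_) (∏∉-true A (λ i → g i (v ∷ select A f) (lookup (v ∷ f) i)))) ⟩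
  ∑ vs (λ v → ∑ (vecs vs m) (λ f → h (v ∷ select A f) * ∏∉ A (λ i → g (suc i) (v ∷ select A f) (lookup f i))))
    ≡⟨ ∑-cong vs (λ v → ∑-vecs-select vs A (λ x → h (v ∷ x)) (λ i x → g (suc i) (v ∷ x))) ⟩
  ∑ vs (λ v → ∑ (vecs vs (size A)) (λ x → h (v ∷ x) * ∏∉ A (λ i → ∑ vs (g (suc i) (v ∷ x)))))
    ≡⟨ ∑-cong vs (λ v → ∑-cong (vecs vs (size A)) λ x → cong (h (v ∷ x) *_) (sym (∏∉-true A (λ i → ∑ vs (g i (v ∷ x)))))) ⟩
  ∑ vs (λ v → ∑ (vecs vs (size A)) (λ x → h (v ∷ x) * ∏∉ (true ∷ A) (λ i → ∑ vs (g i (v ∷ x)))))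
    ≡⟨ sym (∑-vecs-suc vs (size A) _) ⟩
  ∑ (vecs vs (suc (size A))) (λ x → h x * ∏∉ (true ∷ A) (λ i → ∑ vs (g i x))) ∎
  where open ≡-Reasoning
∑-vecs-select {V} vs {suc m} (false ∷ A) h g = begin
  ∑ (vecs vs (suc m)) (λ f → h (select (false ∷ A) f) * ∏∉ (false ∷ A) (λ i → g i (select (false ∷ A) f) (lookup f i)))
    ≡⟨ ∑-vecs-suc vs m _ ⟩
  ∑ vs (λ v → ∑ (vecs vs m) (λ f → h (select A f) * ∏∉ (false ∷ A) (λ i → g i (select A f) (lookup (v ∷ f) i))))
    ≡⟨ ∑-cong vs (λ v → ∑-cong (vecs vs m) λ f → trans (cong (h (select A f) *_) (∏∉-false A (λ i → g i (select A f) (lookup (v ∷ f) i)))) (sym (*-assoc (h (select A f)) _ _))) ⟩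
  ∑ vs (λ v → ∑ (vecs vs m) (λ f → h (select A f) * g zero (select A f) v * ∏∉ A (λ i → g (suc i) (select A f) (lookup f i))))
    ≡⟨ ∑-cong vs (λ v → ∑-vecs-select vs A (λ x → h x * g zero x v) (λ i → g (suc i))) ⟩
  ∑ vs (λ v → ∑ (vecs vs (size A)) (λ x → h x * g zero x v * ∏∉ A (λ i → ∑ vs (g (suc i) x))))
    ≡⟨ ∑-swap vs (vecs vs (size A)) _ ⟩
  ∑ (vecs vs (size A)) (λ x → ∑ vs (λ v → h x * g zero x v * ∏∉ A (λ i → ∑ vs (g (suc i) x))))
    ≡⟨ ∑-cong (vecs vs (size A)) (λ x → trans (∑-*ʳ vs _ _) (cong (_* ∏∉ A (λ i → ∑ vs (g (suc i) x))) (∑-*ˡ vs (h x) _))) ⟩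
  ∑ (vecs vs (size A)) (λ x → h x * ∑ vs (g zero x) * ∏∉ A (λ i → ∑ vs (g (suc i) x)))
    ≡⟨ ∑-cong (vecs vs (size A)) (λ x → trans (*-assoc (h x) _ _) (cong (h x *_) (sym (∏∉-false A (λ i → ∑ vs (g i x)))))) ⟩
  ∑ (vecs vs (size A)) (λ x → h x * ∏∉ (false ∷ A) (λ i → ∑ vs (g i x))) ∎
  where open ≡-Reasoning

∏-01 : {A : Set} (xs : List A) (f : A → ℕ) → (∀ x → f x ≡ 0 ⊎ f x ≡ 1) → ∏ xs f ≡ 0 ⊎ ∏ xs f ≡ 1
∏-01 []       f f-01 = inj₂ refl
∏-01 (x ∷ xs) f f-01 with f-01 x
... | inj₁ eq = inj₁ (cong (_* ∏ xs f) eq)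
... | inj₂ eq rewrite eq | *-identityˡ (∏ xs f) = ∏-01 xs f f-01

bit-01 : ∀ b → bit b ≡ 0 ⊎ bit b ≡ 1
bit-01 false = inj₁ refl
bit-01 true  = inj₂ refl

01-idem : ∀ {k} → k ≡ 0 ⊎ k ≡ 1 → k * k ≡ k
01-idem (inj₁ refl) = refl
01-idem (inj₂ refl) = refl

module Bipartite {m : ℕ} (H : SimpleGraph m) (inA : Fin m → Bool) (bip : IsBipartition H inA) where

  A : Vec Bool m
  A = Vec.tabulate inA

  neighbours : Fin m → Vec Bool (size A)
  neighbours b = select A (Vec.tabulate (adj H b))

  neighbourhoods : List (Vec Bool (size A))
  neighbourhoods = map neighbours (sideB inA)

  sizeA≡ : sizeA inA ≡ size A
  sizeA≡ = trans (length-filterᵇ inA (allFin m)) (sym (size-tabulate inA))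

  ∏-sideB : (φ : Fin m → ℕ) → ∏ (sideB inA) φ ≡ ∏ (allFin m) (λ i → if lookup A i then 1 else φ i)
  ∏-sideB φ = trans (∏-filterᵇ _ (allFin m) φ) (∏-cong (allFin m) λ i →
    trans (if-not (inA i)) (cong (λ b → if b then 1 else φ i) (sym (lookup∘tabulate inA i))))
    where
    if-not : ∀ b {k l : ℕ} → (if not b then k else l) ≡ (if b then l else k)
    if-not true  = refl
    if-not false = refl

  degree≡ : ∀ b → inA b ≡ false → degree H b ≡ size (neighbours b)
  degree≡ b b∉A = trans (length-filterᵇ (adj H b) (allFin m)) (sym (trans (size-select A (adj H b))
    (∑-cong (allFin m) λ i → trans (cong (λ c → if c then bit (adj H b i) else 0) (lookup∘tabulate inA i)) (only-A i))))
    where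
    only-A : ∀ i → (if inA i then bit (adj H b i) else 0) ≡ bit (adj H b i)
    only-A i with inA i | adj H b i | bip b i
    ... | true  | _     | _ = refl
    ... | false | false | _ = refl
    ... | false | true  | e = contradiction (trans (sym (e tt)) b∉A) λ ()

  module _ {n : ℕ} (G : SimpleGraph n) where

    private
      vs : List (Fin n)
      vs = allFin n

    open Codegree vs (adj G)

    common-select-lookup : ∀ {k} (A : Vec Bool k) (P : Fin k → Bool) (f : Vec (Fin n) k) y →
      common (select A (Vec.tabulate P)) (select A f) y ≡ ∏ (allFin k) (λ j → if lookup A j then hit (P j) (lookup f j) y else 1)
    common-select-lookup [] P [] y = refl
    common-select-lookup (true ∷ A)  P (v ∷ f) y =
      trans (cong (hit (P zero) v y *_) (common-select-lookup A (P ∘ suc) f y)) (sym (∏-allFin-suc _ (λ j → if lookup (true ∷ A) j then hit (P j) (lookup (v ∷ f) j) y else 1)))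
    common-select-lookup (false ∷ A) P (v ∷ f) y =
      trans (common-select-lookup A (P ∘ suc) f y) (sym (trans (∏-allFin-suc _ (λ j → if lookup (false ∷ A) j then hit (P j) (lookup (v ∷ f) j) y else 1)) (*-identityˡ _)))

    edgeOK : (Fin m → Fin n) → Fin m → Fin m → Bool
    edgeOK f i j = not (adj H i j) ∨ adj G (f i) (f j)

    -- The constraint of an ordered pair charged to its end in B: it is trivial unless `i` lies in B
    -- and `j` in A.
    crossOK : (Fin m → Fin n) → Fin m → Fin m → ℕ
    crossOK f i j = if inA i then 1 else (if inA j then bit (edgeOK f i j) else 1)

    edgeOK-split : ∀ f i j → bit (edgeOK f i j) ≡ crossOK f i j * crossOK f j i
    edgeOK-split f i j rewrite SimpleGraph.sym H j i | SimpleGraph.sym G (f j) (f i)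
      with inA i | inA j | adj H i j | bip i j
    ... | true  | true  | false | _ = refl
    ... | true  | false | false | _ = refl
    ... | false | true  | false | _ = refl
    ... | false | false | false | _ = refl
    ... | true  | false | true  | _ = sym (+-identityʳ _)
    ... | false | true  | true  | _ = sym (*-identityʳ _)
    ... | true  | true  | true  | e with () ← e tt
    ... | false | false | true  | e with () ← e tt

    crossOK-01 : ∀ f i j → crossOK f i j ≡ 0 ⊎ crossOK f i j ≡ 1
    crossOK-01 f i j with inA i | inA j
    ... | true  | _     = inj₂ refl
    ... | false | true  = bit-01 _
    ... | false | false = inj₂ refl

    -- `isHom` tests every edge in both orders, which gives the product `M` of the charged
    -- constraints twice; as `M` is 0 or 1, its square is `M`.
    bit-isHom : ∀ f → bit (isHom H G f) ≡ ∏ (allFin m) (λ i → ∏ (allFin m) (crossOK f i))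
    bit-isHom f = begin
      bit (isHom H G f)
        ≡⟨ bit-and _ (allFin m) ⟩
      ∏ (allFin m) (λ i → bit (and (map (edgeOK f i) (allFin m))))
        ≡⟨ ∏-cong (allFin m) (λ i → trans (bit-and (edgeOK f i) (allFin m)) (trans (∏-cong (allFin m) (edgeOK-split f i)) (∏-* (allFin m) _ _))) ⟩
      ∏ (allFin m) (λ i → ∏ (allFin m) (crossOK f i) * ∏ (allFin m) (λ j → crossOK f j i))
        ≡⟨ ∏-* (allFin m) _ _ ⟩
      M * ∏ (allFin m) (λ i → ∏ (allFin m) (λ j → crossOK f j i))
        ≡⟨ cong (M *_) (∏-swap (allFin m) (allFin m) (λ i j → crossOK f j i)) ⟩
      M * M
        ≡⟨ 01-idem (∏-01 (allFin m) _ λ i → ∏-01 (allFin m) _ (crossOK-01 f i)) ⟩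
      M ∎
      where
      open ≡-Reasoning
      M = ∏ (allFin m) (λ i → ∏ (allFin m) (crossOK f i))

    row : ∀ (f : Vec (Fin n) m) i → ∏ (allFin m) (crossOK (lookup f) i) ≡
      (if lookup A i then 1 else common (neighbours i) (select A f) (lookup f i))
    row f i = trans outer (cong (λ b → if b then 1 else common (neighbours i) (select A f) (lookup f i)) (sym (lookup∘tabulate inA i)))
      where
      entry : ∀ j → (if inA j then bit (edgeOK (lookup f) i j) else 1) ≡ (if lookup A j then hit (adj H i j) (lookup f j) (lookup f i) else 1)
      entry j rewrite lookup∘tabulate inA j | SimpleGraph.sym G (lookup f i) (lookup f j) with inA j | adj H i j
      ... | true  | true  = refl
      ... | true  | false = refl
      ... | false | _     = refl
      outer : ∏ (allFin m) (crossOK (lookup f) i) ≡ (if inA i then 1 else common (neighbours i) (select A f) (lookup f i))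
      outer with inA i
      ... | true  = ∏-1 (allFin m)
      ... | false = trans (∏-cong (allFin m) entry) (sym (common-select-lookup A (adj H i) f (lookup f i)))

    homCount-codeg : homCount H G ≡ ∑ (vecs vs (size A)) (λ x → ∏ neighbourhoods (λ N → codeg N x))
    homCount-codeg = begin
      homCount H G
        ≡⟨ length-filterᵇ (isHom H G) (allMaps m n) ⟩
      ∑ (allMaps m n) (λ f → bit (isHom H G f))
        ≡⟨ ∑-cong (allMaps m n) bit-isHom ⟩
      ∑ (allMaps m n) (λ f → ∏ (allFin m) (λ i → ∏ (allFin m) (crossOK f i)))
        ≡⟨ ∑-allMaps m n _ (λ f g eq → ∏-cong (allFin m) λ i → ∏-cong (allFin m) λ j →
             cong₂ (λ u v → if inA i then 1 else (if inA j then bit (not (adj H i j) ∨ adj G u v) else 1)) (eq i) (eq j)) ⟩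
      ∑ (vecs vs m) (λ f → ∏ (allFin m) (λ i → ∏ (allFin m) (crossOK (lookup f) i)))
        ≡⟨ ∑-cong (vecs vs m) (λ f → trans (∏-cong (allFin m) (row f)) (sym (*-identityˡ _))) ⟩
      ∑ (vecs vs m) (λ f → 1 * ∏ (allFin m) (λ i → if lookup A i then 1 else common (neighbours i) (select A f) (lookup f i)))
        ≡⟨ ∑-vecs-select vs A (λ _ → 1) (λ i x y → common (neighbours i) x y) ⟩
      ∑ (vecs vs (size A)) (λ x → 1 * ∏ (allFin m) (λ i → if lookup A i then 1 else codeg (neighbours i) x))
        ≡⟨ ∑-cong (vecs vs (size A)) (λ x → trans (*-identityˡ _) (trans (sym (∏-sideB (λ i → codeg (neighbours i) x))) (sym (∏-map neighbours (sideB inA) _)))) ⟩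
      ∑ (vecs vs (size A)) (λ x → ∏ neighbourhoods (λ N → codeg N x)) ∎
      where open ≡-Reasoning

  ∑∑-split : (f g : Fin m → Fin m → ℕ) → (∀ i j → f i j ≡ g i j + g j i) →
    ∑ (allFin m) (λ i → ∑ (allFin m) (f i)) ≡ 2 * ∑ (allFin m) (λ i → ∑ (allFin m) (g i))
  ∑∑-split f g eq = begin
    ∑ (allFin m) (λ i → ∑ (allFin m) (f i))
      ≡⟨ ∑-cong (allFin m) (λ i → trans (∑-cong (allFin m) (eq i)) (∑-+ (allFin m) _ _)) ⟩
    ∑ (allFin m) (λ i → ∑ (allFin m) (g i) + ∑ (allFin m) (λ j → g j i))
      ≡⟨ ∑-+ (allFin m) _ _ ⟩
    M + ∑ (allFin m) (λ i → ∑ (allFin m) (λ j → g j i))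
      ≡⟨ cong (M +_) (∑-swap (allFin m) (allFin m) (λ i j → g j i)) ⟩
    M + M
      ≡⟨ cong (M +_) (sym (+-identityʳ M)) ⟩
    2 * M ∎
    where
    open ≡-Reasoning
    M = ∑ (allFin m) (λ i → ∑ (allFin m) (g i))

  -- Both sides pick one order for each edge, either the smaller index first or the end in B first.
  -- Twice either count is the number of ordered adjacent pairs.
  edgeCount≡ : edgeCount H ≡ ∑ neighbourhoods size
  edgeCount≡ = begin
    edgeCount H
      ≡⟨ sym (length-∑ (concatMap (λ i → filterᵇ (λ j → (toℕ i <ᵇ toℕ j) ∧ adj H i j) (allFin m)) (allFin m))) ⟩
    ∑ (concatMap (λ i → filterᵇ (λ j → (toℕ i <ᵇ toℕ j) ∧ adj H i j) (allFin m)) (allFin m)) (λ _ → 1)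
      ≡⟨ ∑-concatMap _ (allFin m) _ ⟩
    ∑ (allFin m) (λ i → ∑ (filterᵇ (λ j → (toℕ i <ᵇ toℕ j) ∧ adj H i j) (allFin m)) (λ _ → 1))
      ≡⟨ ∑-cong (allFin m) (λ i → trans (length-∑ (filterᵇ (λ j → (toℕ i <ᵇ toℕ j) ∧ adj H i j) (allFin m))) (length-filterᵇ _ (allFin m))) ⟩
    ∑ (allFin m) (λ i → ∑ (allFin m) (λ j → bit ((toℕ i <ᵇ toℕ j) ∧ adj H i j)))
      ≡⟨ *-cancelˡ-≡ _ _ 2 (trans (sym (∑∑-split (λ i j → bit (adj H i j)) _ by-order)) (∑∑-split _ _ by-side)) ⟩
    ∑ (allFin m) (λ i → ∑ (allFin m) (λ j → if inA i then 0 else bit (adj H i j)))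
      ≡⟨ ∑-cong (allFin m) from-B ⟩
    ∑ (allFin m) (λ i → if not (inA i) then size (neighbours i) else 0)
      ≡⟨ sym (∑-filterᵇ _ (allFin m) _) ⟩
    ∑ (sideB inA) (λ i → size (neighbours i))
      ≡⟨ sym (∑-map neighbours (sideB inA) size) ⟩
    ∑ neighbourhoods size ∎
    where
    open ≡-Reasoning
    <ᵇ-true : ∀ {a b} → a < b → (a <ᵇ b) ≡ true
    <ᵇ-true {a} {b} lt with a <ᵇ b | <⇒<ᵇ lt
    ... | true | _ = refl
    <ᵇ-false : ∀ {a b} → ¬ a < b → (a <ᵇ b) ≡ false
    <ᵇ-false {a} {b} nlt with a <ᵇ b | <ᵇ⇒< a b
    ... | true  | lt = contradiction (lt tt) nlt
    ... | false | _  = refl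
    by-order : ∀ i j → bit (adj H i j) ≡ bit ((toℕ i <ᵇ toℕ j) ∧ adj H i j) + bit ((toℕ j <ᵇ toℕ i) ∧ adj H j i)
    by-order i j with <-cmp (toℕ i) (toℕ j)
    ... | tri< lt _ ≯ rewrite <ᵇ-true lt | <ᵇ-false ≯ = sym (+-identityʳ _)
    ... | tri> ≮ _ gt rewrite <ᵇ-true gt | <ᵇ-false ≮ = cong bit (SimpleGraph.sym H i j)
    ... | tri≈ ≮ eq ≯ rewrite <ᵇ-false ≮ | <ᵇ-false ≯ | toℕ-injective eq = cong bit (irrefl H j)
    by-side : ∀ i j → bit (adj H i j) ≡ (if inA i then 0 else bit (adj H i j)) + (if inA j then 0 else bit (adj H j i))
    by-side i j rewrite SimpleGraph.sym H j i with inA i | inA j | adj H i j | bip i j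
    ... | true  | true  | false | _ = refl
    ... | true  | false | false | _ = refl
    ... | false | true  | false | _ = refl
    ... | false | false | false | _ = refl
    ... | true  | false | true  | _ = refl
    ... | false | true  | true  | _ = refl
    ... | true  | true  | true  | e with () ← e tt
    ... | false | false | true  | e with () ← e tt
    from-B : ∀ i → ∑ (allFin m) (λ j → if inA i then 0 else bit (adj H i j)) ≡ (if not (inA i) then size (neighbours i) else 0)
    from-B i with inA i | degree≡ i
    ... | true  | _ = ∑-0 (allFin m)
    ... | false | d = trans (sym (length-filterᵇ (adj H i) (allFin m))) (d refl)

-- Counting subsets by size, and tuples by their relevant coordinates

size-full : ∀ a → size (full a) ≡ a
size-full zero    = refl
size-full (suc a) = cong suc (size-full a)

subsets≡subsetsOf-full : ∀ a → subsets a ≡ subsetsOf (full a)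
subsets≡subsetsOf-full zero    = refl
subsets≡subsetsOf-full (suc a) = cong (λ Ss → concatMap (λ c → map (c ∷_) Ss) bools) (subsets≡subsetsOf-full a)


∑-subsetsOf-size : ∀ {a} (R : Vec Bool a) k → ∑ (subsetsOf R) (λ S → bit (size S ≡ᵇ k)) ≡ size R C k
∑-subsetsOf-size []          zero    = refl
∑-subsetsOf-size []          (suc k) = refl
∑-subsetsOf-size (false ∷ R) k       = trans (∑-subsetsOf-∷ false R _) (trans (+-identityʳ _) (∑-subsetsOf-size R k))
∑-subsetsOf-size (true ∷ R)  zero    = trans (∑-subsetsOf-∷ true R _) (cong₂ _+_ (∑-subsetsOf-size R 0) (trans (+-identityʳ _) (∑-0 (subsetsOf R))))
∑-subsetsOf-size (true ∷ R)  (suc k) = trans (∑-subsetsOf-∷ true R _)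
  (trans (cong₂ _+_ (∑-subsetsOf-size R (suc k)) (trans (+-identityʳ _) (∑-subsetsOf-size R k)))
    (trans (+-comm (size R C suc k) _) (nCk+nC[k+1]≡[n+1]C[k+1] (size R) k)))

∑-subsets-size : ∀ a k → ∑ (subsets a) (λ S → bit (size S ≡ᵇ k)) ≡ a C k
∑-subsets-size a k = trans (cong (λ Ss → ∑ Ss (λ S → bit (size S ≡ᵇ k))) (subsets≡subsetsOf-full a))
  (trans (∑-subsetsOf-size (full a) k) (cong (_C k) (size-full a)))

∏-subsetsOf-size : ∀ {a} (R : Vec Bool a) (φ : ℕ → ℕ) → ∏ (subsetsOf R) (φ ∘ size) ≡ ∏ (subsets (size R)) (φ ∘ size)
∏-subsetsOf-size []          φ = refl
∏-subsetsOf-size (false ∷ R) φ = trans (∏-subsetsOf-∷ false R _) (trans (*-identityʳ _) (∏-subsetsOf-size R φ))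
∏-subsetsOf-size (true ∷ R)  φ = trans (∏-subsetsOf-∷ true R _)
  (trans (cong₂ (λ s t → s * (t * 1)) (∏-subsetsOf-size R φ) (∏-subsetsOf-size R (φ ∘ suc))) (sym (∏-vecs-suc bools (size R) _)))

∏-range : ∀ r x (φ : ℕ → ℕ) → x ≤ r → ∏ (allFin (suc r)) (λ i → φ (toℕ i) ^ bit (x ≡ᵇ toℕ i)) ≡ φ x
∏-range r zero φ _ = trans (∏-allFin-suc r (λ i → φ (toℕ i) ^ bit (0 ≡ᵇ toℕ i)))
  (trans (cong₂ _*_ (*-identityʳ (φ 0)) (∏-1 (allFin r))) (*-identityʳ (φ 0)))
∏-range (suc r) (suc x) φ (s≤s x≤r) = trans (∏-allFin-suc (suc r) (λ i → φ (toℕ i) ^ bit (suc x ≡ᵇ toℕ i)))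
  (trans (*-identityˡ _) (∏-range r x (φ ∘ suc) x≤r))

∏-by-value : {X : Set} (xs : List X) (val : X → ℕ) (r : ℕ) (φ : ℕ → ℕ) → (∀ {x} → x ∈ xs → val x ≤ r) →
  ∏ xs (φ ∘ val) ≡ ∏ (allFin (suc r)) (λ i → φ (toℕ i) ^ ∑ xs (λ x → bit (val x ≡ᵇ toℕ i)))
∏-by-value xs val r φ le = begin
  ∏ xs (φ ∘ val)
    ≡⟨ ∏-cong-∈ xs (λ {x} x∈ → sym (∏-range r (val x) φ (le x∈))) ⟩
  ∏ xs (λ x → ∏ (allFin (suc r)) (λ i → φ (toℕ i) ^ bit (val x ≡ᵇ toℕ i)))
    ≡⟨ ∏-swap xs (allFin (suc r)) (λ x i → φ (toℕ i) ^ bit (val x ≡ᵇ toℕ i)) ⟩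
  ∏ (allFin (suc r)) (λ i → ∏ xs (λ x → φ (toℕ i) ^ bit (val x ≡ᵇ toℕ i)))
    ≡⟨ ∏-cong (allFin (suc r)) (λ i → ^-∑ (φ (toℕ i)) xs (λ x → bit (val x ≡ᵇ toℕ i))) ⟩
  ∏ (allFin (suc r)) (λ i → φ (toℕ i) ^ ∑ xs (λ x → bit (val x ≡ᵇ toℕ i))) ∎
  where open ≡-Reasoning

∏-subsets-binomial : ∀ r (ψ : ℕ → ℕ) → ∏ (subsets r) (ψ ∘ size) ≡ ∏ (allFin (suc r)) (λ i → ψ (toℕ i) ^ (r C toℕ i))
∏-subsets-binomial r ψ = trans (∏-by-value (subsets r) size r ψ (λ {S} _ → size≤ S))
  (∏-cong (allFin (suc r)) λ i → cong (ψ (toℕ i) ^_) (∑-subsets-size r (toℕ i)))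

2^-injective : ∀ {a b} → 2 ^ a ≡ 2 ^ b → a ≡ b
2^-injective {a} {b} eq with <-cmp a b
... | tri< lt _ _ = contradiction eq (<⇒≢ (^-monoʳ-< 2 (s≤s (s≤s z≤n)) lt))
... | tri≈ _ e _ = e
... | tri> _ _ gt = contradiction (sym eq) (<⇒≢ (^-monoʳ-< 2 (s≤s (s≤s z≤n)) gt))

is-full : ∀ {a} (S : Vec Bool a) → is (full a) S ≡ ofSize a S
is-full []          = refl
is-full (true ∷ S)  = is-full S
is-full {suc a} (false ∷ S) with size S ≡ᵇ suc a | ≡ᵇ⇒≡ (size S) (suc a)
... | false | _ = refl
... | true  | e = contradiction (size≤ S) (<⇒≱ (≤-reflexive (sym (e tt))))

∏-full : ∀ r (h : Vec Bool r → ℕ) → ∏ (subsets r) (λ S → h S ^ bit (ofSize r S)) ≡ h (full r)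
∏-full r h = trans (∏-cong (subsets r) λ S → trans (sym (if-^-bit (h S) (ofSize r S))) (cong (λ b → if b then h S else 1) (sym (is-full S)))) (∏-is (full r) h)

1≤∑⇒∃ : {X : Set} (xs : List X) (f : X → ℕ) → 1 ≤ ∑ xs f → ∃ λ x → 1 ≤ f x
1≤∑⇒∃ (x ∷ xs) f le with f x in eq
... | suc _ = x , ≤-trans (s≤s z≤n) (≤-reflexive (sym eq))
... | zero  = 1≤∑⇒∃ xs f le

≤∑-vecs-replicate : {V : Set} {vs : List V} {v : V} → v ∈ vs → ∀ a (f : Vec V a → ℕ) → f (Vec.replicate a v) ≤ ∑ (vecs vs a) f
≤∑-vecs-replicate v∈ zero    f = ≤-reflexive (sym (+-identityʳ _))
≤∑-vecs-replicate {vs = vs} {v} v∈ (suc a) f = ≤-trans (≤∑-vecs-replicate v∈ a (λ x → f (v ∷ x)))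
  (≤-trans (∈⇒≤∑ (λ u → ∑ (vecs vs a) (λ x → f (u ∷ x))) v∈) (≤-reflexive (sym (∑-vecs-suc vs a f))))

cosize-initial : ∀ {a r} → r ≤ a → cosize (initial a r) + r ≡ a
cosize-initial {a} {r} r≤a = trans (cong (cosize (initial a r) +_) (sym (size-initial r≤a))) (cosize+size (initial a r))

∑-vecs-select-only : {V : Set} (vs : List V) {a : ℕ} (R : Vec Bool a) (h : Vec V (size R) → ℕ) →
  ∑ (vecs vs a) (h ∘ select R) ≡ length vs ^ cosize R * ∑ (vecs vs (size R)) h
∑-vecs-select-only vs [] h = sym (+-identityʳ _)
∑-vecs-select-only vs {suc a} (true ∷ R) h = begin
  ∑ (vecs vs (suc a)) (h ∘ select (true ∷ R))
    ≡⟨ ∑-vecs-suc vs a _ ⟩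
  ∑ vs (λ v → ∑ (vecs vs a) (λ x → h (v ∷ select R x)))
    ≡⟨ ∑-cong vs (λ v → ∑-vecs-select-only vs R (λ z → h (v ∷ z))) ⟩
  ∑ vs (λ v → length vs ^ cosize R * ∑ (vecs vs (size R)) (λ z → h (v ∷ z)))
    ≡⟨ ∑-*ˡ vs (length vs ^ cosize R) _ ⟩
  length vs ^ cosize R * ∑ vs (λ v → ∑ (vecs vs (size R)) (λ z → h (v ∷ z)))
    ≡⟨ cong (length vs ^ cosize R *_) (sym (∑-vecs-suc vs (size R) h)) ⟩
  length vs ^ cosize R * ∑ (vecs vs (suc (size R))) h ∎
  where open ≡-Reasoning
∑-vecs-select-only vs {suc a} (false ∷ R) h = begin
  ∑ (vecs vs (suc a)) (h ∘ select (false ∷ R))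
    ≡⟨ ∑-vecs-suc vs a _ ⟩
  ∑ vs (λ v → ∑ (vecs vs a) (h ∘ select R))
    ≡⟨ ∑-const vs _ ⟩
  length vs * ∑ (vecs vs a) (h ∘ select R)
    ≡⟨ cong (length vs *_) (∑-vecs-select-only vs R h) ⟩
  length vs * (length vs ^ cosize R * ∑ (vecs vs (size R)) h)
    ≡⟨ sym (*-assoc (length vs) _ _) ⟩
  length vs * length vs ^ cosize R * ∑ (vecs vs (size R)) h ∎
  where open ≡-Reasoning

-- From clusters to the inequality for homomorphism counts

module Counting {V : Set} (vs : List V) (every : ∀ v → v ∈ vs) (E : V → V → Bool) where

  open Codegree vs E
  open LocalBound vs every E

  cluster-select : ∀ q {a} (R : Vec Bool a) x → cluster q R x ≡ cluster q (full (size R)) (select R x)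
  cluster-select q R x = go R x (λ c k → ∑ vs c ^ q k) (λ eq k → cong (_^ q k) (∑-cong vs eq))
    where
    -- Passing a coordinate multiplies `common` by a `hit` and may raise the size, so the induction
    -- needs an arbitrary `g` of both; `ext` lets `g` respect pointwise equality of its first
    -- argument.
    go : ∀ {a} (R : Vec Bool a) x (g : (V → ℕ) → ℕ → ℕ) → (∀ {c d} → (∀ y → c y ≡ d y) → ∀ k → g c k ≡ g d k) →
      ∏ (subsetsOf R) (λ S → g (common S x) (size S)) ≡ ∏ (subsetsOf (full (size R))) (λ S → g (common S (select R x)) (size S))
    go [] [] g ext = refl
    go (false ∷ R) (v ∷ x) g ext = begin
      ∏ (subsetsOf (false ∷ R)) (λ S → g (common S (v ∷ x)) (size S))
        ≡⟨ trans (∏-subsetsOf-∷ false R _) (*-identityʳ _) ⟩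
      ∏ (subsetsOf R) (λ S → g (λ y → 1 * common S x y) (size S))
        ≡⟨ ∏-cong (subsetsOf R) (λ S → ext (λ y → *-identityˡ (common S x y)) (size S)) ⟩
      ∏ (subsetsOf R) (λ S → g (common S x) (size S))
        ≡⟨ go R x g ext ⟩
      ∏ (subsetsOf (full (size R))) (λ S → g (common S (select R x)) (size S)) ∎
      where open ≡-Reasoning
    go (true ∷ R) (v ∷ x) g ext = begin
      ∏ (subsetsOf (true ∷ R)) (λ S → g (common S (v ∷ x)) (size S))
        ≡⟨ ∏-subsetsOf-∷ true R _ ⟩
      ∏ (below true) (λ b → ∏ (subsetsOf R) (λ S → g (λ y → hit b v y * common S x y) (bit b + size S)))
        ≡⟨ ∏-cong (below true) (λ b → go R x (λ c k → g (λ y → hit b v y * c y) (bit b + k)) (λ eq k → ext (λ y → cong (hit b v y *_) (eq y)) (bit b + k))) ⟩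
      ∏ (below true) (λ b → ∏ (subsetsOf (full (size R))) (λ S → g (λ y → hit b v y * common S (select R x) y) (bit b + size S)))
        ≡⟨ sym (∏-subsetsOf-∷ true (full (size R)) _) ⟩
      ∏ (subsetsOf (full (suc (size R)))) (λ S → g (common S (v ∷ select R x)) (size S)) ∎
      where open ≡-Reasoning

  ∑-cluster : ∀ q {a} (R : Vec Bool a) → ∑ (vecs vs a) (cluster q R) ≡ n ^ cosize R * ∑ (vecs vs (size R)) (cluster q (full (size R)))
  ∑-cluster q R = trans (∑-cong (vecs vs _) (cluster-select q R)) (∑-vecs-select-only vs R _)

  common-replicate : ∀ {a} (S : Vec Bool a) v y → E v y ≡ true → common S (Vec.replicate a v) y ≡ 1
  common-replicate []          v y eq = refl
  common-replicate (false ∷ S) v y eq = trans (*-identityˡ _) (common-replicate S v y eq)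
  common-replicate (true ∷ S)  v y eq rewrite eq = trans (*-identityˡ _) (common-replicate S v y eq)

  -- Take an edge between `v` and `y` and the constant tuple `v`: then `y` is a common neighbour for
  -- every subset, so this one summand is positive.
  clusters-pos : ∀ q r a → 1 ≤ ∑ vs deg → 1 ≤ ∑ (vecs vs a) (λ x → ∏ (subsets a) (λ R → restrict r (cluster q) R x))
  clusters-pos q r a pos with y , 1≤deg ← 1≤∑⇒∃ vs deg pos with v , 1≤Evy ← 1≤∑⇒∃ vs (λ v → bit (E v y)) 1≤deg =
    ≤-trans (∏-pos (subsets a) λ R → restricted R) (≤∑-vecs-replicate (every v) a _)
    where
    Evy : ∀ b → 1 ≤ bit b → b ≡ true
    Evy true _ = refl
    codeg-pos : ∀ S → 1 ≤ codeg S (Vec.replicate a v)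
    codeg-pos S = ≤-trans (≤-reflexive (sym (common-replicate S v y (Evy (E v y) 1≤Evy)))) (∈⇒≤∑ (common S (Vec.replicate a v)) (every y))
    restricted : ∀ R → 1 ≤ restrict r (cluster q) R (Vec.replicate a v)
    restricted R with ofSize r R
    ... | true  = ∏-pos (subsetsOf R) λ S → m^n>0 _ {{>-nonZero (codeg-pos S)}} (q (size S))
    ... | false = s≤s z≤n

  module _ {a : ℕ} (Ns : List (Vec Bool a)) (s d₀ : ℕ) (q : ℕ → ℕ) where

    private
      r D e e′ B′ : ℕ
      r = suc s
      D = count a r
      e = ∑ Ns size
      e′ = ∑ (subsets r) (λ S → size S * q (size S))
      B′ = ∑ (subsets r) (λ S → q (size S))

    K′ : ℕ
    K′ = ∑ (vecs vs r) (cluster q (full r))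

    -- Sidorenko's inequality, cleared of denominators, for the graph of one cluster, which has r +
    -- B′ vertices and e′ edges.
    cluster-bound : q 0 ≡ 0 → 1 ≤ q r → ∑ vs deg ^ e′ * n ^ (r + B′) ≤ K′ * n ^ (2 * e′)
    cluster-bound q0 1≤qr = begin
      ∑ vs deg ^ e′ * n ^ (r + B′)           ≡⟨ cong (λ k → ∑ vs deg ^ k * n ^ (r + B′)) e′≡ ⟩
      ∑ vs deg ^ suc (Q + t) * n ^ (r + B′)  ≤⟨ *-monoˡ-≤ (n ^ (r + B′)) (local-bound s t q′ r+X≡) ⟩
      K s t q′ * n ^ (X + t) * n ^ (r + B′)  ≡⟨ *-assoc (K s t q′) _ _ ⟩
      K s t q′ * (n ^ (X + t) * n ^ (r + B′)) ≡⟨ cong₂ _*_ K≡ (trans (sym (^-distribˡ-+-* n (X + t) (r + B′))) (cong (n ^_) exponent)) ⟩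
      K′ * n ^ (2 * e′)                      ∎
      where
      open ≤-Reasoning
      -- One vertex joined to all r coordinates is set aside as the centre of the stars in
      -- `local-bound`; `q′` counts the remaining vertices.
      δ q′ : ℕ → ℕ
      δ k = bit (k ≡ᵇ r)
      q′ k = q k ∸ δ k
      δ≤q : ∀ k → δ k ≤ q k
      δ≤q k with k ≡ᵇ r | ≡ᵇ⇒≡ k r
      ... | false | _ = z≤n
      ... | true  | eq = subst (λ j → 1 ≤ q j) (sym (eq tt)) 1≤qr
      q≡ : ∀ k → δ k + q′ k ≡ q k
      q≡ k = m+[n∸m]≡n (δ≤q k)
      Q X t : ℕ
      Q = ∑ (subsets r) (λ S → q′ (size S))
      X = ∑ (subsets r) (λ S → size S * q′ (size S))
      -- No truncation occurs: by `q 0 ≡ 0` every counted vertex has degree at least 1, so B′ ≤ e′.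
      t = e′ ∸ B′
      ∑δ : ∑ (subsets r) (λ S → δ (size S)) ≡ 1
      ∑δ = trans (∑-subsets-size r r) (nCn≡1 r)
      B′≡ : B′ ≡ suc Q
      B′≡ = trans (∑-cong (subsets r) λ S → sym (q≡ (size S))) (trans (∑-+ (subsets r) _ _) (cong (_+ Q) ∑δ))
      size*δ : ∀ (S : Vec Bool r) → size S * δ (size S) ≡ r * δ (size S)
      size*δ S with size S ≡ᵇ r | ≡ᵇ⇒≡ (size S) r
      ... | true  | eq = cong (_* 1) (eq tt)
      ... | false | _  = trans (*-zeroʳ (size S)) (sym (*-zeroʳ r))
      r+X : e′ ≡ r + X
      r+X = begin-equality
        e′
          ≡⟨ ∑-cong (subsets r) (λ S → trans (cong (size S *_) (sym (q≡ (size S)))) (*-distribˡ-+ (size S) _ _)) ⟩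
        ∑ (subsets r) (λ S → size S * δ (size S) + size S * q′ (size S))
          ≡⟨ ∑-+ (subsets r) _ _ ⟩
        ∑ (subsets r) (λ S → size S * δ (size S)) + X
          ≡⟨ cong (_+ X) (trans (∑-cong (subsets r) size*δ) (trans (∑-*ˡ (subsets r) r _) (trans (cong (r *_) ∑δ) (*-identityʳ r)))) ⟩
        r + X ∎
      B′≤e′ : B′ ≤ e′
      B′≤e′ = ∑-mono (subsets r) λ S → positive-size (size S)
        where
        positive-size : ∀ k → q k ≤ k * q k
        positive-size zero    = ≤-reflexive q0
        positive-size (suc k) = m≤m+n (q (suc k)) _
      e′≡ : e′ ≡ suc (Q + t)
      e′≡ = trans (sym (m+[n∸m]≡n B′≤e′)) (cong (_+ t) B′≡)
      r+X≡ : r + X ≡ suc (Q + t)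
      r+X≡ = trans (sym r+X) e′≡
      exponent : X + t + (r + B′) ≡ 2 * e′
      exponent = trans (id₁ X t r B′) (cong₂ (λ u v → u + (v + 0)) (sym r+X) (m+[n∸m]≡n B′≤e′))
        where
        id₁ : ∀ x t r b → x + t + (r + b) ≡ (r + x) + (b + t + 0)
        id₁ = solve-∀
      K≡ : K s t q′ ≡ K′
      K≡ = ∑-cong (vecs vs r) λ x → begin-equality
        codeg (full r) x * ∏ (subsets r) (λ S → codeg S x ^ q′ (size S))
          ≡⟨ cong (_* ∏ (subsets r) (λ S → codeg S x ^ q′ (size S))) (sym (∏-full r (λ S → codeg S x))) ⟩
        ∏ (subsets r) (λ S → codeg S x ^ δ (size S)) * ∏ (subsets r) (λ S → codeg S x ^ q′ (size S))
          ≡⟨ sym (∏-* (subsets r) _ _) ⟩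
        ∏ (subsets r) (λ S → codeg S x ^ δ (size S) * codeg S x ^ q′ (size S))
          ≡⟨ ∏-cong (subsets r) (λ S → trans (sym (^-distribˡ-+-* (codeg S x) (δ (size S)) (q′ (size S)))) (cong (codeg S x ^_) (q≡ (size S)))) ⟩
        ∏ (subsets r) (λ S → codeg S x ^ q (size S))
          ≡⟨ cong (λ Ss → ∏ Ss (λ S → codeg S x ^ q (size S))) (subsets≡subsetsOf-full r) ⟩
        cluster q (full r) x ∎

    -- Reflection bounds the D-th power of the mean of one cluster, so `cluster-bound` enters to the
    -- power D. This accounts for all edges and for all vertices of positive degree in B; the `d₀`
    -- isolated ones contribute `n ^ d₀` through symmetrisation.
    counting-bound : r ≤ a → q 0 ≡ 0 → 1 ≤ q r →
      (∀ φ → ∏ Ns (φ ∘ size) ≡ φ 0 ^ d₀ * ∏ (subsets r) (λ S → φ (size S) ^ q (size S)) ^ D) →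
      1 ≤ ∑ vs deg →
      ∑ vs deg ^ e * n ^ (a + length Ns) ≤ ∑ (vecs vs a) (λ x → ∏ Ns (λ N → codeg N x)) * n ^ (2 * e)
    counting-bound r≤a q0 1≤qr degrees pos = *-cancelʳ-≤ _ _ (N ^ D) {{m^n≢0 N D {{m^n≢0 n a {{n≢0}}}}}} (begin
      m ^ e * n ^ (a + length Ns) * N ^ D
        ≡⟨ cong₂ (λ i j → m ^ i * n ^ (a + j) * N ^ D) e≡ length≡ ⟩
      m ^ (e′ * D) * n ^ (a + (d₀ + B′ * D)) * N ^ D
        ≡⟨ step₁ ⟩
      n ^ d₀ * ((m ^ e′ * n ^ (a + B′)) ^ D * N)
        ≤⟨ *-monoʳ-≤ (n ^ d₀) (*-monoˡ-≤ N (^-monoˡ-≤ D first)) ⟩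
      n ^ d₀ * ((M * n ^ (2 * e′)) ^ D * N)
        ≡⟨ step₂ ⟩
      n ^ d₀ * n ^ (2 * e) * (M ^ D * N)
        ≤⟨ *-monoʳ-≤ (n ^ d₀ * n ^ (2 * e)) (Reflection.reflection-inequality vs r≤a (cluster q) (λ p → cluster-reflective q p) (clusters-pos q r a pos)) ⟩
      n ^ d₀ * n ^ (2 * e) * (P * N ^ D)
        ≡⟨ id₃ (n ^ d₀) (n ^ (2 * e)) P (N ^ D) ⟩
      n ^ d₀ * P * (n ^ (2 * e) * N ^ D)
        ≤⟨ *-monoˡ-≤ (n ^ (2 * e) * N ^ D) (Symmetrise.symmetrisation vs E r q Ns d₀ restricted) ⟩
      ∑ (vecs vs a) (λ x → ∏ Ns (λ N → codeg N x)) * (n ^ (2 * e) * N ^ D)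
        ≡⟨ sym (*-assoc (∑ (vecs vs a) (λ x → ∏ Ns (λ N → codeg N x))) _ _) ⟩
      ∑ (vecs vs a) (λ x → ∏ Ns (λ N → codeg N x)) * n ^ (2 * e) * N ^ D ∎)
      where
      open ≤-Reasoning
      m M N P : ℕ
      m = ∑ vs deg
      M = ∑ (vecs vs a) (cluster q (initial a r))
      N = n ^ a
      P = ∑ (vecs vs a) (λ x → ∏ (subsets a) (λ R → restrict r (cluster q) R x))
      n≢0 : NonZero n
      n≢0 with v , _ ← 1≤∑⇒∃ vs deg pos = >-nonZero (≤-trans (∈⇒≤∑ (λ _ → 1) (every v)) (≤-reflexive (length-∑ vs)))
      c : ℕ
      c = cosize (initial a r)
      M≡ : M ≡ n ^ c * K′
      M≡ = trans (∑-cluster q (initial a r)) (cong (λ k → n ^ c * ∑ (vecs vs k) (cluster q (full k))) (size-initial r≤a))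
      first : m ^ e′ * n ^ (a + B′) ≤ M * n ^ (2 * e′)
      first = begin
        m ^ e′ * n ^ (a + B′)              ≡⟨ cong (λ k → m ^ e′ * n ^ k) (trans (cong (_+ B′) (sym (cosize-initial r≤a))) (+-assoc c r B′)) ⟩
        m ^ e′ * n ^ (c + (r + B′))        ≡⟨ cong (m ^ e′ *_) (^-distribˡ-+-* n c (r + B′)) ⟩
        m ^ e′ * (n ^ c * n ^ (r + B′))    ≡⟨ id₁ (m ^ e′) (n ^ c) (n ^ (r + B′)) ⟩
        n ^ c * (m ^ e′ * n ^ (r + B′))    ≤⟨ *-monoʳ-≤ (n ^ c) (cluster-bound q0 1≤qr) ⟩
        n ^ c * (K′ * n ^ (2 * e′))        ≡⟨ sym (*-assoc (n ^ c) _ _) ⟩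
        n ^ c * K′ * n ^ (2 * e′)          ≡⟨ cong (_* n ^ (2 * e′)) (sym M≡) ⟩
        M * n ^ (2 * e′)                   ∎
        where
        id₁ : ∀ x y z → x * (y * z) ≡ y * (x * z)
        id₁ = solve-∀
      -- Testing `degrees` on powers of 2 and comparing exponents makes it additive. The identity
      -- function for `f` then counts edges, and the constant 1 counts the members of `Ns`.
      2^-degrees : ∀ (f : ℕ → ℕ) → f 0 * d₀ + ∑ (subsets r) (λ S → f (size S) * q (size S)) * D ≡ ∑ Ns (f ∘ size)
      2^-degrees f = 2^-injective (begin-equality
        2 ^ (f 0 * d₀ + ∑ (subsets r) (λ S → f (size S) * q (size S)) * D)
          ≡⟨ ^-distribˡ-+-* 2 (f 0 * d₀) _ ⟩
        2 ^ (f 0 * d₀) * 2 ^ (∑ (subsets r) (λ S → f (size S) * q (size S)) * D)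
          ≡⟨ cong₂ _*_ (sym (^-*-assoc 2 (f 0) d₀)) (trans (sym (^-*-assoc 2 (∑ (subsets r) (λ S → f (size S) * q (size S))) D)) (cong (_^ D) (trans (sym (^-∑ 2 (subsets r) (λ S → f (size S) * q (size S))))
               (∏-cong (subsets r) λ S → sym (^-*-assoc 2 (f (size S)) (q (size S))))))) ⟩
        (2 ^ f 0) ^ d₀ * ∏ (subsets r) (λ S → (2 ^ f (size S)) ^ q (size S)) ^ D
          ≡⟨ sym (degrees (λ k → 2 ^ f k)) ⟩
        ∏ Ns (λ N → 2 ^ f (size N))
          ≡⟨ ^-∑ 2 Ns _ ⟩
        2 ^ ∑ Ns (f ∘ size) ∎)
      e≡ : e ≡ e′ * D
      e≡ = sym (2^-degrees (λ k → k))
      length≡ : length Ns ≡ d₀ + B′ * D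
      length≡ = sym (trans (cong₂ _+_ (sym (*-identityˡ d₀)) (cong (_* D) (∑-cong (subsets r) λ S → sym (*-identityˡ _)))) (trans (2^-degrees (λ _ → 1)) (length-∑ Ns)))
      step₁ : m ^ (e′ * D) * n ^ (a + (d₀ + B′ * D)) * N ^ D ≡ n ^ d₀ * ((m ^ e′ * n ^ (a + B′)) ^ D * N)
      step₁ = begin-equality
        m ^ (e′ * D) * n ^ (a + (d₀ + B′ * D)) * N ^ D
          ≡⟨ cong (λ z → m ^ (e′ * D) * z * N ^ D) (trans (^-distribˡ-+-* n a _) (cong (N *_) (^-distribˡ-+-* n d₀ (B′ * D)))) ⟩
        m ^ (e′ * D) * (N * (n ^ d₀ * n ^ (B′ * D))) * N ^ D
          ≡⟨ cong₂ (λ y z → y * (N * (n ^ d₀ * z)) * N ^ D) (sym (^-*-assoc m e′ D)) (sym (^-*-assoc n B′ D)) ⟩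
        (m ^ e′) ^ D * (N * (n ^ d₀ * (n ^ B′) ^ D)) * N ^ D
          ≡⟨ id₁ ((m ^ e′) ^ D) N (n ^ d₀) ((n ^ B′) ^ D) (N ^ D) ⟩
        n ^ d₀ * ((m ^ e′) ^ D * (N ^ D * (n ^ B′) ^ D) * N)
          ≡⟨ cong (λ z → n ^ d₀ * ((m ^ e′) ^ D * z * N)) (trans (sym (^-distribʳ-* N (n ^ B′) D)) (cong (_^ D) (sym (^-distribˡ-+-* n a B′)))) ⟩
        n ^ d₀ * ((m ^ e′) ^ D * (n ^ (a + B′)) ^ D * N)
          ≡⟨ cong (λ z → n ^ d₀ * (z * N)) (sym (^-distribʳ-* (m ^ e′) (n ^ (a + B′)) D)) ⟩
        n ^ d₀ * ((m ^ e′ * n ^ (a + B′)) ^ D * N) ∎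
        where
        id₁ : ∀ x N d b y → x * (N * (d * b)) * y ≡ d * (x * (y * b) * N)
        id₁ = solve-∀
      step₂ : n ^ d₀ * ((M * n ^ (2 * e′)) ^ D * N) ≡ n ^ d₀ * n ^ (2 * e) * (M ^ D * N)
      step₂ = begin-equality
        n ^ d₀ * ((M * n ^ (2 * e′)) ^ D * N)
          ≡⟨ cong (λ z → n ^ d₀ * (z * N)) (^-distribʳ-* M (n ^ (2 * e′)) D) ⟩
        n ^ d₀ * (M ^ D * (n ^ (2 * e′)) ^ D * N)
          ≡⟨ cong (λ z → n ^ d₀ * (M ^ D * z * N)) (trans (^-*-assoc n (2 * e′) D) (cong (n ^_) (trans (*-assoc 2 e′ D) (cong (2 *_) (sym e≡))))) ⟩
        n ^ d₀ * (M ^ D * n ^ (2 * e) * N)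
          ≡⟨ id₁ (n ^ d₀) (M ^ D) (n ^ (2 * e)) N ⟩
        n ^ d₀ * n ^ (2 * e) * (M ^ D * N) ∎
        where
        id₁ : ∀ d x y N → d * (x * y * N) ≡ d * y * (x * N)
        id₁ = solve-∀
      id₃ : ∀ d y p z → d * y * (p * z) ≡ d * p * (y * z)
      id₃ = solve-∀
      restricted : ∀ φ → ∏ Ns (φ ∘ size) ≡ φ 0 ^ d₀ * ∏ (subsets a) (λ R → if ofSize r R then ∏ (subsetsOf R) (λ S → φ (size S) ^ q (size S)) else 1)
      restricted φ = trans (degrees φ) (cong (φ 0 ^ d₀ *_) (sym (trans (∏-cong (subsets a) same) (∏-ofSize-const a r _))))
        where
        same : ∀ R → (if ofSize r R then ∏ (subsetsOf R) (λ S → φ (size S) ^ q (size S)) else 1) ≡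
                     (if ofSize r R then ∏ (subsets r) (λ S → φ (size S) ^ q (size S)) else 1)
        same R with ofSize r R | ≡ᵇ⇒≡ (size R) r
        ... | false | _  = refl
        ... | true  | eq = trans (∏-subsetsOf-size R (λ k → φ k ^ q k)) (cong (λ k → ∏ (subsets k) (λ S → φ (size S) ^ q (size S))) (eq tt))

-- Clearing denominators in the rationals

/-toℚᵘ : ∀ a b .{{_ : NonZero b}} → ℚ.toℚᵘ (ℤ.+ a ℚ./ b) ℚᵘ.≃ (ℤ.+ a ℚᵘ./ b)
/-toℚᵘ a (suc b) = ℚ.toℚᵘ-fromℚᵘ (ℚᵘ.mkℚᵘ (ℤ.+ a) b)

/-*-/ : ∀ a b c d .{{_ : NonZero b}} .{{d≢0 : NonZero d}} .{{_ : NonZero (b * d)}} →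
  (ℤ.+ a ℚᵘ./ b) ℚᵘ.* (ℤ.+ c ℚᵘ./ d) ℚᵘ.≃ (ℤ.+ (a * c) ℚᵘ./ (b * d))
/-*-/ a (suc b) c (suc d) = ℚᵘ.≃-reflexive (cong (λ z → z ℚᵘ./ (suc b * suc d)) (sym (ℤ.pos-* a c)))

^ℚ-toℚᵘ : ∀ a b e .{{_ : NonZero b}} .{{be≢0 : NonZero (b ^ e)}} →
  ℚ.toℚᵘ ((ℤ.+ a ℚ./ b) ^ℚ e) ℚᵘ.≃ (ℤ.+ (a ^ e) ℚᵘ./ (b ^ e))
^ℚ-toℚᵘ a b zero    = ℚᵘ.≃-refl
^ℚ-toℚᵘ a b (suc e) = ℚᵘ.≃-trans (ℚ.toℚᵘ-homo-* (ℤ.+ a ℚ./ b) ((ℤ.+ a ℚ./ b) ^ℚ e))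
  (ℚᵘ.≃-trans (ℚᵘ.*-cong (/-toℚᵘ a b) (^ℚ-toℚᵘ a b e {{be≢0 = m^n≢0 b e}})) (/-*-/ a b (a ^ e) (b ^ e) {{d≢0 = m^n≢0 b e}}))

/≤/ : ∀ a b c d .{{_ : NonZero b}} .{{_ : NonZero d}} → a * d ≤ c * b → (ℤ.+ a ℚᵘ./ b) ℚᵘ.≤ (ℤ.+ c ℚᵘ./ d)
/≤/ a (suc b) c (suc d) le = ℚᵘ.*≤* (subst₂ ℤ._≤_ (ℤ.pos-* a (suc d)) (ℤ.pos-* c (suc b)) (ℤ.+≤+ le))

-- The comparison takes place among unnormalised rationals, where a power of a fraction is the
-- fraction of the powers and the order is cross-multiplication.
^ℚ≤/ : ∀ a b e c d .{{_ : NonZero b}} .{{_ : NonZero d}} → a ^ e * d ≤ c * b ^ e → (ℤ.+ a ℚ./ b) ^ℚ e ℚ.≤ ℤ.+ c ℚ./ d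
^ℚ≤/ a b e c d le = ℚ.toℚᵘ-cancel-≤ (ℚᵘ.≤-respˡ-≃ (ℚᵘ.≃-sym (^ℚ-toℚᵘ a b e {{be≢0 = m^n≢0 b e}}))
  (ℚᵘ.≤-respʳ-≃ (ℚᵘ.≃-sym (/-toℚᵘ c d)) (/≤/ (a ^ e) (b ^ e) c d {{m^n≢0 b e}} le)))

-- Degree data of H and the final inequality

∈⇒≤max : ∀ {xs x} → x ∈ xs → x ≤ foldr _⊔_ 0 xs
∈⇒≤max {y ∷ xs} (here refl) = m≤m⊔n y _
∈⇒≤max {y ∷ xs} (there x∈)  = ≤-trans (∈⇒≤max x∈) (m≤n⊔m y _)

max∈ : ∀ xs → 1 ≤ foldr _⊔_ 0 xs → foldr _⊔_ 0 xs ∈ xs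
max∈ (x ∷ xs) pos with ⊔-sel x (foldr _⊔_ 0 xs)
... | inj₁ eq rewrite eq = here refl
... | inj₂ eq rewrite eq = there (max∈ xs pos)

module Conclusion {m : ℕ} (H : SimpleGraph m) (inA : Fin m → Bool) (bip : IsBipartition H inA)
  (div : ∀ k → 1 ≤ k → k ≤ maxDegB H inA → ((sizeA inA C maxDegB H inA) * (maxDegB H inA C k)) ∣ dB H inA k) where

  open Bipartite H inA bip

  a r e D : ℕ
  a = size A
  r = maxDegB H inA
  e = ∑ neighbourhoods size
  D = count a r

  D≡ : D ≡ sizeA inA C r
  D≡ = trans (∑-subsets-size a r) (cong (_C r) (sym sizeA≡))

  -- The quotient of d_k by C(a,r) C(r,k). Divisibility is given for 1 ≤ k ≤ r only: degree 0 is
  -- recorded separately as `dB H inA 0`, and beyond `r` the value 0 is a default.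
  q : ℕ → ℕ
  q zero    = 0
  q (suc k) with suc k ≤? r
  ... | yes k≤r = quotient (div (suc k) (s≤s z≤n) k≤r)
  ... | no  _   = 0

  dB≡ : ∀ k → 1 ≤ k → k ≤ r → dB H inA k ≡ q k * ((r C k) * D)
  dB≡ (suc k) _ k≤r with suc k ≤? r
  ... | no  k≰r  = contradiction k≤r k≰r
  ... | yes k≤r′ = trans (_∣_.equality (div (suc k) (s≤s z≤n) k≤r′))
    (cong (quotient (div (suc k) (s≤s z≤n) k≤r′) *_) (trans (*-comm (sizeA inA C r) _) (cong ((r C suc k) *_) (sym D≡))))

  degree-sideB : ∀ {b} → b ∈ sideB inA → degree H b ≡ size (neighbours b)
  degree-sideB {b} b∈ = degree≡ b (not-true (proj₂ (∈-filter⁻ (T? ∘ not ∘ inA) {xs = allFin m} b∈)))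
    where
    not-true : ∀ {c} → T (not c) → c ≡ false
    not-true {false} _ = refl

  degree≤r : ∀ {b} → b ∈ sideB inA → degree H b ≤ r
  degree≤r b∈ = ∈⇒≤max (∈-map⁺ (degree H) b∈)

  -- An equality of multisets of degrees, expressed by testing all multiplicative functions `φ`.
  -- Each of the D sets of size r accounts for C(r,k) times `q k` vertices of degree k, which totals
  -- d_k by `dB≡`.
  degrees : ∀ φ → ∏ neighbourhoods (φ ∘ size) ≡ φ 0 ^ dB H inA 0 * ∏ (subsets r) (λ S → φ (size S) ^ q (size S)) ^ D
  degrees φ = begin
    ∏ neighbourhoods (φ ∘ size)
      ≡⟨ ∏-map neighbours (sideB inA) _ ⟩
    ∏ (sideB inA) (λ b → φ (size (neighbours b)))
      ≡⟨ ∏-cong-∈ (sideB inA) (λ b∈ → cong φ (sym (degree-sideB b∈))) ⟩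
    ∏ (sideB inA) (φ ∘ degree H)
      ≡⟨ ∏-by-value (sideB inA) (degree H) r φ degree≤r ⟩
    ∏ (allFin (suc r)) (λ i → φ (toℕ i) ^ ∑ (sideB inA) (λ b → bit (degree H b ≡ᵇ toℕ i)))
      ≡⟨ ∏-cong (allFin (suc r)) (λ i → cong (φ (toℕ i) ^_) (sym (length-filterᵇ (λ b → degree H b ≡ᵇ toℕ i) (sideB inA)))) ⟩
    ∏ (allFin (suc r)) (λ i → φ (toℕ i) ^ dB H inA (toℕ i))
      ≡⟨ ∏-allFin-suc r (λ i → φ (toℕ i) ^ dB H inA (toℕ i)) ⟩
    φ 0 ^ dB H inA 0 * ∏ (allFin r) (λ i → φ (suc (toℕ i)) ^ dB H inA (suc (toℕ i)))
      ≡⟨ cong (φ 0 ^ dB H inA 0 *_) (∏-cong (allFin r) λ i → by-degree (suc (toℕ i)) (s≤s z≤n) (toℕ<n i)) ⟩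
    φ 0 ^ dB H inA 0 * ∏ (allFin r) (λ i → ψ (suc (toℕ i)) ^ D)
      ≡⟨ cong (φ 0 ^ dB H inA 0 *_) (trans (∏-^ (allFin r) (ψ ∘ suc ∘ toℕ) D) (cong (_^ D) (sym drop-0))) ⟩
    φ 0 ^ dB H inA 0 * ∏ (allFin (suc r)) (λ i → ψ (toℕ i)) ^ D
      ≡⟨ cong (λ z → φ 0 ^ dB H inA 0 * z ^ D) (sym (∏-subsets-binomial r (λ k → φ k ^ q k))) ⟩
    φ 0 ^ dB H inA 0 * ∏ (subsets r) (λ S → φ (size S) ^ q (size S)) ^ D ∎
    where
    open ≡-Reasoning
    ψ : ℕ → ℕ
    ψ k = (φ k ^ q k) ^ (r C k)
    by-degree : ∀ k → 1 ≤ k → k ≤ r → φ k ^ dB H inA k ≡ ψ k ^ D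
    by-degree k 1≤k k≤r = begin
      φ k ^ dB H inA k               ≡⟨ cong (φ k ^_) (dB≡ k 1≤k k≤r) ⟩
      φ k ^ (q k * ((r C k) * D))    ≡⟨ sym (^-*-assoc (φ k) (q k) _) ⟩
      (φ k ^ q k) ^ ((r C k) * D)    ≡⟨ sym (^-*-assoc (φ k ^ q k) (r C k) D) ⟩
      ψ k ^ D                        ∎
    drop-0 : ∏ (allFin (suc r)) (λ i → ψ (toℕ i)) ≡ ∏ (allFin r) (ψ ∘ suc ∘ toℕ)
    drop-0 = trans (∏-allFin-suc r (ψ ∘ toℕ)) (trans (cong (_* ∏ (allFin r) (ψ ∘ suc ∘ toℕ)) (^-zeroˡ (r C 0))) (*-identityˡ _))

  m≡ : a + length neighbourhoods ≡ m
  m≡ = begin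
    a + length neighbourhoods
      ≡⟨ cong₂ _+_ (size-tabulate inA) (trans (length-map neighbours (sideB inA)) (length-filterᵇ (not ∘ inA) (allFin m))) ⟩
    ∑ (allFin m) (bit ∘ inA) + ∑ (allFin m) (bit ∘ not ∘ inA)
      ≡⟨ sym (∑-+ (allFin m) _ _) ⟩
    ∑ (allFin m) (λ i → bit (inA i) + bit (not (inA i)))
      ≡⟨ ∑-cong (allFin m) (λ i → either (inA i)) ⟩
    ∑ (allFin m) (λ _ → 1)
      ≡⟨ trans (length-∑ (allFin m)) (length-tabulate (λ i → i)) ⟩
    m ∎
    where
    open ≡-Reasoning
    either : ∀ b → bit b + bit (not b) ≡ 1
    either true  = refl
    either false = refl

  module _ (n′ : ℕ) (G : SimpleGraph (suc n′)) where

    private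
      vs : List (Fin (suc n′))
      vs = allFin (suc n′)
    open Codegree vs (adj G)
    open LocalBound vs ∈-allFin (adj G) using (deg)

    homCount-K₂ : homCount K₂ G ≡ ∑ vs deg
    homCount-K₂ = begin
      homCount K₂ G
        ≡⟨ Bipartite.homCount-codeg K₂ left bip₂ G ⟩
      ∑ (vecs vs 1) (λ x → codeg (true ∷ []) x * 1)
        ≡⟨ ∑-vecs-suc vs 0 _ ⟩
      ∑ vs (λ v → ∑ vs (λ y → bit (adj G v y) * 1) * 1 + 0)
        ≡⟨ ∑-cong vs (λ v → trans (+-identityʳ _) (trans (*-identityʳ _) (∑-cong vs λ y → *-identityʳ _))) ⟩
      ∑ vs (λ v → ∑ vs (λ y → bit (adj G v y)))
        ≡⟨ ∑-swap vs vs (λ v y → bit (adj G v y)) ⟩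
      ∑ vs deg ∎
      where
      open ≡-Reasoning
      left : Fin 2 → Bool
      left zero    = true
      left (suc _) = false
      bip₂ : IsBipartition K₂ left
      bip₂ zero       (suc zero) _ = refl
      bip₂ (suc zero) zero       _ = refl
      bip₂ (suc zero) (suc zero) ()

    hom : ℕ
    hom = ∑ (vecs vs a) (λ x → ∏ neighbourhoods (λ N → codeg N x))

    length-vs : length vs ≡ suc n′
    length-vs = length-tabulate (λ i → i)

    no-edges : e ≡ 0 → hom ≡ length vs ^ m
    no-edges e≡0 = begin
      ∑ (vecs vs a) (λ x → ∏ neighbourhoods (λ N → codeg N x))
        ≡⟨ ∑-cong (vecs vs a) (λ x → ∏-cong-∈ neighbourhoods λ {N} N∈ → trans (∑-cong vs (common-∅ N x (n≤0⇒n≡0 (≤-trans (∈⇒≤∑ size N∈) (≤-reflexive e≡0))))) (length-∑ vs)) ⟩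
      ∑ (vecs vs a) (λ x → ∏ neighbourhoods (λ N → length vs))
        ≡⟨ trans (∑-const (vecs vs a) _) (cong₂ _*_ (length-vecs vs a) (∏-const neighbourhoods (length vs))) ⟩
      length vs ^ a * length vs ^ length neighbourhoods
        ≡⟨ trans (sym (^-distribˡ-+-* (length vs) a _)) (cong (length vs ^_) m≡) ⟩
      length vs ^ m ∎
      where
      open ≡-Reasoning
      common-∅ : ∀ {a} (S : Vec Bool a) x → size S ≡ 0 → ∀ y → common S x y ≡ 1
      common-∅ []          []      _  y = refl
      common-∅ (false ∷ S) (v ∷ x) eq y = trans (*-identityˡ _) (common-∅ S x eq y)

    1≤r : 1 ≤ e → 1 ≤ r
    1≤r pos = n≢0⇒n>0 λ r≡0 → <⇒≱ pos (begin
      e                                           ≡⟨ ∑-map neighbours (sideB inA) size ⟩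
      ∑ (sideB inA) (λ b → size (neighbours b))   ≤⟨ ∑-mono-∈ (sideB inA) (λ b∈ → ≤-trans (≤-reflexive (sym (degree-sideB b∈))) (degree≤r b∈)) ⟩
      ∑ (sideB inA) (λ _ → r)                     ≡⟨ ∑-const (sideB inA) r ⟩
      length (sideB inA) * r                      ≡⟨ trans (cong (length (sideB inA) *_) r≡0) (*-zeroʳ (length (sideB inA))) ⟩
      0                                           ∎)
      where open ≤-Reasoning

    max-degree-vertex : 1 ≤ r → ∃ λ b → b ∈ sideB inA × r ≡ degree H b
    max-degree-vertex pos = ∈-map⁻ (degree H) (max∈ (map (degree H) (sideB inA)) pos)

    r≤a : 1 ≤ r → r ≤ a
    r≤a pos with b , b∈ , eq ← max-degree-vertex pos =
      ≤-trans (≤-reflexive (trans eq (degree-sideB b∈))) (size≤ (neighbours b))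

    1≤q[r] : 1 ≤ r → 1 ≤ q r
    1≤q[r] pos with b , b∈ , eq ← max-degree-vertex pos = n≢0⇒n>0 λ q≡0 → <⇒≱ 1≤dB
      (≤-reflexive (trans (dB≡ r pos ≤-refl) (cong (_* ((r C r) * D)) q≡0)))
      where
      same : ∀ {k l} → k ≡ l → 1 ≤ bit (l ≡ᵇ k)
      same {k} refl with k ≡ᵇ k | ≡⇒≡ᵇ k k refl
      ... | true | _ = s≤s z≤n
      1≤dB : 1 ≤ dB H inA r
      1≤dB = ≤-trans (same eq) (≤-trans (∈⇒≤∑ (λ b → bit (degree H b ≡ᵇ r)) b∈)
        (≤-reflexive (sym (length-filterᵇ (λ b → degree H b ≡ᵇ r) (sideB inA)))))

    -- The argument by reflection needs an edge in H, so that r is positive, and an edge in G, so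
    -- that the mean of the product of clusters is positive. Without edges in H both sides agree;
    -- without edges in G the left side is 0.
    count-bound : ∑ vs deg ^ e * length vs ^ m ≤ hom * length vs ^ (2 * e)
    count-bound with e ≟ 0 | ∑ vs deg ≟ 0
    ... | yes e≡0 | _ = ≤-reflexive (begin
      ∑ vs deg ^ e * length vs ^ m      ≡⟨ cong (λ k → ∑ vs deg ^ k * length vs ^ m) e≡0 ⟩
      1 * length vs ^ m                 ≡⟨ trans (*-identityˡ _) (sym (*-identityʳ _)) ⟩
      length vs ^ m * 1                 ≡⟨ cong₂ (λ h k → h * length vs ^ (2 * k)) (sym (no-edges e≡0)) (sym e≡0) ⟩
      hom * length vs ^ (2 * e)         ∎)
      where open ≡-Reasoning
    ... | no e≢0 | yes deg≡0 = ≤-trans (≤-reflexive (cong (_* length vs ^ m) (trans (cong (_^ e) deg≡0) (0^n≡0 (n≢0⇒n>0 e≢0))))) z≤n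
    ... | no e≢0 | no deg≢0 = subst (λ k → ∑ vs deg ^ e * length vs ^ k ≤ hom * length vs ^ (2 * e)) m≡
      (from-size (pred r) (sym (suc-pred r {{>-nonZero r>0}})))
      where
      r>0 : 1 ≤ r
      r>0 = 1≤r (n≢0⇒n>0 e≢0)
      -- `r` is a maximum rather than a variable, so its successor form is supplied as an equation
      -- and transported through each premise.
      from-size : ∀ s → r ≡ suc s → ∑ vs deg ^ e * length vs ^ (a + length neighbourhoods) ≤ hom * length vs ^ (2 * e)
      from-size s eq = Counting.counting-bound vs ∈-allFin (adj G) neighbourhoods s (dB H inA 0) q
        (subst (_≤ a) eq (r≤a r>0)) refl (subst (λ k → 1 ≤ q k) eq (1≤q[r] r>0))
        (λ φ → subst (λ k → ∏ neighbourhoods (φ ∘ size) ≡ φ 0 ^ dB H inA 0 * ∏ (subsets k) (λ S → φ (size S) ^ q (size S)) ^ count a k) eq (degrees φ))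
        (n≢0⇒n>0 deg≢0)

    density-bound : homCount K₂ G ^ edgeCount H * suc n′ ^ m ≤ homCount H G * (suc n′ ^ 2) ^ edgeCount H
    density-bound = begin
      homCount K₂ G ^ edgeCount H * suc n′ ^ m
        ≡⟨ cong₂ (λ k i → k ^ i * suc n′ ^ m) homCount-K₂ edgeCount≡ ⟩
      ∑ vs deg ^ e * suc n′ ^ m
        ≡⟨ cong (λ k → ∑ vs deg ^ e * k ^ m) (sym length-vs) ⟩
      ∑ vs deg ^ e * length vs ^ m
        ≤⟨ count-bound ⟩
      hom * length vs ^ (2 * e)
        ≡⟨ cong (λ k → hom * k ^ (2 * e)) length-vs ⟩
      hom * suc n′ ^ (2 * e)
        ≡⟨ cong₂ _*_ (sym (homCount-codeg G)) (trans (sym (^-*-assoc (suc n′) 2 e)) (cong ((suc n′ ^ 2) ^_) (sym edgeCount≡))) ⟩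
      homCount H G * (suc n′ ^ 2) ^ edgeCount H ∎
      where open ≤-Reasoning

theorem1p1 : ∀ {m : ℕ} (H : SimpleGraph m) (inA : Fin m → Bool) →
    IsBipartition H inA →
    (∀ (k : ℕ) → 1 ≤ k → k ≤ maxDegB H inA →
    ((sizeA inA C maxDegB H inA) * (maxDegB H inA C k)) ∣ dB H inA k) →
    SidorenkoHolds H
theorem1p1 {m} H inA bip div n G =
  ^ℚ≤/ (homCount K₂ G) (suc n ^ 2) (edgeCount H) (homCount H G) (suc n ^ m) {{m^n≢0 (suc n) 2}} {{m^n≢0 (suc n) m}}
    (Conclusion.density-bound H inA bip div n G)
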